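{- Let $\Pi$ be an LCL problem in rooted regular trees (without inputs). Then $\Pi$ has locality $n^{\Omega(1)}$ in the LOCAL model if and only if it has locality $n^{\Omega(1)}$ in the online-LOCAL model.
   Context: An LCL problem in rooted trees is a triple $\Pi=(\delta,\Gamma,C)$ where $\delta\ge 1$ is the number of allowed children, $\Gamma$ is a finite set of output labels, and $C\subseteq\Gamma^{\delta+1}$ is a set of allowed configurations $(a : b_1 b_2\dots b_\delta)$, meaning that a node labeled $a$ may have children labeled $b_1,\dots,b_\delta$ in some order. The inputs are rooted trees in which every non-leaf node has exactly $\delta$ children (no input labels); a labeling is feasible if every node with $\delta$ children, together with its children, forms an allowed configuration. $n$ is the number of nodes, known to algorithms; $B(v,T)$ is the set of nodes within distance $T$ of $v$. LOCAL model with locality $T$: the adversary assigns unique identifiers from $\{1,\dots,\mathrm{poly}(n)\}$; each node outputs a function of its radius-$T$ neighborhood. Online-LOCAL model with locality $T$: the adversary chooses an ordering $v_1,\dots,v_n$ of the nodes; with $G_i = G\bigl[\bigcup_{j\le i}B(v_j,T)\bigr]$, when $v_i$ is presented the algorithm, with unbounded memory, must irrevocably output the label of $v_i$ based on $v_1,\dots,v_i$ and $G_i$. An algorithm solves $\Pi$ if for every input and every adversarial choice the output is feasible. The locality of $\Pi$ in a model is the pointwise smallest function $T(n)$ such that some algorithm in that model solves $\Pi$ with locality at most $T$. "Locality $n^{\Omega(1)}$" means locality $\Omega(n^{\alpha})$ for some constant $\alpha>0$. -}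

module Defs where

open import Data.Nat using (ℕ; zero; suc; _+_; _*_; _^_; _≤_; _<_)
open import Data.Fin using (Fin; toℕ)
open import Data.Vec using (Vec; tabulate)
open import Data.List using (List)
open import Data.List.Membership.Propositional using (_∈_)
open import Data.Maybe using (Maybe; just; nothing; _>>=_)
open import Data.Product using (Σ; ∃; _×_; _,_)
open import Data.Sum using (_⊎_)
open import Data.Empty using (⊥)
open import Relation.Nullary using (¬_)
open import Relation.Binary.PropositionalEquality using (_≡_; _≢_)
open import Function.Definitions using (Injective)

-- LCL problems in rooted regular trees (no inputs).
-- Output labels Γ = Fin γ; C ⊆ Γ^{δ+1}, a configuration (a : b₁ … b_δ)
-- is a pair (a , [b₁ … b_δ]).

record LCL : Set where
  field
    δ   : ℕ
    δ≥1 : 1 ≤ δ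
    γ   : ℕ
    C   : List (Fin γ × Vec (Fin γ) δ)

ancestor : {n : ℕ} → (Fin n → Maybe (Fin n)) → ℕ → Fin n → Maybe (Fin n)
ancestor p zero    v = just v
ancestor p (suc k) v = ancestor p k v >>= p

ChildEnum : {n : ℕ} (δ : ℕ) → (Fin n → Maybe (Fin n)) → Fin n → (Fin δ → Fin n) → Set
ChildEnum δ p v f =
  Injective _≡_ _≡_ f × (∀ k → p (f k) ≡ just v) × (∀ w → p w ≡ just v → ∃ λ k → f k ≡ w)

record RTree (δ n : ℕ) : Set where
  field
    parent   : Fin n → Maybe (Fin n)
    root     : Fin n
    root-nil : parent root ≡ nothing
    root-uniq : ∀ v → parent v ≡ nothing → v ≡ root
    reach    : ∀ v → ∃ λ k → ancestor parent k v ≡ nothing   -- connected, acyclic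
    arity    : ∀ v → (∀ w → parent w ≢ just v)
                     ⊎ (Σ (Fin δ → Fin n) λ f → ChildEnum δ parent v f)

open RTree public

Adj : {δ n : ℕ} → RTree δ n → Fin n → Fin n → Set
Adj t u w = parent t u ≡ just w ⊎ parent t w ≡ just u

data Dist≤ {δ n : ℕ} (t : RTree δ n) : ℕ → Fin n → Fin n → Set where
  here  : ∀ {k u} → Dist≤ t k u u
  step  : ∀ {k u w x} → Adj t u w → Dist≤ t k w x → Dist≤ t (suc k) u x

Ball : {δ n : ℕ} → RTree δ n → ℕ → Fin n → Fin n → Set
Ball t T v u = Dist≤ t T v u

Feasible : (Π : LCL) {n : ℕ} → RTree (LCL.δ Π) n → (Fin n → Fin (LCL.γ Π)) → Set
Feasible Π {n} t L =
  ∀ v → (f : Fin (LCL.δ Π) → Fin n) → ChildEnum (LCL.δ Π) (parent t) v f →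
  Σ (Fin (LCL.δ Π) → Fin n) λ g → ChildEnum (LCL.δ Π) (parent t) v g ×
    ((L v , tabulate (λ k → L (g k))) ∈ LCL.C Π)

record SubIso {δ n : ℕ} (t t' : RTree δ n) (S S' : Fin n → Set) : Set where
  field
    φ     : Fin n → Fin n
    ψ     : Fin n → Fin n
    φ∈    : ∀ u → S u → S' (φ u)
    ψ∈    : ∀ u → S' u → S (ψ u)
    ψφ    : ∀ u → S u → ψ (φ u) ≡ u
    φψ    : ∀ u → S' u → φ (ψ u) ≡ u
    par→  : ∀ u w → S u → S w → parent t u ≡ just w → parent t' (φ u) ≡ just (φ w)
    par←  : ∀ u w → S u → S w → parent t' (φ u) ≡ just (φ w) → parent t u ≡ just w

ValidIds : (n c : ℕ) → (Fin n → ℕ) → Set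
ValidIds n c id = Injective _≡_ _≡_ id × (∀ v → 1 ≤ id v × id v ≤ n ^ c)

-- A LOCAL algorithm for n-node inputs: a node's output depends only on
-- its radius-T neighbourhood G[B(v,T)] together with the identifiers in it.
LocalAlg : (Π : LCL) (n c T : ℕ) → Set
LocalAlg Π n c T =
  Σ (RTree (LCL.δ Π) n → (Fin n → ℕ) → Fin n → Fin (LCL.γ Π)) λ A →
    ∀ (t t' : RTree (LCL.δ Π) n) (id id' : Fin n → ℕ) (v v' : Fin n) →
    ValidIds n c id → ValidIds n c id' →
    (I : SubIso t t' (Ball t T v) (Ball t' T v')) →
    SubIso.φ I v ≡ v' →
    (∀ u → Ball t T v u → id' (SubIso.φ I u) ≡ id u) →
    A t id v ≡ A t' id' v'

LOCALSolvable : (c : ℕ) (Π : LCL) (n T : ℕ) → Set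
LOCALSolvable c Π n T =
  Σ (LocalAlg Π n c T) λ A →
    ∀ (t : RTree (LCL.δ Π) n) (id : Fin n → ℕ) → ValidIds n c id →
    Feasible Π t (λ v → Data.Product.proj₁ A t id v)

-- Online-LOCAL model.  The adversary's ordering is an injective
-- σ : Fin n → Fin n (v_i = σ i).  Revealed(t,σ,i) = ⋃_{j ≤ i} B(σ j, T).

Revealed : {δ n : ℕ} → RTree δ n → ℕ → (Fin n → Fin n) → Fin n → Fin n → Set
Revealed t T σ i u = ∃ λ j → toℕ j ≤ toℕ i × Ball t T (σ j) u

-- An online-LOCAL algorithm: A t σ i is the label output for σ i; it may
-- depend only on G_i = G[Revealed] together with v_1,…,v_i (up to
-- isomorphism, no identifiers).
OnlineAlg : (Π : LCL) (n T : ℕ) → Set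
OnlineAlg Π n T =
  Σ (RTree (LCL.δ Π) n → (Fin n → Fin n) → Fin n → Fin (LCL.γ Π)) λ A →
    ∀ (t t' : RTree (LCL.δ Π) n) (σ σ' : Fin n → Fin n) (i : Fin n) →
    Injective _≡_ _≡_ σ → Injective _≡_ _≡_ σ' →
    (I : SubIso t t' (Revealed t T σ i) (Revealed t' T σ' i)) →
    (∀ j → toℕ j ≤ toℕ i → SubIso.φ I (σ j) ≡ σ' j) →
    A t σ i ≡ A t' σ' i

OnlineSolvable : (Π : LCL) (n T : ℕ) → Set
OnlineSolvable Π n T =
  Σ (OnlineAlg Π n T) λ A →
    ∀ (t : RTree (LCL.δ Π) n) (σ : Fin n → Fin n) → Injective _≡_ _≡_ σ →
    (L : Fin n → Fin (LCL.γ Π)) → (∀ i → L (σ i) ≡ Data.Product.proj₁ A t σ i) →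
    Feasible Π t L

-- "locality n^{Ω(1)}": there are α = p/q > 0, a constant K ≥ 1 and n₀
-- such that for every n ≥ n₀ for which n-node inputs exist, Π is not
-- solvable with any locality T with K·T^q < n^p (i.e. T < (n^p/K)^{1/q}).

PolyLowerBound : (Π : LCL) → (ℕ → ℕ → Set) → Set
PolyLowerBound Π Solvable =
  ∃ λ p → ∃ λ q → ∃ λ K → ∃ λ n₀ →
    1 ≤ p × 1 ≤ q × 1 ≤ K ×
    (∀ n → n₀ ≤ n → RTree (LCL.δ Π) n →
       ∀ T → K * T ^ q < n ^ p → ¬ Solvable n T)

{-# OPTIONS --safe #-}

-- Call a label flexible in a set S of labels if the configurations over S allow closed walks from it of two
-- consecutive lengths.  Removing inflexible labels one at a time ends either with all labels removed, which ranks
-- them, or with a set of flexible labels, and then a strongly connected sink of this set is a certificate.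
--
-- Ranking: every locality below a fixed root of n fails, in both models.  The adversary keeps far apart plots of a
-- tree, whose layers are long paths carrying copies of the next lower layer.  If two sites in different plots got
-- the same label, of rank r, it exchanges two subtrees outside the views so that one site comes to lie below the
-- other at a distance for which no walk over the ranks ≥ r exists, and processes the path between them and the
-- siblings along it: some node there gets a lower rank, and the game goes on from that node.  Sites with new ranks
-- are stored; the set of stored ranks increases lexicographically, so the number of rounds is bounded.  On paths
-- (δ = 1) every label is inflexible among all labels, and moving a single node suffices.
--
-- Certificate: polylogarithmic locality suffices in both models.  Rake-and-compress gives logarithmically many
-- levels, and every long upward walk meets a long run of nodes of equal level.  Colours obtained from one
-- Cole–Vishkin step select well separated nodes of a run, from which a plan of K steps steers the labels along the
-- run to a fixed label a₀; hence the label of a node depends on a bounded number of ancestors.  Identifiers are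
-- read off ancestors only, so online they can be replaced by the first time at which an ancestor is seen.

module Submission where

open import Defs hiding (here; step)
open import Defs using () renaming (here to stay; step to move)
open import Data.Nat using (ℕ; zero; suc; _+_; _*_; _^_; _∸_; _≤_; _<_; z≤n; s≤s; _≤?_; _<?_; pred; _⊔_; _≤′_; ≤′-refl; ≤′-step; >-nonZero; nonZero; ⌊_/2⌋)
open import Data.Nat.Properties using (≤-refl; ≤-trans; ≤-reflexive; <-trans; <-≤-trans; ≤-<-trans; +-comm; +-assoc; +-suc; +-identityʳ; *-comm; *-assoc; *-suc; *-identityʳ; *-zeroʳ; *-distribʳ-+; +-mono-≤; +-monoˡ-≤; +-monoʳ-≤; *-mono-≤; *-monoˡ-≤; *-monoʳ-≤; ^-monoˡ-≤; ^-monoʳ-≤; ^-distribˡ-+-*; ^-*-assoc; m≤m+n; m≤n+m; n≤1+n; n<1+n; <⇒≤; <⇒≢; ≮⇒≥; ≰⇒>; <⇒≱; <-irrefl; ≤-antisym; <-cmp; ≤-total; suc-injective; m∸n+n≡m; m+[n∸m]≡n; m+n∸m≡n; m∸n≤m; ∸-monoˡ-≤; m≤m⊔n; m≤n⊔m; m^n>0; ≤-pred; +-cancelʳ-≡; +-cancelʳ-≤; ≤∧≢⇒<; m≤m*n; 0≢1+n; 1+n≢0; ≤⇒≤′; 1+n≰n; *-cancelʳ-≡; +-∸-assoc; n∸n≡0; m<n⇒0<n∸m; ^-zeroˡ; ≤-<-connex) renaming (_≟_ to _≟ℕ_)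
open import Data.Nat.Tactic.RingSolver using (solve-∀)
open import Data.Fin using (Fin; zero; suc; toℕ; fromℕ<; inject₁; _↑ˡ_; _↑ʳ_; splitAt; join; combine; remQuot)
open import Data.Fin.Properties using (toℕ-injective; toℕ<n; toℕ-fromℕ<; any?; all?; pigeonhole; injective⇒≤; splitAt-↑ˡ; splitAt-↑ʳ; remQuot-combine; combine-remQuot; join-splitAt; toℕ-inject₁; combine-monoˡ-<) renaming (_≟_ to _≟F_)
open import Data.Maybe using (Maybe; just; nothing; _>>=_; maybe) renaming (map to mapM)
open import Data.Maybe.Properties using (just-injective) renaming (≡-dec to maybe-≡-dec)
open import Data.Product using (Σ; ∃; _×_; _,_; proj₁; proj₂)
open import Data.Sum using (_⊎_; inj₁; inj₂; [_,_]′)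
open import Data.Empty using (⊥; ⊥-elim)
open import Data.Unit using (⊤; tt)
open import Data.Bool using (Bool; true; false) renaming (_≟_ to _≟B_)
open import Data.Vec using (Vec; tabulate; lookup)
open import Data.List using (List; []; _∷_; length; filter; allFin; _++_; drop) renaming (tabulate to tabulateL; lookup to lookupL; map to mapL)
open import Data.List.Membership.Propositional using (_∈_; _∉_)
open import Data.List.Relation.Unary.Any using (here; there; index)
open import Data.List.Relation.Unary.All using (All; []; _∷_)
open import Data.List.Relation.Unary.AllPairs using ([]; _∷_)
open import Data.List.Relation.Unary.Unique.Propositional using (Unique)
open import Relation.Nullary using (¬_; Dec; yes; no)
open import Relation.Nullary.Decidable using (_×-dec_; _⊎-dec_; ¬?; dec-true; dec-false; decidable-stable; _→-dec_)
open import Relation.Binary.Definitions using (tri<; tri≈; tri>)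
open import Relation.Binary.PropositionalEquality using (_≡_; _≢_; refl; sym; trans; cong; cong₂; subst; subst₂)
open import Function.Definitions using (Injective)
open import Data.Fin.Permutation using (Permutation′; _⟨$⟩ʳ_; _⟨$⟩ˡ_; transpose; _∘ₚ_; inverseˡ; inverseʳ; permutation) renaming (id to idₚ)
open import Data.Fin.Permutation.Components using () renaming (transpose to swapF)
open import Data.List.Membership.Propositional.Properties using (∈-allFin; ∈-filter⁺; ∈-filter⁻; ∈-++⁺ˡ; ∈-++⁺ʳ; ∈-++⁻; ∈-tabulate⁺; ∈-tabulate⁻; ∈-lookup; ∈-map⁻)
open import Data.List.Properties using (length-tabulate; length-map)
open import Data.List.Relation.Unary.Unique.Propositional.Properties using () renaming (filter⁺ to unique-filter; allFin⁺ to unique-allFin; tabulate⁺ to unique-tabulate)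
open import Data.Vec.Properties using (lookup∘tabulate; tabulate∘lookup; tabulate-cong)
open import Function using (_∘_)
open import Data.List.Relation.Unary.Any.Properties using (lookup-index)
open import Function.Bundles using (_⇔_; mk⇔)

-- Depth and ancestors

-- Flexibility and reachability of labels are decided only under double negation. That is enough,
-- since a polynomial lower bound ends in a negation, but its constants must be announced before the
-- case distinction; hence they depend on `δ` and `γ` alone. The adversary cannot glue trees
-- together, since `n` is fixed and every internal node has exactly `δ` children. An exchange of two
-- disjoint subtrees respects both and changes the surroundings of four nodes only. On a path no two
-- disjoint subtrees exist, which is why `δ = 1` is treated apart. A path is useful only if its
-- siblings are controlled too: a feasible labelling may put the low rank on a sibling. So siblings
-- are processed as well, and every sibling must carry enough structure below it for the game to go
-- on from there. An attachment multiplies the radius of the processed part by about 5, and the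
-- number of attachments is bounded in terms of `γ`. So a path length `D` linear in `T` suffices,
-- and `γ + 1` nested layers need about `T ^ (γ + 1)` nodes: this is the exponent of the lower
-- bound.

just≢nothing : ∀ {A : Set} {x : A} {m : Maybe A} → m ≡ just x → m ≡ nothing → ⊥
just≢nothing refl ()

just-unique : ∀ {A : Set} {x y : A} {m : Maybe A} → m ≡ just x → m ≡ just y → x ≡ y
just-unique refl refl = refl

module _ {n : ℕ} (p : Fin n → Maybe (Fin n)) where

  data Depth : Fin n → ℕ → Set where
    top  : ∀ {v} → p v ≡ nothing → Depth v 0
    down : ∀ {v u h} → p v ≡ just u → Depth u h → Depth v (suc h)

  data Anc : ℕ → Fin n → Fin n → Set where
    self : ∀ {v} → Anc 0 v v
    up   : ∀ {k v u w} → p v ≡ just u → Anc k u w → Anc (suc k) v w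

module _ {n : ℕ} {p : Fin n → Maybe (Fin n)} where

  -- `ancestor` peels off the last step upward, whereas `Depth` and `Anc` start with the first one;
  -- this converts between the two recursions.
  ancestor-suc : ∀ k v → ancestor p (suc k) v ≡ (p v >>= ancestor p k)
  ancestor-suc zero v with p v
  ... | nothing = refl
  ... | just u  = refl
  ancestor-suc (suc k) v rewrite ancestor-suc k v with p v
  ... | nothing = refl
  ... | just u  = refl

  ancestor-depth : ∀ k v → ancestor p k v ≡ nothing → ∃ (Depth p v)
  ancestor-depth (suc k) v eq with p v in pv | trans (sym (ancestor-suc k v)) eq
  ... | nothing | _ = 0 , top pv
  ... | just u  | e = let h , d = ancestor-depth k u e in suc h , down pv d

  depth-ancestor : ∀ {v h} → Depth p v h → ancestor p (suc h) v ≡ nothing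
  depth-ancestor {v} (top e)            = e
  depth-ancestor {v} {suc h} (down e d) =
    trans (ancestor-suc (suc h) v) (trans (cong (_>>= ancestor p (suc h)) e) (depth-ancestor d))

  depth-unique : ∀ {v h h'} → Depth p v h → Depth p v h' → h ≡ h'
  depth-unique (top e)    (top e')     = refl
  depth-unique (top e)    (down e' _)  = ⊥-elim (just≢nothing e' e)
  depth-unique (down e _) (top e')     = ⊥-elim (just≢nothing e e')
  depth-unique (down e d) (down e' d') with just-unique e e'
  ... | refl = cong suc (depth-unique d d')

  anc-trans : ∀ {j k u v w} → Anc p j u v → Anc p k v w → Anc p (j + k) u w
  anc-trans self     b = b
  anc-trans (up e a) b = up e (anc-trans a b)

  anc-snoc : ∀ {k u v w} → Anc p k u v → p v ≡ just w → Anc p (suc k) u w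
  anc-snoc self     e  = up e self
  anc-snoc (up e a) e' = up e (anc-snoc a e')

  anc-fun : ∀ {k u v w} → Anc p k u v → Anc p k u w → v ≡ w
  anc-fun self     self       = refl
  anc-fun (up e a) (up e' a') with just-unique e e'
  ... | refl = anc-fun a a'

  anc-split : ∀ j {k u w} → Anc p (j + k) u w → ∃ λ v → Anc p j u v × Anc p k v w
  anc-split zero    a        = _ , self , a
  anc-split (suc j) (up e a) = let v , b , c = anc-split j a in v , up e b , c

  anc-linear : ∀ {j k u v w} → Anc p j u v → Anc p k u w → (∃ λ i → Anc p i v w) ⊎ (∃ λ i → Anc p i w v)
  anc-linear self     b        = inj₁ (_ , b)
  anc-linear (up e a) self     = inj₂ (_ , up e a)
  anc-linear (up e a) (up e' b) with just-unique e e'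
  ... | refl = anc-linear a b

module _ {δ n : ℕ} (t : RTree δ n) where

  depth : ∀ v → ∃ (Depth (parent t) v)
  depth v = let k , e = reach t v in ancestor-depth k v e

  dep : Fin n → ℕ
  dep v = proj₁ (depth v)

module _ {δ n : ℕ} {t : RTree δ n} where

  dep-parent : ∀ {u p} → parent t u ≡ just p → dep t u ≡ suc (dep t p)
  dep-parent {u} {p} e = depth-unique (proj₂ (depth t u)) (down e (proj₂ (depth t p)))

  dep-anc : ∀ {k u v} → Anc (parent t) k u v → dep t u ≡ k + dep t v
  dep-anc self     = refl
  dep-anc (up e a) = trans (dep-parent e) (cong suc (dep-anc a))

  dist-mono : ∀ {k l u v} → k ≤ l → Dist≤ t k u v → Dist≤ t l u v
  dist-mono le       stay       = stay
  dist-mono (s≤s le) (move a d) = move a (dist-mono le d)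

  dist-trans : ∀ {k l u v w} → Dist≤ t k u v → Dist≤ t l v w → Dist≤ t (k + l) u w
  dist-trans {k} {l} stay e = dist-mono (m≤n+m l k) e
  dist-trans (move a d) e   = move a (dist-trans d e)

  adj-sym : ∀ {u v} → Adj t u v → Adj t v u
  adj-sym (inj₁ e) = inj₂ e
  adj-sym (inj₂ e) = inj₁ e

  dist-sym : ∀ {k u v} → Dist≤ t k u v → Dist≤ t k v u
  dist-sym stay = stay
  dist-sym {suc k} {u} {v} (move a d) =
    subst (λ l → Dist≤ t l v u) (+-comm k 1) (dist-trans (dist-sym d) (move (adj-sym a) stay))

  dist-anc : ∀ {k u v} → Anc (parent t) k u v → Dist≤ t k u v
  dist-anc self     = stay
  dist-anc (up e a) = move (inj₁ e) (dist-anc a)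

  dep-dist : ∀ {k u v} → Dist≤ t k u v → dep t v ≤ k + dep t u
  dep-dist {k} {u} stay = m≤n+m (dep t u) k
  dep-dist {suc k} {u} (move {w = w} (inj₁ e) d) =
    ≤-trans (dep-dist d) (≤-trans (+-monoʳ-≤ k (≤-trans (n≤1+n _) (≤-reflexive (sym (dep-parent e))))) (n≤1+n _))
  dep-dist {suc k} {u} (move {w = w} (inj₂ e) d) =
    ≤-trans (dep-dist d) (≤-reflexive (trans (cong (k +_) (dep-parent e)) (+-suc k _)))

  -- Each step rises by at most one generation, so a walk of length at most `m` starting `m`
  -- generations under `r` cannot get above `r`. This keeps the view around a site inside its plot.
  dist-below : ∀ {k m u v r} → Dist≤ t k u v → k ≤ m → Anc (parent t) m u r → ∃ λ i → Anc (parent t) i v r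
  dist-below stay le a = _ , a
  dist-below (move (inj₁ e) d) (s≤s le) (up e' a) with just-unique e e'
  ... | refl = dist-below d le a
  dist-below {suc k} {m} (move (inj₂ e) d) le a = dist-below d (≤-trans (n≤1+n k) (≤-trans le (n≤1+n m))) (up e a)

-- Two trees agreeing near the processed nodes

record Agree {δ n : ℕ} (t t' : RTree δ n) (u : Fin n) : Set where
  constructor agree
  field
    up≡   : parent t u ≡ parent t' u
    kids  : ∀ w → parent t w ≡ just u → parent t' w ≡ just u
    kids' : ∀ w → parent t' w ≡ just u → parent t w ≡ just u

module _ {δ n : ℕ} {t t' : RTree δ n} where
  open Agree

  agree-dist : ∀ {k u v} → (∀ w → Dist≤ t k u w → Agree t t' w) → Dist≤ t k u v → Dist≤ t' k u v
  agree-dist ag stay = stay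
  agree-dist ag (move (inj₁ e) d) =
    move (inj₁ (trans (sym (up≡ (ag _ stay))) e)) (agree-dist (λ w x → ag w (move (inj₁ e) x)) d)
  agree-dist ag (move (inj₂ e) d) =
    move (inj₂ (kids (ag _ stay) _ e)) (agree-dist (λ w x → ag w (move (inj₂ e) x)) d)

  agree-dist' : ∀ {k u v} → (∀ w → Dist≤ t k u w → Agree t t' w) → Dist≤ t' k u v → Dist≤ t k u v
  agree-dist' ag stay = stay
  agree-dist' ag (move (inj₁ e) d) = let e' = trans (up≡ (ag _ stay)) e in
    move (inj₁ e') (agree-dist' (λ w x → ag w (move (inj₁ e') x)) d)
  agree-dist' ag (move (inj₂ e) d) = let e' = kids' (ag _ stay) _ e in
    move (inj₂ e') (agree-dist' (λ w x → ag w (move (inj₂ e') x)) d)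

  agree-iso : ∀ {S S' : Fin n → Set} → (∀ u → S u → S' u) → (∀ u → S' u → S u) →
              (∀ u → S u → Agree t t' u) → SubIso t t' S S'
  agree-iso f g ag = record
    { φ = λ u → u ; ψ = λ u → u ; φ∈ = f ; ψ∈ = g ; ψφ = λ _ _ → refl ; φψ = λ _ _ → refl
    ; par→ = λ u w su _ e → trans (sym (up≡ (ag u su))) e
    ; par← = λ u w su _ e → trans (up≡ (ag u su)) e }

-- Finite lists without repetition

remove-∈ : ∀ {A : Set} {x : A} (ys : List A) → x ∈ ys →
  ∃ λ zs → length ys ≡ suc (length zs) × (∀ {z} → z ∈ ys → z ≢ x → z ∈ zs)
remove-∈ (y ∷ ys) (here refl) = ys , refl , λ { (here refl) ne → ⊥-elim (ne refl) ; (there i) _ → i }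
remove-∈ (y ∷ ys) (there x∈) = let zs , e , f = remove-∈ ys x∈ in
  y ∷ zs , cong suc e , λ { (here refl) _ → here refl ; (there i) ne → there (f i ne) }

All-∈ : ∀ {A : Set} {P : A → Set} {xs : List A} {x : A} → All P xs → x ∈ xs → P x
All-∈ (p ∷ _) (here refl) = p
All-∈ (_ ∷ ps) (there i)  = All-∈ ps i

unique-⊆-length : ∀ {A : Set} (xs ys : List A) → Unique xs → (∀ {z} → z ∈ xs → z ∈ ys) → length xs ≤ length ys
unique-⊆-length [] ys u sub = z≤n
unique-⊆-length (x ∷ xs) ys (x∉ ∷ u) sub = let zs , e , f = remove-∈ ys (sub (here refl)) in
  subst (suc (length xs) ≤_) (sym e)
    (s≤s (unique-⊆-length xs zs u λ i → f (sub (there i)) λ { refl → All-∈ x∉ i refl }))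

all-≢ : ∀ {A : Set} {x : A} (xs : List A) → x ∉ xs → All (x ≢_) xs
all-≢ []       _  = []
all-≢ (y ∷ ys) ni = (λ { refl → ni (here refl) }) ∷ all-≢ ys (λ i → ni (there i))

-- A player stands for an algorithm of either model; the processed nodes are listed latest first.

record Player (Π : LCL) (n T : ℕ) : Set where
  open LCL Π
  field
    lab       : RTree δ n → List (Fin n) → Fin n → Fin γ
    lab-ext   : ∀ t vs u v → Unique (u ∷ vs) → v ∈ vs → lab t (u ∷ vs) v ≡ lab t vs v
    lab-agree : ∀ t t' vs → Unique vs → (∀ v u → v ∈ vs → Dist≤ t T v u → Agree t t' u) →
                ∀ v → v ∈ vs → lab t vs v ≡ lab t' vs v
    lab-feas  : ∀ t vs → Unique vs → ∃ λ L → Feasible Π t L × (∀ v → v ∈ vs → L v ≡ lab t vs v)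

n≤n^c : ∀ n c → 1 ≤ n → 1 ≤ c → n ≤ n ^ c
n≤n^c (suc n) (suc c) (s≤s z≤n) (s≤s z≤n) = m≤m*n (suc n) (suc n ^ c) {{>-nonZero (m^n>0 (suc n) c)}}

-- The names of the nodes serve as identifiers, so the identity map between two trees preserves
-- them. They fit the range because `c ≥ 1`.
localPlayer : ∀ {Π n T} c → 1 ≤ c → LOCALSolvable c Π n T → Player Π n T
localPlayer {Π} {n} {T} c c≥1 ((A , inv) , feas) = record
  { lab = λ t _ v → A t ids v
  ; lab-ext = λ _ _ _ _ _ _ → refl
  ; lab-agree = λ t t' vs _ ag v v∈ →
      inv t t' ids ids v v valid valid
        (agree-iso (λ u → agree-dist (λ w → ag v w v∈)) (λ u → agree-dist' (λ w → ag v w v∈)) (λ u → ag v u v∈))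
        refl (λ _ _ → refl)
  ; lab-feas = λ t vs _ → A t ids , feas t ids valid , λ _ _ → refl }
  where
  ids : Fin n → ℕ
  ids v = suc (toℕ v)
  valid : ValidIds n c ids
  valid = (λ e → toℕ-injective (suc-injective e)) ,
          λ v → s≤s z≤n , ≤-trans (toℕ<n v) (n≤n^c n c (≤-trans (s≤s z≤n) (toℕ<n v)) c≥1)

swapF-hit : ∀ {n} (i j : Fin n) → swapF i j i ≡ j
swapF-hit i j rewrite dec-true (i ≟F i) refl = refl

swapF-miss : ∀ {n} (i j k : Fin n) → k ≢ i → k ≢ j → swapF i j k ≡ k
swapF-miss i j k a b rewrite dec-false (k ≟F i) a | dec-false (k ≟F j) b = refl

unique-length : ∀ {n} (vs : List (Fin n)) → Unique vs → length vs ≤ n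
unique-length {n} vs u =
  subst (length vs ≤_) (length-tabulate {n = n} (λ i → i)) (unique-⊆-length vs (allFin n) u (λ {z} _ → ∈-allFin z))

-- The processing order starting with the given nodes, the oldest being the last of the list.
order : ∀ {n} → List (Fin n) → Permutation′ n
order [] = idₚ
order {n} (u ∷ vs) with length vs <? n
-- The transposition brings `u` to position `length vs`. For `u` outside `vs` all earlier positions
-- stay fixed, so the ordering grows by extending its prefix.
... | yes l = transpose (fromℕ< l) (order vs ⟨$⟩ˡ u) ∘ₚ order vs
... | no _  = order vs

order-injective : ∀ {n} (π : Permutation′ n) {i j} → π ⟨$⟩ʳ i ≡ π ⟨$⟩ʳ j → i ≡ j
order-injective π e = trans (sym (inverseˡ π)) (trans (cong (π ⟨$⟩ˡ_) e) (inverseˡ π))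

order-prefix : ∀ {n} (vs : List (Fin n)) → Unique vs →
  ∀ j → toℕ j < length vs → (order vs ⟨$⟩ʳ j) ∈ vs
order-step : ∀ {n} (u : Fin n) vs → Unique (u ∷ vs) →
  (∀ j → toℕ j < length vs → order (u ∷ vs) ⟨$⟩ʳ j ≡ order vs ⟨$⟩ʳ j) ×
  (∀ j → toℕ j ≡ length vs → order (u ∷ vs) ⟨$⟩ʳ j ≡ u)

order-step {n} u vs (u∉ ∷ uq) with length vs <? n
... | no ge = ⊥-elim (ge (unique-length (u ∷ vs) (u∉ ∷ uq)))
... | yes l = old , new
  where
  m = fromℕ< l
  q = order vs ⟨$⟩ˡ u
  old : ∀ j → toℕ j < length vs → order vs ⟨$⟩ʳ (swapF m q j) ≡ order vs ⟨$⟩ʳ j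
  old j lt = cong (order vs ⟨$⟩ʳ_) (swapF-miss m q j
    (λ { refl → <-irrefl (toℕ-fromℕ< l) lt })
    (λ { refl → All-∈ u∉ (subst (_∈ vs) (inverseʳ (order vs)) (order-prefix vs uq j lt)) refl }))
  new : ∀ j → toℕ j ≡ length vs → order vs ⟨$⟩ʳ (swapF m q j) ≡ u
  new j e with toℕ-injective {i = j} {j = m} (trans e (sym (toℕ-fromℕ< l)))
  ... | refl = trans (cong (order vs ⟨$⟩ʳ_) (swapF-hit m q)) (inverseʳ (order vs))

order-prefix (u ∷ vs) uq@(_ ∷ uq') j (s≤s le) with toℕ j ≟ℕ length vs
... | yes e = here (proj₂ (order-step u vs uq) j e)
... | no ne = there (subst (_∈ vs) (sym (proj₁ (order-step u vs uq) j lt)) (order-prefix vs uq' j lt))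
  where lt = ≤∧≢⇒< le ne

order-keeps : ∀ {n} (u : Fin n) vs → Unique (u ∷ vs) → ∀ v → toℕ (order vs ⟨$⟩ˡ v) < length vs →
  order (u ∷ vs) ⟨$⟩ˡ v ≡ order vs ⟨$⟩ˡ v
order-keeps u vs uq v lt =
  trans (cong (order (u ∷ vs) ⟨$⟩ˡ_) (sym (trans (proj₁ (order-step u vs uq) _ lt) (inverseʳ (order vs)))))
        (inverseˡ (order (u ∷ vs)))

order-index : ∀ {n} (vs : List (Fin n)) → Unique vs → ∀ v → v ∈ vs → toℕ (order vs ⟨$⟩ˡ v) < length vs
order-index {n} (u ∷ vs) uq@(_ ∷ uq') v (here refl) = ≤-reflexive (cong suc (trans (cong toℕ hit) (toℕ-fromℕ< l)))
  where
  l = unique-length (u ∷ vs) uq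
  hit : order (u ∷ vs) ⟨$⟩ˡ u ≡ fromℕ< l
  hit = trans (cong (order (u ∷ vs) ⟨$⟩ˡ_) (sym (proj₂ (order-step u vs uq) (fromℕ< l) (toℕ-fromℕ< l))))
              (inverseˡ (order (u ∷ vs)))
order-index (u ∷ vs) uq@(_ ∷ uq') v (there i) =
  subst (λ k → toℕ k < suc (length vs)) (sym (order-keeps u vs uq v ih)) (<-trans ih (n<1+n _))
  where ih = order-index vs uq' v i

-- The processed nodes are completed to an ordering of all nodes. An answer depends only on the
-- ordering up to its own index, so neither the arbitrary completion nor later insertions change it.
onlinePlayer : ∀ {Π n T} → OnlineSolvable Π n T → Player Π n T
onlinePlayer {Π} {n} {T} ((A , inv) , feas) = record
  { lab = lab ; lab-ext = ext ; lab-agree = agr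
  ; lab-feas = λ t vs _ → lab t vs , feas t (order vs ⟨$⟩ʳ_) (order-injective (order vs)) (lab t vs)
      (λ i → cong (A t (order vs ⟨$⟩ʳ_)) (inverseˡ (order vs))) , λ _ _ → refl }
  where
  lab : RTree (LCL.δ Π) n → List (Fin n) → Fin n → Fin (LCL.γ Π)
  lab t vs v = A t (order vs ⟨$⟩ʳ_) (order vs ⟨$⟩ˡ v)
  ext : ∀ t vs u v → Unique (u ∷ vs) → v ∈ vs → lab t (u ∷ vs) v ≡ lab t vs v
  ext t vs u v uq@(_ ∷ uq') v∈ = trans (cong (A t _) (order-keeps u vs uq v (order-index vs uq' v v∈)))
    (inv t t _ _ _ (order-injective (order (u ∷ vs))) (order-injective (order vs))
      (agree-iso (λ w → λ { (j , le , d) → j , le , subst (λ x → Dist≤ t T x w) (same j le) d })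
                 (λ w → λ { (j , le , d) → j , le , subst (λ x → Dist≤ t T x w) (sym (same j le)) d })
                 (λ w _ → agree refl (λ _ e → e) (λ _ e → e)))
      same)
    where
    same : ∀ j → toℕ j ≤ toℕ (order vs ⟨$⟩ˡ v) → order (u ∷ vs) ⟨$⟩ʳ j ≡ order vs ⟨$⟩ʳ j
    same j le = proj₁ (order-step u vs uq) j (≤-<-trans le (order-index vs uq' v v∈))
  agr : ∀ t t' vs → Unique vs → (∀ v u → v ∈ vs → Dist≤ t T v u → Agree t t' u) →
        ∀ v → v ∈ vs → lab t vs v ≡ lab t' vs v
  agr t t' vs uq ag v v∈ = inv t t' _ _ _ (order-injective (order vs)) (order-injective (order vs))
    (agree-iso (λ w → λ { (j , le , d) → j , le , agree-dist (λ x → ag _ x (mem j le)) d })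
               (λ w → λ { (j , le , d) → j , le , agree-dist' (λ x → ag _ x (mem j le)) d })
               (λ w → λ { (j , le , d) → ag _ w (mem j le) d }))
    (λ _ _ → refl)
    where
    mem : ∀ j → toℕ j ≤ toℕ (order vs ⟨$⟩ˡ v) → (order vs ⟨$⟩ʳ j) ∈ vs
    mem j le = order-prefix vs uq j (≤-<-trans le (order-index vs uq v v∈))

-- Double negation

dn-map : ∀ {a b} {A : Set a} {B : Set b} → (A → B) → ¬ ¬ A → ¬ ¬ B
dn-map f a k = a (λ x → k (f x))

dn-em : (A : Set) → ¬ ¬ Dec A
dn-em A k = k (no (λ a → k (yes a)))

dn-all : ∀ {m} {P : Fin m → Set} → (∀ i → ¬ ¬ P i) → ¬ ¬ (∀ i → P i)
dn-all {zero}  f k = k (λ ())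
dn-all {suc m} f k = f zero (λ p → dn-all (λ i → f (suc i)) (λ q → k (λ { zero → p ; (suc i) → q i })))

fin-bound : ∀ {m} (f : Fin m → ℕ) → ∃ λ M → ∀ i → f i ≤ M
fin-bound {zero}  f = 0 , λ ()
fin-bound {suc m} f = let M , le = fin-bound (λ i → f (suc i)) in
  f zero ⊔ M , λ { zero → m≤m⊔n _ M ; (suc i) → ≤-trans (le i) (m≤n⊔m (f zero) M) }

-- Walks in the automaton of a problem

module Labels (Π : LCL) where
  open LCL Π

  -- The siblings of `b` must have labels in `S` too: a certificate has to label them without
  -- leaving `S`, and a lower bound has to process them to obtain an edge.
  Edge : (Fin γ → Set) → Fin γ → Fin γ → Set
  Edge S a b = ∃ λ v → (a , v) ∈ C × S a × (∀ k → S (lookup v k)) × ∃ λ k → lookup v k ≡ b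

  data Walk (S : Fin γ → Set) : ℕ → Fin γ → Fin γ → Set where
    []  : ∀ {a} → Walk S 0 a a
    _∷_ : ∀ {m a b c} → Edge S a b → Walk S m b c → Walk S (suc m) a c

  walk-++ : ∀ {S m k a b c} → Walk S m a b → Walk S k b c → Walk S (m + k) a c
  walk-++ []      w' = w'
  walk-++ (e ∷ w) w' = e ∷ walk-++ w w'

  walk-repeat : ∀ {S m a} x → Walk S m a a → Walk S (x * m) a a
  walk-repeat zero    w = []
  walk-repeat (suc x) w = walk-++ w (walk-repeat x w)

  walk-mono : ∀ {S S' : Fin γ → Set} → (∀ {a} → S a → S' a) → ∀ {m a b} → Walk S m a b → Walk S' m a b
  walk-mono f [] = []
  walk-mono f ((v , i , s , r , e) ∷ w) = (v , i , f s , (λ k → f (r k)) , e) ∷ walk-mono f w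

  walk-end : ∀ {S m a b} → S a → Walk S m a b → S b
  walk-end s [] = s
  walk-end {S} s ((v , i , _ , r , k , e) ∷ w) = walk-end (subst S e (r k)) w

  Flex : (Fin γ → Set) → Fin γ → Set
  Flex S a = ∃ λ m → Walk S m a a × Walk S (suc m) a a

  record Ranking : Set where
    field
      rank     : Fin γ → ℕ
      rank<    : ∀ a → rank a < γ
      rank-inj : ∀ {a b} → rank a ≡ rank b → a ≡ b
      inflex   : ∀ a → ¬ Flex (λ b → rank a ≤ rank b) a

  Valid : (Fin γ → Set) → Fin γ → Fin γ → List (Vec (Fin γ) δ × Fin δ) → Set
  Valid S a₀ a []             = a ≡ a₀
  Valid S a₀ a ((v , k) ∷ ps) = (a , v) ∈ C × (∀ i → S (lookup v i)) × Valid S a₀ (lookup v k) ps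

  -- The length `K` is common to all labels of `S`, so the place where a plan ends is known without
  -- its first label. `any` and `plan` are total functions with laws on `S` only, hence membership
  -- in `S` need not be tested.
  record Cert : Set₁ where
    field
      S        : Fin γ → Set
      a₀       : Fin γ
      S-a₀     : S a₀
      K        : ℕ
      K≥1      : 1 ≤ K
      any      : Fin γ → Vec (Fin γ) δ
      any-C    : ∀ {a} → S a → (a , any a) ∈ C
      any-S    : ∀ {a} → S a → ∀ i → S (lookup (any a) i)
      plan     : Fin γ → List (Vec (Fin γ) δ × Fin δ)
      plan-len : ∀ {a} → S a → length (plan a) ≡ K
      plan-ok  : ∀ {a} → S a → Valid S a₀ a (plan a)

  module _ (S : Fin γ → Set) where

    Reach : Fin γ → Fin γ → Set
    Reach a b = ∃ λ m → Walk S m a b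

    reach-trans : ∀ {a b c} → Reach a b → Reach b c → Reach a c
    reach-trans (_ , w) (_ , w') = _ , walk-++ w w'

    module _ (dec : ∀ a b → Dec (Reach a b)) where

      reached : Fin γ → List (Fin γ)
      reached a = filter (dec a) (allFin γ)

      -- If `a` reaches some `b` that does not reach it back, then `b` reaches strictly fewer
      -- labels, because `a` is lost.
      sink : ∀ c a → S a → length (reached a) ≤ c → ∃ λ a₀ → S a₀ × (∀ b → Reach a₀ b → Reach b a₀)
      sink c a sa le with any? (λ b → dec a b ×-dec ¬? (dec b a))
      ... | no none = a , sa , λ b r → decidable-stable (dec b a) (λ nr → none (b , r , nr))
      ... | yes (b , r , nr) = descend c (≤-trans smaller le)
        where
        smaller : suc (length (reached b)) ≤ length (reached a)
        smaller = unique-⊆-length (a ∷ reached b) (reached a)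
          (all-≢ (reached b) (λ i → nr (proj₂ (∈-filter⁻ (dec b) {xs = allFin γ} i))) ∷ unique-filter (dec b) (unique-allFin γ))
          λ { (here refl) → ∈-filter⁺ (dec a) (∈-allFin a) (0 , [])
            ; (there i) → ∈-filter⁺ (dec a) (∈-allFin _)
                (reach-trans r (proj₂ (∈-filter⁻ (dec b) {xs = allFin γ} i))) }
        descend : ∀ c → suc (length (reached b)) ≤ c → ∃ λ a₀ → S a₀ × (∀ b → Reach a₀ b → Reach b a₀)
        descend (suc c') (s≤s le') = sink c' b (walk-end sa (proj₂ r)) le'

      module _ (flex : ∀ a → S a → Flex S a) (a₀ : Fin γ) (sa₀ : S a₀) (back : ∀ b → Reach a₀ b → Reach b a₀) where

        private
          m₀ : ℕ
          m₀ = proj₁ (flex a₀ sa₀)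

          time : Fin γ → ℕ
          time b with dec a₀ b
          ... | yes r = proj₁ (back b r)
          ... | no _  = 0

          M : ℕ
          M = suc (proj₁ (fin-bound time))

          time-walk : ∀ b → Reach a₀ b → Walk S (time b) b a₀
          time-walk b r with dec a₀ b
          ... | yes r' = proj₂ (back b r')
          ... | no nr  = ⊥-elim (nr r)

          -- A way back of length `x`, then `x` loops of length `m` and `r` loops of length `m + 1`:
          -- the shorter loops pay for the way back, so the total depends on `x + r` only.
          length-eq : ∀ x r m → x + (x * m + r * suc m) ≡ (x + r) * suc m
          length-eq = solve-∀

          -- All lengths M m₀ , … , M m₀ + M are sums of M numbers m₀ and m₀ + 1.
          steer : ∀ b → Reach a₀ b → Walk S (M * suc m₀) b a₀
          steer b r = subst (λ l → Walk S l b a₀)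
            (trans (length-eq x (M ∸ x) m₀) (cong (_* suc m₀) (m+[n∸m]≡n le)))
            (walk-++ (time-walk b r)
              (walk-++ (walk-repeat x (proj₁ (proj₂ (flex a₀ sa₀)))) (walk-repeat (M ∸ x) (proj₂ (proj₂ (flex a₀ sa₀))))))
            where
            x  = time b
            le = ≤-trans (proj₂ (fin-bound time) b) (n≤1+n _)

          reach-vec : ∀ {a v} → (a , v) ∈ C → S a → (∀ k → S (lookup v k)) → Reach a₀ a → ∀ i → Reach a₀ (lookup v i)
          reach-vec {a} {v} c s r ra i = reach-trans ra (1 , (v , c , s , r , i , refl) ∷ [])

          plan-of : ∀ {m b} → Walk S m b a₀ → List (Vec (Fin γ) δ × Fin δ)
          plan-of [] = []
          plan-of ((v , c , s , r , k , e) ∷ w) = (v , k) ∷ plan-of w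

          plan-of-len : ∀ {m b} (w : Walk S m b a₀) → length (plan-of w) ≡ m
          plan-of-len [] = refl
          plan-of-len (_ ∷ w) = cong suc (plan-of-len w)

          plan-of-ok : ∀ {m b} (w : Walk S m b a₀) → Reach a₀ b → Valid (Reach a₀) a₀ b (plan-of w)
          plan-of-ok [] r = refl
          plan-of-ok ((v , c , s , sv , k , refl) ∷ w) r = c , reach-vec c s sv r , plan-of-ok w (reach-vec c s sv r k)

          first : ∀ a → Reach a₀ a → ∃ λ v → (a , v) ∈ C × (∀ i → Reach a₀ (lookup v i))
          first a r with flex a (walk-end sa₀ (proj₂ r))
          ... | m , _ , (v , c , s , sv , _) ∷ _ = v , c , reach-vec c s sv r

          any : Fin γ → Vec (Fin γ) δ
          any a with dec a₀ a
          ... | yes r = proj₁ (first a r)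
          ... | no _  = tabulate (λ _ → a₀)

          any-C : ∀ {a} → Reach a₀ a → (a , any a) ∈ C
          any-C {a} r with dec a₀ a
          ... | yes r' = proj₁ (proj₂ (first a r'))
          ... | no nr  = ⊥-elim (nr r)

          any-S : ∀ {a} → Reach a₀ a → ∀ i → Reach a₀ (lookup (any a) i)
          any-S {a} r with dec a₀ a
          ... | yes r' = proj₂ (proj₂ (first a r'))
          ... | no nr  = ⊥-elim (nr r)

          plan : Fin γ → List (Vec (Fin γ) δ × Fin δ)
          plan a with dec a₀ a
          ... | yes r = plan-of (steer a r)
          ... | no _  = []

          plan-len : ∀ {a} → Reach a₀ a → length (plan a) ≡ M * suc m₀
          plan-len {a} r with dec a₀ a
          ... | yes r' = plan-of-len (steer a r')
          ... | no nr  = ⊥-elim (nr r)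

          plan-ok : ∀ {a} → Reach a₀ a → Valid (Reach a₀) a₀ a (plan a)
          plan-ok {a} r with dec a₀ a
          ... | yes r' = plan-of-ok (steer a r') r'
          ... | no nr  = ⊥-elim (nr r)

        sink-cert : Cert
        sink-cert = record
          { S = Reach a₀ ; a₀ = a₀ ; S-a₀ = 0 , [] ; K = M * suc m₀ ; K≥1 = s≤s z≤n
          ; any = any ; any-C = any-C ; any-S = any-S ; plan = plan ; plan-len = plan-len ; plan-ok = plan-ok }

    -- Reachability is decided under double negation for all of the finitely many pairs at once, and
    -- the whole certificate consults this one decision.
    flex-cert : (∀ a → S a → Flex S a) → ∃ S → ¬ ¬ Cert
    flex-cert flex (a , sa) = dn-map
      (λ dec → let a₀ , s₀ , back = sink dec _ a sa ≤-refl in sink-cert dec flex a₀ s₀ back)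
      (dn-all (λ a → dn-all (λ b → dn-em (Reach a b))))

  record RankingOn (xs : List (Fin γ)) : Set where
    field
      rank     : Fin γ → ℕ
      rank<    : ∀ {a} → a ∈ xs → rank a < length xs
      rank-inj : ∀ {a b} → a ∈ xs → b ∈ xs → rank a ≡ rank b → a ≡ b
      inflex   : ∀ {a} → a ∈ xs → ¬ Flex (λ b → b ∈ xs × rank a ≤ rank b) a

  flex-mono : ∀ {S S' : Fin γ → Set} → (∀ {a} → S a → S' a) → ∀ {a} → Flex S a → Flex S' a
  flex-mono f (m , w , w') = m , walk-mono f w , walk-mono f w'

  -- The removed label gets rank 0, for which the labels of at least this rank are all of `xs`. The
  -- others move up by one, and for them the condition on ranks excludes the removed label.
  rank-cons : ∀ {xs zs a} → length xs ≡ suc (length zs) → (∀ {z} → z ∈ xs → z ≢ a → z ∈ zs) →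
              ¬ Flex (_∈ xs) a → RankingOn zs → RankingOn xs
  rank-cons {xs} {zs} {a} len sub nf R = record
    { rank = rk ; rank< = lt ; rank-inj = inj ; inflex = infl }
    where
    open RankingOn R
    rk : Fin γ → ℕ
    rk b with b ≟F a
    ... | yes _ = 0
    ... | no _  = suc (rank b)
    lt : ∀ {b} → b ∈ xs → rk b < length xs
    lt {b} i with b ≟F a
    ... | yes _ = subst (0 <_) (sym len) (s≤s z≤n)
    ... | no ne = subst (suc (rank b) <_) (sym len) (s≤s (rank< (sub i ne)))
    inj : ∀ {b c} → b ∈ xs → c ∈ xs → rk b ≡ rk c → b ≡ c
    inj {b} {c} i j e with b ≟F a | c ≟F a
    ... | yes refl | yes refl = refl
    ... | yes _    | no _     = ⊥-elim (0≢1+n e)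
    ... | no _     | yes _    = ⊥-elim (1+n≢0 e)
    ... | no ne    | no ne'   = rank-inj (sub i ne) (sub j ne') (suc-injective e)
    infl : ∀ {b} → b ∈ xs → ¬ Flex (λ c → c ∈ xs × rk b ≤ rk c) b
    infl {b} i f with b ≟F a
    ... | yes refl = nf (flex-mono proj₁ f)
    ... | no ne    = inflex (sub i ne) (flex-mono shrink f)
      where
      shrink : ∀ {c} → c ∈ xs × suc (rank b) ≤ rk c → c ∈ zs × rank b ≤ rank c
      shrink {c} (j , le) with c ≟F a | le
      ... | no ne' | s≤s le' = sub j ne' , le'

  dichotomy-on : ∀ m xs → length xs ≡ m → ¬ ¬ (Cert ⊎ RankingOn xs)
  dichotomy-on zero [] refl k = k (inj₂ (record
    { rank = λ _ → 0 ; rank< = λ () ; rank-inj = λ () ; inflex = λ () }))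
  dichotomy-on (suc m) xs@(x ∷ _) len k = dn-em (∃ λ a → a ∈ xs × ¬ Flex (_∈ xs) a) λ
    { (yes (a , i , nf)) → let zs , e , sub = remove-∈ xs i in
        dichotomy-on m zs (suc-injective (trans (sym e) len)) λ
          { (inj₁ c) → k (inj₁ c) ; (inj₂ R) → k (inj₂ (rank-cons e sub nf R)) }
    ; (no all) → dn-all {P = λ a → a ∈ xs → Flex (_∈ xs) a}
        (λ a k' → dn-em (a ∈ xs) λ { (yes i) → all (a , i , λ f → k' (λ _ → f)) ; (no ni) → k' (λ i → ⊥-elim (ni i)) })
        (λ flex → flex-cert (_∈ xs) flex (x , here refl) (λ c → k (inj₁ c))) }

  dichotomy : ¬ ¬ (Cert ⊎ Ranking)
  dichotomy k = dichotomy-on γ (allFin γ) len λ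
    { (inj₁ c) → k (inj₁ c)
    ; (inj₂ R) → let open RankingOn R in k (inj₂ (record
        { rank = rank ; rank< = λ a → subst (rank a <_) len (rank< (∈-allFin a))
        ; rank-inj = rank-inj (∈-allFin _) (∈-allFin _)
        ; inflex = λ a f → inflex (∈-allFin a) (flex-mono (λ le → ∈-allFin _ , le) f) })) }
    where len = length-tabulate {n = γ} (λ i → i)

-- Exchanging two disjoint subtrees

swapF-hit' : ∀ {n} (i j : Fin n) → swapF i j j ≡ i
swapF-hit' i j with j ≟F i
... | yes refl = refl
... | no _ rewrite dec-true (j ≟F j) refl = refl

swapF-invol : ∀ {n} (i j k : Fin n) → swapF i j (swapF i j k) ≡ k
swapF-invol i j k with k ≟F i
... | yes refl = swapF-hit' i j
... | no a with k ≟F j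
...   | yes refl = swapF-hit i j
...   | no b = swapF-miss i j k a b

module Swap {δ n : ℕ} (t : RTree δ n) (x y px py : Fin n)
            (ex : parent t x ≡ just px) (ey : parent t y ≡ just py)
            (x≁y : ∀ k → ¬ Anc (parent t) k x y) (y≁x : ∀ k → ¬ Anc (parent t) k y x) where

  τ : Fin n → Fin n
  τ = swapF x y

  τ-inj : Injective _≡_ _≡_ τ
  τ-inj {i} {j} e = trans (sym (swapF-invol x y i)) (trans (cong τ e) (swapF-invol x y j))

  -- Composing with `τ` on the argument side only exchanges the parents of `x` and `y` but leaves
  -- their children attached to them, so the whole subtrees move.
  par' : Fin n → Maybe (Fin n)
  par' v = parent t (τ v)

  par'-τ : ∀ v → par' (τ v) ≡ parent t v
  par'-τ v = cong (parent t) (swapF-invol x y v)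

  private
    no-loop : ∀ {k u} → ¬ Anc (parent t) (suc k) u u
    no-loop {k} {u} a = <-irrefl (dep-anc {t = t} a) (s≤s (m≤n+m (dep t u) k))

    clean : ∀ {v h} → Depth (parent t) v h → (∀ k → ¬ Anc (parent t) k v x) → (∀ k → ¬ Anc (parent t) k v y) → Depth par' v h
    clean {v} d ax ay with swapF-miss x y v (λ { refl → ax 0 self }) (λ { refl → ay 0 self })
    clean {v} (top e)    ax ay | τv = top (trans (cong (parent t) τv) e)
    clean {v} (down e d) ax ay | τv =
      down (trans (cong (parent t) τv) e) (clean d (λ k a → ax (suc k) (up e a)) (λ k a → ay (suc k) (up e a)))

    -- The way up stays finite: from `x` it continues at `py`, above which lies neither `y` nor, by
    -- `y≁x`, the node `x`; symmetrically from `y`. So at most one detour is taken.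
    depth' : ∀ {v h} → Depth (parent t) v h → ∃ (Depth par' v)
    depth' {v} d with v ≟F x
    ... | yes refl = _ , down (trans (cong (parent t) (swapF-hit x y)) ey)
                      (clean (proj₂ (depth t py)) (λ k a → y≁x (suc k) (up ey a)) (λ k a → no-loop (up ey a)))
    ... | no ne with v ≟F y
    ...   | yes refl = _ , down (trans (cong (parent t) (swapF-hit' x y)) ex)
                        (clean (proj₂ (depth t px)) (λ k a → no-loop (up ex a)) (λ k a → x≁y (suc k) (up ex a)))
    ...   | no ne' with d
    ...     | top e = _ , top (trans (cong (parent t) (swapF-miss x y v ne ne')) e)
    ...     | down e d' = _ , down (trans (cong (parent t) (swapF-miss x y v ne ne')) e) (proj₂ (depth' d'))

    τ-root : τ (root t) ≡ root t
    τ-root = swapF-miss x y (root t) (λ e → just≢nothing (trans (cong (parent t) e) ex) (root-nil t))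
                                     (λ e → just≢nothing (trans (cong (parent t) e) ey) (root-nil t))

  childEnum-τ : ∀ {v} {f : Fin δ → Fin n} → ChildEnum δ (parent t) v f → ChildEnum δ par' v (λ k → τ (f k))
  childEnum-τ {v} {f} (inj , par , all) =
    (λ e → inj (τ-inj e)) , (λ k → trans (par'-τ (f k)) (par k)) ,
    λ w e → let k , fk = all (τ w) e in k , trans (cong τ fk) (swapF-invol x y w)

  t' : RTree δ n
  t' = record
    { parent = par' ; root = root t
    ; root-nil = trans (cong (parent t) τ-root) (root-nil t)
    ; root-uniq = λ v e → τ-inj (trans (root-uniq t (τ v) e) (sym τ-root))
    ; reach = λ v → let h , d = depth' (proj₂ (depth t v)) in suc h , depth-ancestor d
    ; arity = λ v → [ (λ leaf → inj₁ (λ w e → leaf (τ w) e)) , (λ { (f , ce) → inj₂ ((λ k → τ (f k)) , childEnum-τ ce) }) ]′ (arity t v) }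

  par'-other : ∀ {v} → v ≢ x → v ≢ y → par' v ≡ parent t v
  par'-other {v} a b = cong (parent t) (swapF-miss x y v a b)

  par'-x : par' x ≡ just py
  par'-x = trans (cong (parent t) (swapF-hit x y)) ey

  par'-y : par' y ≡ just px
  par'-y = trans (cong (parent t) (swapF-hit' x y)) ex

  kid-other : ∀ {c p} → p ≢ px → p ≢ py → parent t c ≡ just p → c ≢ x × c ≢ y
  kid-other a b e = (λ { refl → a (just-unique e ex) }) , (λ { refl → b (just-unique e ey) })

  kid-other' : ∀ {c p} → p ≢ px → p ≢ py → par' c ≡ just p → c ≢ x × c ≢ y
  kid-other' a b e = (λ { refl → b (just-unique e par'-x) }) , (λ { refl → a (just-unique e par'-y) })

  kid→ : ∀ {c p} → p ≢ px → p ≢ py → parent t c ≡ just p → par' c ≡ just p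
  kid→ a b e = let c , d = kid-other a b e in trans (par'-other c d) e

  kid← : ∀ {c p} → p ≢ px → p ≢ py → par' c ≡ just p → parent t c ≡ just p
  kid← a b e = let c , d = kid-other' a b e in trans (sym (par'-other c d)) e

  swap-agree : ∀ u → u ≢ x → u ≢ y → u ≢ px → u ≢ py → Agree t t' u
  swap-agree u a b c d = agree (sym (par'-other a b)) (λ _ → kid→ c d) (λ _ → kid← c d)

-- Rich nodes: from a node that is j + 1 rich, labels of rank j can be attacked.

module Richness {δ n : ℕ} (D : ℕ) where

  data Chain (t : RTree δ n) (P : Fin n → Set) : ℕ → Fin n → Set where
    stop : ∀ {v} → P v → Chain t P 0 v
    step : ∀ {l v f} → ChildEnum δ (parent t) v f → (∀ k → P (f k)) → (k : Fin δ) → Chain t P l (f k) → Chain t P (suc l) v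

  Rich : RTree δ n → ℕ → Fin n → Set
  Rich t zero    v = ⊤
  Rich t (suc j) v = Chain t (Rich t j) D v

  -- A chain seen from below. All children along the path are rich, not just those on it, so
  -- whichever of them receives a low rank can be the next site.
  data Up (t : RTree δ n) (j : ℕ) : ℕ → Fin n → Fin n → Set where
    nil  : ∀ {v} → Up t j 0 v v
    cons : ∀ {l v p r f} → parent t v ≡ just p → ChildEnum δ (parent t) p f → (∀ k → Rich t j (f k)) →
           Up t j l p r → Up t j (suc l) v r

  module _ {t : RTree δ n} where

    chain-drop : ∀ {P : Fin n → Set} → (∀ {v f} → ChildEnum δ (parent t) v f → Fin δ → (∀ k → P (f k)) → P v) →
                 ∀ {l v} → Chain t P (suc l) v → Chain t P l v
    chain-drop g {zero}  (step ce a k c) = stop (g ce k a)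
    chain-drop g {suc l} (step ce a k c) = step ce a k (chain-drop g c)

    -- The chain of a child is prolonged by the parent at the top and loses its last node at the
    -- bottom, which restores the length `D`.
    rich-parent : ∀ j {v f} → ChildEnum δ (parent t) v f → Fin δ → (∀ k → Rich t j (f k)) → Rich t j v
    rich-pred   : ∀ j {v} → Rich t (suc j) v → Rich t j v

    rich-parent zero    ce k a = tt
    rich-parent (suc j) ce k a =
      chain-drop (rich-parent j) (step ce (λ i → rich-pred j (a i)) k (a k))

    rich-pred j = head D
      where
      head : ∀ l {v} → Chain t (Rich t j) l v → Rich t j v
      head zero    (stop p)        = p
      head (suc l) (step ce a k c) = rich-parent j ce k a

    rich-mono : ∀ {i j v} → i ≤ j → Rich t j v → Rich t i v
    rich-mono le = go (≤⇒≤′ le)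
      where
      go : ∀ {i j v} → i ≤′ j → Rich t j v → Rich t i v
      go ≤′-refl     r = r
      go (≤′-step l) r = go l (rich-pred _ r)

    chain-shorten : ∀ {j l v} m → Chain t (Rich t j) (m + l) v → Chain t (Rich t j) l v
    chain-shorten zero    c = c
    chain-shorten (suc m) c = chain-shorten m (chain-drop (rich-parent _) c)

    up-anc : ∀ {j l v r} → Up t j l v r → Anc (parent t) l v r
    up-anc nil            = self
    up-anc (cons e _ _ u) = up e (up-anc u)

    up-mono : ∀ {i j l v r} → i ≤ j → Up t j l v r → Up t i l v r
    up-mono le nil             = nil
    up-mono le (cons e ce a u) = cons e ce (λ k → rich-mono le (a k)) (up-mono le u)

    up-++ : ∀ {j k l u v w} → Up t j k u v → Up t j l v w → Up t j (k + l) u w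
    up-++ nil             b = b
    up-++ (cons e ce a u) b = cons e ce a (up-++ u b)

    up-split : ∀ {j l u w} k → Up t j (k + l) u w → ∃ λ v → Up t j k u v × Up t j l v w
    up-split zero    b               = _ , nil , b
    up-split (suc k) (cons e ce a u) = let v , p , q = up-split k u in v , cons e ce a p , q

    chain-up : ∀ {j l i v w} d → Chain t (Rich t j) (d + l) v → Up t j i v w → ∃ λ y → Up t j (d + i) y w
    chain-up zero    c               u = _ , u
    chain-up {j} {l} {i} {v} {w} (suc d) (step (inj , par , all) a k c) u =
      let y , u' = chain-up d c (cons (par k) (inj , par , all) a u) in
      y , subst (λ m → Up t j m y w) (+-suc d i) u'

  -- The `D` generations above `w` have two uses: by `site-near` they keep balls of radius at most
  -- `D` inside the plot, and another site can be hooked below by cutting this path.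
  record Site (t : RTree δ n) (own : Fin n → Maybe ℕ) (π j : ℕ) (w : Fin n) : Set where
    constructor site
    field
      rich  : Rich t j w
      {lim} : Fin n
      upw   : Up t j D w lim
      owned : own lim ≡ just π

  Closed : RTree δ n → (Fin n → Maybe ℕ) → Set
  Closed t own = ∀ {u p π} → parent t u ≡ just p → own p ≡ just π → own u ≡ just π

  own-anc : ∀ {t own} → Closed t own → ∀ {k u v π} → Anc (parent t) k u v → own v ≡ just π → own u ≡ just π
  own-anc cl self     o = o
  own-anc {t} {own} cl (up e a) o = cl e (own-anc {t} {own} cl a o)

  site-near : ∀ {t own π j w k v} → Closed t own → Site t own π j w → k ≤ D → Dist≤ t k w v → own v ≡ just π
  site-near {t} {own} cl (site _ u o) le d = own-anc {t} {own} cl (proj₂ (dist-below d le (up-anc u))) o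

  site-mono : ∀ {t own π i j w} → i ≤ j → Site t own π j w → Site t own π i w
  site-mono le (site r u o) = site (rich-mono le r) (up-mono le u) o

  module SwapRich (t : RTree δ n) (x y px py : Fin n)
            (ex : parent t x ≡ just px) (ey : parent t y ≡ just py)
            (x≁y : ∀ k → ¬ Anc (parent t) k x y) (y≁x : ∀ k → ¬ Anc (parent t) k y x) where
    open Swap t x y px py ex ey x≁y y≁x public

    -- Below z the subtree at y may have been replaced by the one at x.
    rich-swap : ∀ j {z} → (∀ k u → Anc (parent t) k u z → u ≢ px) →
                (∀ k u → Anc (parent t) k u z → u ≡ py → Rich t' j x) → Rich t j z → Rich t' j z
    chain-swap : ∀ j l {z} → l ≤ D → (∀ k u → Anc (parent t) k u z → u ≢ px) →
                (∀ k u → Anc (parent t) k u z → u ≡ py → Rich t' (suc j) x) →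
                Chain t (Rich t j) l z → Chain t' (Rich t' j) l z

    rich-swap zero    nx hy r = tt
    rich-swap (suc j) nx hy c = chain-swap j D ≤-refl nx hy c

    chain-swap j zero {z} le nx hy (stop p) =
      stop (rich-swap j nx (λ k u a e → rich-pred j (hy k u a e)) p)
    chain-swap j (suc l) {z} le nx hy (step {f = f} ce@(inj , par , all) a k c) =
      step (childEnum-τ ce) kid k rest
      where
      kid : ∀ i → Rich t' j (τ (f i))
      kid i with f i ≟F x
      ... | yes e = ⊥-elim (nx 0 z self (just-unique (trans (cong (parent t) (sym e)) (par i)) ex))
      ... | no _ with f i ≟F y
      ...   | yes e = rich-pred j (hy 0 z self (just-unique (trans (cong (parent t) (sym e)) (par i)) ey))
      ...   | no _  = rich-swap j (λ k u b → nx _ u (anc-snoc b (par i)))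
                        (λ k u b e → rich-pred j (hy _ u (anc-snoc b (par i)) e)) (a i)
      rest : Chain t' (Rich t' j) l (τ (f k))
      rest with f k ≟F x
      ... | yes e = ⊥-elim (nx 0 z self (just-unique (trans (cong (parent t) (sym e)) (par k)) ex))
      ... | no _ with f k ≟F y
      -- The chain ran through `y`. Its replacement `x` starts a chain of full length `D`, which is
      -- cut down to the `l` generations still required.
      ...   | yes e = chain-shorten (D ∸ l) (subst (λ m → Chain t' (Rich t' j) m x) (sym (m∸n+n≡m (≤-trans (n≤1+n l) le)))
                        (hy 0 z self (just-unique (trans (cong (parent t) (sym e)) (par k)) ey)))
      ...   | no _  = chain-swap j l (≤-trans (n≤1+n l) le) (λ i u b → nx _ u (anc-snoc b (par k)))
                        (λ i u b e → hy _ u (anc-snoc b (par k)) e) c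

    childEnum-other : ∀ {p f} → p ≢ px → p ≢ py → ChildEnum δ (parent t) p f → ChildEnum δ par' p f
    childEnum-other a b (inj , par , all) = inj , (λ k → kid→ a b (par k)) , λ w e → all w (kid← a b e)

    Keeps : ℕ → Fin n → Set
    Keeps j p = p ≢ px × p ≢ py × (∀ c → parent t c ≡ just p → Rich t j c → Rich t' j c)

    up-swap : ∀ {j l v r} → (∀ i p → i < l → Anc (parent t) (suc i) v p → Keeps j p) →
      Up t j l v r → Up t' j l v r
    up-swap H nil = nil
    up-swap H (cons {f = f} e ce@(_ , par , _) a u) with H 0 _ (s≤s z≤n) (up e self)
    ... | n1 , n2 , tr = cons (kid→ n1 n2 e) (childEnum-other n1 n2 ce) (λ k → tr (f k) (par k) (a k))
                          (up-swap (λ i p lt b → H (suc i) p (s≤s lt) (up e b)) u)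

-- Hooking a site below another one

merge : ℕ → ℕ → Maybe ℕ → Maybe ℕ
merge a b nothing  = nothing
merge a b (just c) with c ≟ℕ b
... | yes _ = just a
... | no _  = just c

merge-hit : ∀ a b → merge a b (just b) ≡ just a
merge-hit a b with b ≟ℕ b
... | yes _ = refl
... | no ne = ⊥-elim (ne refl)

merge-miss : ∀ a b {c} → c ≢ b → merge a b (just c) ≡ just c
merge-miss a b {c} ne with c ≟ℕ b
... | yes e = ⊥-elim (ne e)
... | no _  = refl

merge-inv : ∀ a b {m π} → merge a b m ≡ just π → (m ≡ just b × π ≡ a) ⊎ (m ≡ just π)
merge-inv a b {just c} e with c ≟ℕ b
... | yes refl = inj₁ (refl , sym (just-injective e))
... | no _     = inj₂ e

module Hooking {δ n : ℕ} (D : ℕ) where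
  open Richness {δ} {n} D

  record Hooked (t : RTree δ n) (own : Fin n → Maybe ℕ) (a b r : ℕ) (w s : Fin n) (d e : ℕ) : Set where
    field
      t'      : RTree δ n
      closed' : Closed t' (λ u → merge a b (own u))
      path    : Up t' r (suc d + e) s w
      {lim}   : Fin n
      upw     : Up t' r D w lim
      owned   : own lim ≡ just a
      -- In the plots `a` and `b` only `w` and `s` are known to be far from the cuts; in any other
      -- plot every site is.
      agree'  : ∀ {π j z k u} → Site t own π j z → (π ≡ a → z ≡ w) → (π ≡ b → z ≡ s) → k < d → k < e →
                Dist≤ t k z u → Agree t t' u
      other   : ∀ {π j z} → π ≢ a → π ≢ b → Site t own π j z → Site t' (λ u → merge a b (own u)) π j z

  module _ {t : RTree δ n} {own : Fin n → Maybe ℕ} (cl : Closed t own) {a b r : ℕ} (a≢b : a ≢ b) {w s : Fin n}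
           {limw lims : Fin n} (ow : own limw ≡ just a) (os : own lims ≡ just b)
           {d e m : ℕ} (d≤ : d < D) (e≤ : e < D) {x y px py : Fin n}
           (uw : Up t r D w limw) (ey : parent t y ≡ just py) {f : Fin δ → Fin n} (ce : ChildEnum δ (parent t) py f)
           (rf : ∀ k → Rich t r (f k)) (uy : Up t r d py w)
           (ux : Up t r e s x) (ex : parent t x ≡ just px) (rx : Rich t r x) (ul : Anc (parent t) m px lims) where

    private
      own↓ : ∀ {k u v π} → Anc (parent t) k u v → own v ≡ just π → own u ≡ just π
      own↓ = own-anc {t} {own} cl
      own-w : own w ≡ just a
      own-w = own↓ (up-anc uw) ow
      own-py : own py ≡ just a
      own-py = own↓ (up-anc uy) own-w
      own-y : own y ≡ just a
      own-y = cl ey own-py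
      own-px : own px ≡ just b
      own-px = own↓ ul os
      own-x : own x ≡ just b
      own-x = cl ex own-px

      clash : ∀ {u : Fin n} → own u ≡ just a → own u ≡ just b → ⊥
      clash p q = a≢b (just-unique p q)

      open SwapRich t x y px py ex ey
        (λ k c → clash (own↓ c own-y) own-x) (λ k c → clash own-y (own↓ c own-x))

      rx' : Rich t' r x
      rx' = rich-swap r (λ { k u c refl → <-irrefl (dep-anc {t = t} (up ex c)) (s≤s (m≤n+m _ k)) })
                        (λ { k u c refl → ⊥-elim (clash own-py (own↓ c own-x)) }) rx

      -- A node of plot `a` above `py` loses the subtree at `y` but receives the one at `x`, which
      -- is `r`-rich as well. No node of plot `a` has the other cut point `px` below it.
      graft : ∀ {z} → own z ≡ just a → Rich t r z → Rich t' r z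
      graft {z} o = rich-swap r (λ { k u c refl → clash (own↓ c o) own-px }) (λ _ _ _ _ → rx')

      below-x : ∀ {k z} → Anc (parent t) k z x → Rich t r z → Rich t' r z
      below-x {k} {z} c = rich-swap r
        (λ { i u c' refl → <-irrefl (trans (dep-anc {t = t} (anc-trans c' c)) (cong (i + k +_) (dep-parent {t = t} ex))) (lt (dep t px) (i + k)) })
        (λ { i u c' refl → ⊥-elim (clash own-py (own↓ (anc-trans c' c) own-x)) })
        where
        lt : ∀ p q → p < q + suc p
        lt p q = m≤n+m (suc p) q

      anc-rest : ∀ {i l u v w} → i < l → Anc (parent t) l u w → Anc (parent t) (suc i) u v → ∃ λ k → Anc (parent t) k v w
      anc-rest {i} {l} lt c c' with anc-split (suc i) {l ∸ suc i} (subst (λ q → Anc (parent t) q _ _) (sym (m+[n∸m]≡n lt)) c)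
      ... | v' , p , q with anc-fun p c'
      ... | refl = _ , q

      up-graft : ∀ {j l v ρ} → own ρ ≡ just a → Anc (parent t) j py v → Up t r l v ρ → Up t' r l v ρ
      up-graft {j} {l} {v} o c u = up-swap H u
        where
        H : ∀ i p → i < l → Anc (parent t) (suc i) v p → Keeps r p
        H i p lt c' with anc-rest lt (up-anc u) c'
        ... | k , c'' = (λ { refl → clash own-p own-px }) ,
          (λ { refl → <-irrefl (dep-anc {t = t} (anc-trans c c')) (lt' i j (dep t py)) }) ,
          (λ c e → graft (cl e own-p))
          where
          own-p : own p ≡ just a
          own-p = own↓ c'' o
          lt' : ∀ i j p → p < j + suc i + p
          lt' i j p = ≤-trans (s≤s (m≤n+m p (j + i))) (≤-reflexive (cong (_+ p) (sym (+-suc j i))))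

      path₁ : Up t' r e s x
      path₁ = up-swap H ux
        where
        H : ∀ i p → i < e → Anc (parent t) (suc i) s p → Keeps r p
        H i p lt c' with anc-rest lt (up-anc ux) c'
        ... | k , c = (λ { refl → <-irrefl (trans (dep-anc {t = t} c) (cong (k +_) (dep-parent {t = t} ex))) (m≤n+m (suc (dep t px)) k) }) ,
                      (λ { refl → clash own-py (own↓ c own-x) }) ,
                      (λ z e → below-x (up e c))

      kids : ∀ k → Rich t' r (τ (f k))
      kids k with f k ≟F x
      ... | yes e' = graft own-y rich-y
        where
        rich-y : Rich t r y
        rich-y = let k' , e'' = proj₂ (proj₂ ce) y ey in subst (Rich t r) e'' (rf k')
      ... | no _ with f k ≟F y
      ...   | yes _ = rx'
      ...   | no _  = graft (cl (proj₁ (proj₂ ce) k) own-py) (rf k)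

      own' : Fin n → Maybe ℕ
      own' u = merge a b (own u)

      closed-by : ∀ {u p π} → Dec (u ≡ x) → Dec (u ≡ y) → par' u ≡ just p → own' p ≡ just π → own' u ≡ just π
      closed-by (yes refl) _ e' o with just-unique e' par'-x
      ... | refl with just-unique o (trans (cong (merge a b) own-py) (merge-miss a b a≢b))
      ...   | refl = trans (cong (merge a b) own-x) (merge-hit a b)
      closed-by (no ne) (yes refl) e' o with just-unique e' par'-y
      ... | refl with just-unique o (trans (cong (merge a b) own-px) (merge-hit a b))
      ...   | refl = trans (cong (merge a b) own-y) (merge-miss a b a≢b)
      closed-by (no ne) (no ne') e' o with merge-inv a b o
      ... | inj₁ (q , refl) = trans (cong (merge a b) (cl (trans (sym (par'-other ne ne')) e') q)) (merge-hit a b)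
      ... | inj₂ q = trans (cong (merge a b) (trans (cl (trans (sym (par'-other ne ne')) e') q) (sym q))) o

      closed : Closed t' own'
      closed {u} = closed-by (u ≟F x) (u ≟F y)

      -- The nodes `x` and `px` lie at least `e` generations above `s`, and `y` and `py` at least
      -- `d` below `w`, while a walk of length `k` changes the depth by at most `k`. In other plots
      -- ownership separates.
      near : ∀ {π j z k u} → Site t own π j z → (π ≡ a → z ≡ w) → (π ≡ b → z ≡ s) → k < d → k < e →
             Dist≤ t k z u → u ≢ x × u ≢ y × u ≢ px × u ≢ py
      near {π} {j} {z} {k} {u} st za zb k<d k<e dist =
        (λ { refl → far-s (just-unique own-u own-x) (≤-reflexive (sym dep-sx)) }) ,
        (λ { refl → far-w (just-unique own-u own-y) (≤-trans (n≤1+n _) (≤-reflexive (sym (trans (dep-parent {t = t} ey) (cong suc dep-py))))) }) ,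
        (λ { refl → far-s (just-unique own-u own-px) (≤-trans (+-monoʳ-≤ e (≤-trans (n≤1+n _) (≤-reflexive (sym (dep-parent {t = t} ex))))) (≤-reflexive (sym dep-sx))) }) ,
        (λ { refl → far-w (just-unique own-u own-py) (≤-reflexive (sym dep-py)) })
        where
        own-u : own u ≡ just π
        own-u = site-near cl st (≤-trans (<⇒≤ k<d) (<⇒≤ d≤)) dist
        dep-sx : dep t s ≡ e + dep t x
        dep-sx = dep-anc {t = t} (up-anc ux)
        dep-py : dep t py ≡ d + dep t w
        dep-py = dep-anc {t = t} (up-anc uy)
        far-s : π ≡ b → e + dep t u ≤ dep t s → ⊥
        far-s eq le with zb eq
        ... | refl = <⇒≱ k<e (+-cancelʳ-≤ (dep t u) e k (≤-trans le (dep-dist (dist-sym dist))))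
        far-w : π ≡ a → d + dep t w ≤ dep t u → ⊥
        far-w eq le with za eq
        ... | refl = <⇒≱ k<d (+-cancelʳ-≤ (dep t w) d k (≤-trans le (dep-dist dist)))

      transfer : ∀ {π j z} → π ≢ a → π ≢ b → Site t own π j z → Site t' own' π j z
      transfer {π} {j} {z} na nb (site rich {lim} u o) =
        site (clean (own↓ (up-anc u) o) rich) (up-swap H u) (trans (cong (merge a b) o) (merge-miss a b nb))
        where
        not-px : ∀ {v} → own v ≡ just π → v ≢ px
        not-px o refl = nb (just-unique o own-px)
        not-py : ∀ {v} → own v ≡ just π → v ≢ py
        not-py o refl = na (just-unique o own-py)
        clean : ∀ {v} → own v ≡ just π → Rich t j v → Rich t' j v
        clean o = rich-swap j (λ k u c → not-px (own↓ c o))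
                              (λ k u c e → ⊥-elim (not-py (own↓ c o) e))
        H : ∀ i p → i < D → Anc (parent t) (suc i) z p → Keeps j p
        H i p lt c with anc-rest lt (up-anc u) c
        ... | k , c' = let op = own↓ c' o in not-px op , not-py op , λ v e → clean (cl e op)

    hooked : Hooked t own a b r w s d e
    hooked = record
      { t' = t' ; closed' = λ {u} → closed {u}
      ; path = subst (λ l → Up t' r l s w) (trans (+-suc e d) (cong suc (+-comm e d)))
                 (up-++ path₁ (cons par'-x (childEnum-τ ce) kids (up-graft own-w self uy)))
      ; upw = up-graft ow (up-anc uy) uw ; owned = ow
      ; agree' = λ {π} {j} {z} {k} {u} st za zb kd ke dist →
          let p , q , p' , q' = near st za zb kd ke dist in swap-agree u p q p' q'
      ; other = transfer }

  abstract
    -- The node `y` is taken `d + 1` generations below `w` on its chain, and `x` is taken `e`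
    -- generations above `s`. After their exchange `x` hangs under `py`, so `s` is `e + 1 + d` below
    -- `w`.
    hook : ∀ {t own a b r w s} → Closed t own → a ≢ b → Site t own a (suc r) w → Site t own b (suc r) s →
           ∀ d e → d < D → e < D → Hooked t own a b r w s d e
    hook {t} {own} {a} {b} {r} {w} {s} cl a≢b (site rich uw ow) (site _ us os) d e d< e<
      with chain-up {l = D ∸ suc d} {i = 0} (suc d) (subst (λ l → Chain t (Rich t r) l w) (sym (m+[n∸m]≡n d<)) rich) nil
         | up-split {l = suc (D ∸ suc e)} e (subst (λ l → Up t (suc r) l s _) (sym (trans (+-suc e _) (m+[n∸m]≡n e<))) us)
    ... | y , cons ey ce rf uy | x , ux , cons ex ce' rf' ul =
      hooked cl a≢b ow os d< e< (up-mono (n≤1+n r) uw) ey ce rf (subst (λ l → Up t r l _ w) (+-identityʳ d) uy)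
        (up-mono (n≤1+n r) ux) ex
        (let k , eq = proj₂ (proj₂ ce') x ex in subst (Rich t r) eq (rich-pred r (rf' k))) (up-anc ul)

-- The adversary

2^-double : ∀ k → 2 ^ k + 2 ^ k ≡ 2 ^ suc k
2^-double k = cong (2 ^ k +_) (sym (+-identityʳ (2 ^ k)))

bit : ∀ {A : Set} → Maybe A → ℕ → ℕ
bit nothing  w = 0
bit (just _) w = w

-- The stock is read as a binary number with the digit of rank 0 in front; every round increases it.
value : ∀ {A : Set} → ℕ → (ℕ → Maybe A) → ℕ
value zero    s = 0
value (suc k) s = bit (s 0) (2 ^ k) + value k (s ∘ suc)

value< : ∀ {A : Set} k (s : ℕ → Maybe A) → value k s < 2 ^ k
value< zero    s = s≤s z≤n
value< (suc k) s = ≤-trans (≤-reflexive (sym (+-suc _ _))) (≤-trans (+-mono-≤ (bit≤ (s 0)) (value< k (s ∘ suc)))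
  (≤-reflexive (2^-double k)))
  where
  bit≤ : ∀ m → bit m (2 ^ k) ≤ 2 ^ k
  bit≤ nothing  = z≤n
  bit≤ (just _) = ≤-refl

-- By `value<` the new digit outweighs all digits behind it, so the stock of every rank above `r`
-- may be lost.
value-lex : ∀ {A : Set} k (s s' : ℕ → Maybe A) r {x : A} → r < k → s r ≡ nothing → s' r ≡ just x →
            (∀ i → i < r → s' i ≡ s i) → value k s < value k s'
value-lex (suc k) s s' zero r< e e' same rewrite e | e' = ≤-trans (value< k (s ∘ suc)) (m≤m+n _ _)
value-lex (suc k) s s' (suc r) (s≤s r<) e e' same rewrite same 0 (s≤s z≤n) =
  ≤-trans (≤-reflexive (sym (+-suc _ _))) (+-monoʳ-≤ (bit (s 0) (2 ^ k))
    (value-lex k (s ∘ suc) (s' ∘ suc) r r< e e' (λ i lt → same (suc i) (s≤s lt))))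

search : ∀ {A : Set} {Q : A → Set} → (∀ x → Dec (Q x)) → ∀ xs → (∃ λ x → x ∈ xs × Q x) ⊎ (∀ x → x ∈ xs → ¬ Q x)
search q [] = inj₂ (λ _ ())
search q (x ∷ xs) with q x
... | yes p = inj₁ (x , here refl , p)
... | no np with search q xs
...   | inj₁ (y , i , p) = inj₁ (y , there i , p)
...   | inj₂ none = inj₂ (λ { _ (here refl) → np ; y (there i) → none y i })

_[_≔_] : ∀ {A : Set} → (ℕ → A) → ℕ → A → ℕ → A
(f [ i ≔ x ]) j with j ≟ℕ i
... | yes _ = x
... | no _  = f j

update-hit : ∀ {A : Set} (f : ℕ → A) i x → (f [ i ≔ x ]) i ≡ x
update-hit f i x with i ≟ℕ i
... | yes _ = refl
... | no ne = ⊥-elim (ne refl)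

update-miss : ∀ {A : Set} (f : ℕ → A) i x {j} → j ≢ i → (f [ i ≔ x ]) j ≡ f j
update-miss f i x {j} ne with j ≟ℕ i
... | yes e = ⊥-elim (ne e)
... | no _  = refl

-- Lists of processed nodes

module Processing {Π : LCL} {n T : ℕ} (P : Player Π n T) where
  open LCL Π
  open Player P
  open import Data.List.Membership.DecPropositional (_≟F_ {n}) using (_∈?_)

  insert : Fin n → List (Fin n) → List (Fin n)
  insert z vs with z ∈? vs
  ... | yes _ = vs
  ... | no _  = z ∷ vs

  insert-unique : ∀ z {vs} → Unique vs → Unique (insert z vs)
  insert-unique z {vs} u with z ∈? vs
  ... | yes _ = u
  ... | no ni = all-≢ vs ni ∷ u

  insert-old : ∀ z {v vs} → v ∈ vs → v ∈ insert z vs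
  insert-old z {v} {vs} i with z ∈? vs
  ... | yes _ = i
  ... | no _  = there i

  insert-new : ∀ z vs → z ∈ insert z vs
  insert-new z vs with z ∈? vs
  ... | yes i = i
  ... | no _  = here refl

  insert-inv : ∀ z {v} vs → v ∈ insert z vs → v ≡ z ⊎ v ∈ vs
  insert-inv z vs i with z ∈? vs
  ... | yes _ = inj₂ i
  insert-inv z vs (here refl) | no _ = inj₁ refl
  insert-inv z vs (there i)   | no _ = inj₂ i

  insert-lab : ∀ t z {v vs} → Unique vs → v ∈ vs → lab t (insert z vs) v ≡ lab t vs v
  insert-lab t z {v} {vs} u i with z ∈? vs
  ... | yes _ = refl
  ... | no ni = lab-ext t vs z v (all-≢ vs ni ∷ u) i

  inserts : List (Fin n) → List (Fin n) → List (Fin n)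
  inserts []       vs = vs
  inserts (z ∷ zs) vs = insert z (inserts zs vs)

  inserts-unique : ∀ zs {vs} → Unique vs → Unique (inserts zs vs)
  inserts-unique []       u = u
  inserts-unique (z ∷ zs) u = insert-unique z (inserts-unique zs u)

  inserts-old : ∀ zs {v vs} → v ∈ vs → v ∈ inserts zs vs
  inserts-old []       i = i
  inserts-old (z ∷ zs) i = insert-old z (inserts-old zs i)

  inserts-new : ∀ {zs z} vs → z ∈ zs → z ∈ inserts zs vs
  inserts-new {z ∷ zs} vs (here refl) = insert-new z (inserts zs vs)
  inserts-new {z ∷ zs} vs (there i)   = insert-old z (inserts-new vs i)

  inserts-inv : ∀ zs {v} vs → v ∈ inserts zs vs → v ∈ zs ⊎ v ∈ vs
  inserts-inv []       vs i = inj₂ i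
  inserts-inv (z ∷ zs) vs i with insert-inv z (inserts zs vs) i
  ... | inj₁ refl = inj₁ (here refl)
  ... | inj₂ j with inserts-inv zs vs j
  ...   | inj₁ k = inj₁ (there k)
  ...   | inj₂ k = inj₂ k

  inserts-lab : ∀ t zs {v vs} → Unique vs → v ∈ vs → lab t (inserts zs vs) v ≡ lab t vs v
  inserts-lab t []       u i = refl
  inserts-lab t (z ∷ zs) u i = trans (insert-lab t z (inserts-unique zs u) (inserts-old zs i)) (inserts-lab t zs u i)

-- With `M` the previous radius, an attached path has length at most `2 M + 2 T + 4`. From the new
-- site an old node is reached by going up the path, down to the hooked site, and `M` further:
-- `5 M + 4 T + 8` in total.
radius : ℕ → ℕ → ℕ
radius T zero    = 0
radius T (suc h) = 5 * radius T h + 4 * T + 8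

radius-mono : ∀ T {h h'} → h ≤ h' → radius T h ≤ radius T h'
radius-mono T z≤n = z≤n
radius-mono T (s≤s le) = +-monoˡ-≤ 8 (+-monoˡ-≤ (4 * T) (*-monoʳ-≤ 5 (radius-mono T le)))

-- States and rounds of the game

module Game (Π : LCL) (R : Labels.Ranking Π) {n T : ℕ} (P : Player Π n T) (D : ℕ) where
  open LCL Π
  open Labels Π
  open Ranking R
  open Player P
  open Processing P
  open Richness {δ} {n} D
  open Hooking {δ} {n} D

  kids : ∀ {t j l v r} → Up t j l v r → List (Fin n)
  kids nil                     = []
  kids (cons {f = f} _ _ _ u) = tabulateL f ++ kids u

  kids-up : ∀ {t j l v r} (u : Up t j l v r) {z} → z ∈ kids u → Rich t j z × ∃ λ i → i < l × Up t j (suc i) z r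
  kids-up (cons {l} {f = f} e ce@(_ , par , _) a u) i with ∈-++⁻ (tabulateL f) i
  ... | inj₁ i' with ∈-tabulate⁻ {f = f} i'
  ...   | k , refl = a k , l , ≤-refl , cons (par k) ce a u
  kids-up (cons {l} {f = f} e ce a u) i | inj₂ i' =
    let r , j , lt , u' = kids-up u i' in r , j , <-trans lt (n<1+n l) , u'

  path-walk : ∀ {t j l v r} (u : Up t j l v r) (L : Fin n → Fin γ) → Feasible Π t L → {S : Fin γ → Set} →
              (∀ z → z ∈ kids u → S (L z)) → S (L r) → Walk S l (L r) (L v) × S (L v)
  path-walk nil L feas H s = [] , s
  path-walk {t} {l = suc l} {v} {ρ} (cons {p = p} {f = f} e ce@(_ , _ , all) a u) L feas {S} H s
    with path-walk u L feas (λ z i → H z (∈-++⁺ʳ (tabulateL f) i)) s | feas p f ce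
  ... | w , sp | g , (_ , gpar , gall) , c =
    subst (λ m → Walk S m (L ρ) (L v)) (+-comm l 1)
      (walk-++ w ((tabulate (λ k → L (g k)) , c , sp , (λ k → subst S (sym (lookup∘tabulate _ k)) (kid (gpar k))) ,
        (let k , eq = gall v e in k , trans (lookup∘tabulate _ k) (cong L eq))) ∷ [])) , kid e
    where
    kid : ∀ {z} → parent t z ≡ just p → S (L z)
    kid {z} ez = let k , eq = all z ez in H z (∈-++⁺ˡ (subst (_∈ tabulateL f) eq (∈-tabulate⁺ k)))

  -- After h attachments: own maps a node to its plot, act a plot to its site and the level of that site,
  -- stock a rank to a plot whose site has received the label of this rank; the plots below F are untouched.
  record State (h F : ℕ) : Set where
    field
      t       : RTree δ n
      vs      : List (Fin n)
      uniq    : Unique vs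
      own     : Fin n → Maybe ℕ
      closed  : Closed t own
      act     : ℕ → Maybe (Fin n × ℕ)
      sites   : ∀ {π w j} → act π ≡ just (w , j) → Site t own π j w
      home    : ∀ {v} → v ∈ vs → ∃ λ π → ∃ λ w → ∃ λ j → act π ≡ just (w , j) × Dist≤ t (radius T h) w v
      fresh   : ∀ {π} → π < F → ∃ λ w → act π ≡ just (w , γ)
      stock   : ℕ → Maybe ℕ
      stocked : ∀ {r π} → stock r ≡ just π → F ≤ π × ∃ λ w → act π ≡ just (w , suc r) × w ∈ vs × rank (lab t vs w) ≡ r

  -- The position in the middle of a round: the plot in play is no longer fresh and not in the
  -- stock, so it can be hooked to a stored one without conflict.
  record Current {h F : ℕ} (s : State h F) (r : ℕ) : Set where
    open State s
    field
      plot    : ℕ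
      old     : F ≤ plot
      node    : Fin n
      is-act  : act plot ≡ just (node , suc r)
      done    : node ∈ vs
      is-rank : rank (lab t vs node) ≡ r
      unused  : ∀ {i π} → stock i ≡ just π → π ≢ plot

  currentLabel : ∀ {h F r} {s : State h F} → Current s r → Fin γ
  currentLabel {s = s} c = lab (State.t s) (State.vs s) (Current.node c)

  -- The attachment spends the stored site of rank `r`. This is allowed because the round will end
  -- by storing a lower rank, and the stock below `r` is untouched.
  Descends : ∀ {h F} → State h F → ℕ → Set
  Descends {h} {F} s r = ∃ λ r' → r' < r × ∃ λ (s' : State (suc h) F) →
    Current s' r' × (∀ {i} → i < r → State.stock s' i ≡ State.stock s i)

  Improves : ∀ {h h' F} → State h F → State h' F → ℕ → Set
  Improves s s' r = ∃ λ i → i ≤ r × State.stock s i ≡ nothing × (∃ λ π → State.stock s' i ≡ just π) ×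
    (∀ m → m < i → State.stock s' m ≡ State.stock s m)

  store : ∀ {h F r} (s : State h F) → Current s r → State.stock s r ≡ nothing → ∃ λ (s' : State h F) → Improves s s' r
  store {h} {F} {r} s c none = s' , r , ≤-refl , none , (plot , update-hit stock r (just plot)) ,
      λ m lt → update-miss stock r _ (<⇒≢ lt)
    where
    open State s
    open Current c
    s' : State h F
    s' = record { t = t ; vs = vs ; uniq = uniq ; own = own ; closed = closed ; act = act ; sites = sites ; home = home
                ; fresh = fresh ; stock = stock [ r ≔ just plot ] ; stocked = ok }
      where
      ok : ∀ {i π} → (stock [ r ≔ just plot ]) i ≡ just π → F ≤ π × ∃ λ w → act π ≡ just (w , suc i) × w ∈ vs × rank (lab t vs w) ≡ i
      ok {i} e with i ≟ℕ r
      ... | no _     = stocked e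
      ... | yes refl with just-injective e
      ...   | refl = old , node , is-act , done , is-rank

  module Attach {h F r : ℕ} (s : State h F) (c : Current s r) {b : ℕ} (old-b : F ≤ b) (unused-b : b ≢ Current.plot c)
                {v₀ : Fin n} (act-b : State.act s b ≡ just (v₀ , suc r)) (done-b : v₀ ∈ State.vs s)
                (rank-b : rank (lab (State.t s) (State.vs s) v₀) ≡ r) {d e : ℕ}
                (near-d : radius T h + T < d) (near-e : radius T h + T < e)
                (far : (suc d + e) + (suc d + e) + radius T h ≤ radius T (suc h))
                (hk : Hooked (State.t s) (State.own s) (Current.plot c) b r (Current.node c) v₀ d e) where
    open State s
    open Current c
    open Hooked hk

    private
      M len a : ℕ
      M   = radius T h
      len = suc d + e
      a   = plot

      w : Fin n
      w = node

      a≢b : a ≢ b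
      a≢b q = unused-b (sym q)

      own' : Fin n → Maybe ℕ
      own' u = merge a b (own u)

      zs vs' : List (Fin n)
      zs  = kids path
      vs' = inserts zs vs

      uniq' : Unique vs'
      uniq' = inserts-unique zs uniq

      near-agree : ∀ {π w' j k u} → act π ≡ just (w' , j) → k ≤ M + T → Dist≤ t k w' u → Agree t t' u
      near-agree {π} {w'} ac le dist = agree' (sites ac)
        (λ { refl → cong proj₁ (just-unique ac is-act) }) (λ { refl → cong proj₁ (just-unique ac act-b) })
        (≤-<-trans le near-d) (≤-<-trans le near-e) dist

      near-dist : ∀ {π w' j k u} → act π ≡ just (w' , j) → k ≤ M + T → Dist≤ t k w' u → Dist≤ t' k w' u
      near-dist ac le dist = agree-dist (λ _ → near-agree ac le) dist

      -- A processed node is within `M` of the site of its plot, so its view stays within `M + T` of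
      -- that site and stops short of both cuts. Hence no label given so far is affected by the
      -- exchange.
      lab-same : ∀ {v} → v ∈ vs → lab t' vs' v ≡ lab t vs v
      lab-same {v} i = trans (inserts-lab t' zs uniq i) (sym (lab-agree t t' vs uniq
        (λ v' u i' dist → let π , w' , j , ac , d' = home i' in near-agree ac ≤-refl (dist-trans d' dist)) v i))

      top-rank : rank (lab t' vs' w) ≡ r
      top-rank = trans (cong rank (lab-same done)) is-rank

      bottom-rank : rank (lab t' vs' v₀) ≡ r
      bottom-rank = trans (cong rank (lab-same done-b)) rank-b

    act' : Fin n → ℕ → ℕ → Maybe (Fin n × ℕ)
    act' z j = (act [ b ≔ nothing ]) [ a ≔ just (z , j) ]

    act'-other : ∀ {z j π} → π ≢ a → π ≢ b → act' z j π ≡ act π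
    act'-other na nb = trans (update-miss _ a _ na) (update-miss _ b _ nb)

    module _ {z : Fin n} (z∈ : z ∈ zs) {r' : ℕ} (r'<r : r' < r) (rk : rank (lab t' vs' z) ≡ r') where

      private
        new-site : Site t' own' a (suc r') z
        new-site with kids-up path z∈
        ... | rich , i , _ , u with up-split D (subst (λ q → Up t' r q z lim) (+-comm (suc i) D) (up-++ u upw))
        ...   | v , u₁ , u₂ = site-mono r'<r (site rich u₁
                  (own-anc {t'} {own'} (λ {u} → closed' {u}) (up-anc u₂) (trans (cong (merge a b) owned) (merge-miss a b a≢b))))

        to-top : ∀ {y} → y ∈ zs → Dist≤ t' len y w
        to-top y∈ with kids-up path y∈
        ... | _ , i , lt , u = dist-mono lt (dist-anc {t = t'} (up-anc u))

        M≤ : M ≤ radius T (suc h)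
        M≤ = ≤-trans (m≤n+m M (len + len)) far

      attached : State (suc h) F
      attached = record
        { t = t' ; vs = vs' ; uniq = uniq' ; own = own' ; closed = λ {u} → closed' {u}
        ; act = act' z (suc r') ; sites = sites' ; home = home' ; fresh = fresh'
        ; stock = stock [ r ≔ nothing ] ; stocked = stocked' }
        where
        sites' : ∀ {π y j} → act' z (suc r') π ≡ just (y , j) → Site t' own' π j y
        sites' {π} q with π ≟ℕ a
        ... | yes refl with just-injective q
        ...   | refl = new-site
        sites' {π} q | no na with π ≟ℕ b
        ...   | no nb = other na nb (sites q)
        home' : ∀ {v} → v ∈ vs' → ∃ λ π → ∃ λ y → ∃ λ j → act' z (suc r') π ≡ just (y , j) × Dist≤ t' (radius T (suc h)) y v
        home' {v} i with inserts-inv zs vs i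
        ... | inj₁ v∈ = a , z , suc r' , update-hit _ a _ ,
              dist-mono (≤-trans (m≤m+n (len + len) M) far) (dist-trans (to-top z∈) (dist-sym (to-top v∈)))
        ... | inj₂ v∈ with home v∈
        ...   | π , y , j , ac , dist with near-dist ac (m≤m+n M T) dist
        ...     | dist' with π ≟ℕ a
        ...       | yes refl with just-unique ac is-act
        ...         | refl = a , z , suc r' , update-hit _ a _ ,
                      dist-mono (≤-trans (+-monoˡ-≤ M (m≤m+n len len)) far) (dist-trans (to-top z∈) dist')
        home' {v} i | inj₂ v∈ | π , y , j , ac , dist | dist' | no na with π ≟ℕ b
        ...       | yes refl with just-unique ac act-b
        ...         | refl = a , z , suc r' , update-hit _ a _ ,
                      dist-mono far (dist-trans (dist-trans (to-top z∈) (dist-sym (dist-anc {t = t'} (up-anc path)))) dist')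
        home' {v} i | inj₂ v∈ | π , y , j , ac , dist | dist' | no na | no nb =
              π , y , j , trans (act'-other na nb) ac , dist-mono M≤ dist'
        fresh' : ∀ {π} → π < F → ∃ λ y → act' z (suc r') π ≡ just (y , γ)
        fresh' {π} lt = let y , q = fresh lt in
          y , trans (act'-other (λ { refl → <⇒≱ lt old }) (λ { refl → <⇒≱ lt old-b })) q
        stocked' : ∀ {i π} → (stock [ r ≔ nothing ]) i ≡ just π →
                   F ≤ π × ∃ λ y → act' z (suc r') π ≡ just (y , suc i) × y ∈ vs' × rank (lab t' vs' y) ≡ i
        stocked' {i} {π} q with i ≟ℕ r
        ... | no ne with stocked q
        ...   | le , y , ac , y∈ , ry = le , y ,
                trans (act'-other (unused q) (λ { refl → ne (suc-injective (cong proj₂ (just-unique ac act-b))) })) ac ,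
                inserts-old zs y∈ , trans (cong rank (lab-same y∈)) ry

      attached-current : Current attached r'
      attached-current = record
        { plot = a ; old = old ; node = z ; is-act = update-hit _ a _ ; done = inserts-new vs z∈ ; is-rank = rk
        ; unused = λ {i} q → unused {i} (back i q) }
        where
        back : ∀ i {π} → (stock [ r ≔ nothing ]) i ≡ just π → stock i ≡ just π
        back i q with i ≟ℕ r
        ... | no _ = q

    private
      -- Both ends of the path have rank `r`, hence the same label by `rank-inj`, so the walk read
      -- off the path is closed.
      all-high : (∀ z → z ∈ zs → r ≤ rank (lab t' vs' z)) → Walk (λ q → r ≤ rank q) len (lab t' vs' w) (lab t' vs' w)
      all-high H with lab-feas t' vs' uniq'
      ... | L , feas , same = subst₂ (Walk (λ q → r ≤ rank q) len) (same w (inserts-old zs done))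
          (trans (same v₀ (inserts-old zs done-b)) (rank-inj (trans bottom-rank (sym top-rank))))
          (proj₁ (path-walk path L feas (λ z i → subst (λ q → r ≤ rank q) (sym (same z (inserts-new vs i))) (H z i))
            (subst (λ q → r ≤ rank q) (sym (same w (inserts-old zs done))) (≤-reflexive (sym top-rank)))))

    outcome : Descends s r ⊎ Walk (λ q → r ≤ rank q) len (lab t vs w) (lab t vs w)
    outcome with search (λ z → rank (lab t' vs' z) <? r) zs
    ... | inj₁ (z , z∈ , lt) = inj₁ (_ , lt , attached z∈ lt refl , attached-current z∈ lt refl ,
                                     λ i<r → update-miss stock r nothing (<⇒≢ i<r))
    ... | inj₂ none = inj₂ (subst (λ q → Walk (λ q → r ≤ rank q) len q q) (lab-same done)
                        (all-high (λ z i → ≮⇒≥ (none z i))))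

  attach : ∀ {h F r b} (s : State h F) (c : Current s r) → State.stock s r ≡ just b → radius T h + T + 3 ≤ D → ∀ x → x ≤ 1 →
    Descends s r ⊎ Walk (λ q → r ≤ rank q) (x + 2 * (radius T h + T) + 3) (currentLabel c) (currentLabel c)
  attach {h} {F} {r} {b} s c eb room x x≤ = let old-b , v₀ , act-b , done-b , rank-b = State.stocked s eb in
    subst (λ l → Descends s r ⊎ Walk (λ q → r ≤ rank q) l (currentLabel c) (currentLabel c))
      (total x (M + T))
      (Attach.outcome s c old-b (Current.unused c eb) act-b done-b rank-b near-d near-e far
        (hook (State.closed s) (λ q → Current.unused c eb (sym q)) (State.sites s (Current.is-act c)) (State.sites s act-b) d e d<D e<D))
    where
    M d e : ℕ
    M = radius T h
    -- The shortest distances that keep the cuts out of the views. The values 0 and 1 of `x` give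
    -- the two consecutive path lengths that inflexibility speaks about.
    d = suc (M + T)
    e = x + suc (M + T)
    d<D : d < D
    d<D = ≤-trans (≤-reflexive (+-comm 2 (M + T))) (≤-trans (+-monoʳ-≤ (M + T) (s≤s (s≤s z≤n))) room)
    e<D : e < D
    e<D = ≤-trans (s≤s (+-monoˡ-≤ (suc (M + T)) x≤)) (≤-trans (≤-reflexive (+-comm 3 (M + T))) room)
    near-d : M + T < d
    near-d = ≤-refl
    near-e : M + T < e
    near-e = m≤n+m d x
    far : (suc d + e) + (suc d + e) + M ≤ radius T (suc h)
    far = ≤-trans (≤-reflexive (expand x M T)) (≤-trans (+-monoʳ-≤ (5 * M + 4 * T + 6) (+-mono-≤ x≤ x≤)) (≤-reflexive (+-assoc (5 * M + 4 * T) 6 2)))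
      where
      expand : ∀ x M T → (suc (suc (M + T)) + (x + suc (M + T))) + (suc (suc (M + T)) + (x + suc (M + T))) + M
               ≡ 5 * M + 4 * T + 6 + (x + x)
      expand = solve-∀
    total : ∀ x m → suc (suc m) + (x + suc m) ≡ x + 2 * m + 3
    total = solve-∀

  module _ (H : ℕ) (room : radius T H + T + 3 ≤ D) where

    -- The rank stays below `bound`, and every attachment lowers both, so a round makes at most
    -- `bound` attachments. The stock is only promised to have improved at some rank up to `r`, as
    -- required by `value-lex`.
    play : ∀ bound {h F r} (s : State h F) → Current s r → r < bound → h + bound ≤ H →
           (∀ {h'} (s' : State h' F) → h' ≤ h + bound → Improves s s' r → ⊥) → ⊥
    play (suc bound) {h} {F} {r} s c (s≤s r≤) h≤ k with State.stock s r in eb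
    ... | nothing = let s' , imp = store s c eb in k s' (m≤m+n h (suc bound)) imp
    -- Both hookings start from the same state `s`: the player is a function, so a failed attempt
    -- leaves no trace. If both fail, the two closed walks contradict `inflex`.
    ... | just b  = try 0 z≤n (λ w₀ → try 1 ≤-refl (λ w₁ → inflex a (_ , restrict w₀ , restrict w₁)))
      where
      a : Fin γ
      a = currentLabel c
      room-h : radius T h + T + 3 ≤ D
      room-h = ≤-trans (+-monoˡ-≤ 3 (+-monoˡ-≤ T (radius-mono T (≤-trans (m≤m+n h (suc bound)) h≤)))) room
      restrict : ∀ {l} → Walk (λ q → r ≤ rank q) l a a → Walk (λ q → rank a ≤ rank q) l a a
      restrict = walk-mono (subst (_≤ _) (sym (Current.is-rank c)))
      try : ∀ x → x ≤ 1 → (Walk (λ q → r ≤ rank q) (x + 2 * (radius T h + T) + 3) a a → ⊥) → ⊥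
      try x x≤ k' with attach s c eb room-h x x≤
      ... | inj₂ w = k' w
      ... | inj₁ (r' , lt , s₁ , c₁ , kept) =
        play bound s₁ c₁ (<-≤-trans lt r≤) (subst (_≤ H) (+-suc h bound) h≤)
          (λ s' h'≤ → λ { (i , i≤ , e , e' , same) →
            k s' (≤-trans h'≤ (≤-reflexive (sym (+-suc h bound))))
              (i , ≤-trans i≤ (<⇒≤ lt) , trans (sym (kept (≤-<-trans i≤ lt))) e , e' ,
               λ m m< → trans (same m m<) (kept (<-trans m< (≤-<-trans i≤ lt)))) })

    -- A fresh site is `γ`-rich because its label is not known beforehand; once it is processed,
    -- only the level that its rank requires is kept.
    start : ∀ {h F} (s : State h (suc F)) →
            ∃ λ (s' : State h F) → (∀ i → State.stock s' i ≡ State.stock s i) × ∃ λ r → r < γ × Current s' r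
    start {h} {F} s = s' , (λ _ → refl) , r , rank< (lab t (insert w vs) w) , record
        { plot = F ; old = ≤-refl ; node = w ; is-act = update-hit act F _ ; done = insert-new w vs ; is-rank = refl
        ; unused = λ q → λ { refl → <-irrefl refl (proj₁ (stocked q)) } }
      where
      open State s
      w : Fin n
      w = proj₁ (fresh ≤-refl)
      act-F : act F ≡ just (w , γ)
      act-F = proj₂ (fresh ≤-refl)
      r : ℕ
      r = rank (lab t (insert w vs) w)
      s' : State h F
      s' = record { t = t ; vs = insert w vs ; uniq = insert-unique w uniq ; own = own ; closed = closed
                  ; act = act [ F ≔ just (w , suc r) ] ; sites = sites' ; home = home' ; fresh = fresh' ; stock = stock ; stocked = stocked' }
        where
        sites' : ∀ {π y j} → (act [ F ≔ just (w , suc r) ]) π ≡ just (y , j) → Site t own π j y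
        sites' {π} q with π ≟ℕ F
        ... | no _ = sites q
        ... | yes refl with just-injective q
        ...   | refl = site-mono (rank< _) (sites act-F)
        home' : ∀ {v} → v ∈ insert w vs → ∃ λ π → ∃ λ y → ∃ λ j → (act [ F ≔ just (w , suc r) ]) π ≡ just (y , j) × Dist≤ t (radius T h) y v
        home' i with insert-inv w vs i
        ... | inj₁ refl = F , w , suc r , update-hit act F _ , stay
        ... | inj₂ i' with home i'
        ...   | π , y , j , ac , d with π ≟ℕ F
        ...     | no ne = π , y , j , trans (update-miss act F _ ne) ac , d
        ...     | yes refl with just-unique ac act-F
        ...       | refl = F , w , suc r , update-hit act F _ , d
        fresh' : ∀ {π} → π < F → ∃ λ y → (act [ F ≔ just (w , suc r) ]) π ≡ just (y , γ)
        fresh' lt = let y , q = fresh (<-trans lt (n<1+n F)) in y , trans (update-miss act F _ (<⇒≢ lt)) q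
        stocked' : ∀ {i π} → stock i ≡ just π → F ≤ π × ∃ λ y → (act [ F ≔ just (w , suc r) ]) π ≡ just (y , suc i) × y ∈ insert w vs × rank (lab t (insert w vs) y) ≡ i
        stocked' q with stocked q
        ... | le , y , ac , y∈ , ry = <⇒≤ le , y , trans (update-miss act F _ (λ { refl → <-irrefl refl le })) ac ,
              insert-old w y∈ , trans (cong rank (insert-lab t w uniq y∈)) ry

    value-cong : ∀ {A : Set} k {s s' : ℕ → Maybe A} → (∀ i → s i ≡ s' i) → value k s ≡ value k s'
    value-cong zero    e = refl
    value-cong (suc k) e = cong₂ _+_ (cong (λ m → bit m (2 ^ k)) (e 0)) (value-cong k (λ i → e (suc i)))

    -- A round consumes one fresh plot but raises the value of the stock, so `value + F` never drops
    -- below `2 ^ γ`. With no fresh plot left this contradicts `value<`.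
    run : ∀ F {h} (s : State h F) → h + F * γ ≤ H → 2 ^ γ ≤ value γ (State.stock s) + F → ⊥
    run zero s h≤ v≤ = <⇒≱ (value< γ (State.stock s)) (subst (2 ^ γ ≤_) (+-identityʳ _) v≤)
    run (suc F) {h} s h≤ v≤ with start s
    ... | s₁ , same , r , r<γ , c = play γ s₁ c r<γ
          (≤-trans (+-monoʳ-≤ h (m≤m+n γ (F * γ))) h≤)
          (λ s' h'≤ → λ { (i , i≤ , e , (π , e') , agr) → run F s'
            (≤-trans (+-monoˡ-≤ (F * γ) h'≤) (≤-trans (≤-reflexive (+-assoc h γ (F * γ))) h≤))
            (≤-trans v≤ (≤-trans (≤-reflexive (+-suc _ F)) (+-monoˡ-≤ F
              (subst (_< value γ (State.stock s')) (value-cong γ same)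
                (value-lex γ (State.stock s₁) (State.stock s') i (≤-<-trans i≤ r<γ) e e' agr))))) })

-- The number of nodes of a regular tree

lookup-injective : ∀ {A : Set} {xs : List A} → Unique xs → ∀ i j → lookupL xs i ≡ lookupL xs j → i ≡ j
lookup-injective (_ ∷ u)  zero    zero    e = refl
lookup-injective {xs = x ∷ xs} (x∉ ∷ u) zero (suc j) e = ⊥-elim (All-∈ x∉ (∈-lookup {xs = xs} j) e)
lookup-injective {xs = x ∷ xs} (x∉ ∷ u) (suc i) zero e = ⊥-elim (All-∈ x∉ (∈-lookup {xs = xs} i) (sym e))
lookup-injective (_ ∷ u)  (suc i) (suc j) e = cong suc (lookup-injective u i j e)

module _ {δ n : ℕ} (t : RTree δ n) where

  private
    Internal : Fin n → Set
    Internal v = Σ (Fin δ → Fin n) λ f → ChildEnum δ (parent t) v f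

    internal? : 1 ≤ δ → ∀ v → Dec (Internal v)
    internal? (s≤s _) v with arity t v
    ... | inj₁ leaf = no (λ { (f , _ , par , _) → leaf _ (par zero) })
    ... | inj₂ i    = yes i

  -- Every node except the root is a child of exactly one internal node. The lower bound has to hold
  -- for each `n` that admits a tree, so the hard tree is padded to exactly this size.
  node-count : 1 ≤ δ → ∃ λ m → n ≡ suc (m * δ)
  node-count δ≥1 = m , ≤-antisym (injective⇒≤ {f = from} from-inj) (injective⇒≤ {f = to} to-inj)
    where
    I : List (Fin n)
    I = filter (internal? δ≥1) (allFin n)
    m : ℕ
    m = length I
    uniq : Unique I
    uniq = unique-filter (internal? δ≥1) (unique-allFin n)
    inner : ∀ i → Internal (lookupL I i)
    inner i = proj₂ (∈-filter⁻ (internal? δ≥1) {xs = allFin n} (∈-lookup {xs = I} i))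
    child : Fin m × Fin δ → Fin n
    child (i , k) = proj₁ (inner i) k
    child-par : ∀ ik → parent t (child ik) ≡ just (lookupL I (proj₁ ik))
    child-par (i , k) = proj₁ (proj₂ (proj₂ (inner i))) k
    child-inj : ∀ ik jl → child ik ≡ child jl → ik ≡ jl
    child-inj (i , k) (j , l) e with lookup-injective uniq i j (just-unique (child-par (i , k)) (trans (cong (parent t) e) (child-par (j , l))))
    ... | refl = cong (i ,_) (proj₁ (proj₂ (inner i)) e)
    to : Fin (suc (m * δ)) → Fin n
    to zero    = root t
    to (suc q) = child (remQuot δ q)
    to-inj : Injective _≡_ _≡_ to
    to-inj {zero}  {zero}  e = refl
    to-inj {zero}  {suc q} e = ⊥-elim (just≢nothing (trans (cong (parent t) e) (child-par (remQuot δ q))) (root-nil t))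
    to-inj {suc q} {zero}  e = ⊥-elim (just≢nothing (trans (cong (parent t) (sym e)) (child-par (remQuot δ q))) (root-nil t))
    to-inj {suc q} {suc q'} e with child-inj (remQuot δ q) (remQuot δ q') e
    ... | eq = cong suc (trans (sym (combine-remQuot {m} δ q)) (trans (cong (λ { (i , k) → combine i k }) eq) (combine-remQuot {m} δ q')))
    find : ∀ v {p} → parent t v ≡ just p → ∃ λ ik → child ik ≡ v
    find v {p} e with arity t p
    ... | inj₁ leaf = ⊥-elim (leaf v e)
    ... | inj₂ int  = (i , proj₁ has) , proj₂ has
      where
      p∈ : p ∈ I
      p∈ = ∈-filter⁺ (internal? δ≥1) (∈-allFin p) int
      i : Fin m
      i = index p∈
      has : ∃ λ k → proj₁ (inner i) k ≡ v
      has = proj₂ (proj₂ (proj₂ (inner i))) v (trans e (cong just (lookup-index p∈)))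
    from-by : ∀ v (mp : Maybe (Fin n)) → parent t v ≡ mp → Fin (suc (m * δ))
    from-by v nothing  e = zero
    from-by v (just p) e = let (i , k) , _ = find v e in suc (combine i k)
    from : Fin n → Fin (suc (m * δ))
    from v = from-by v (parent t v) refl
    to-from-by : ∀ v mp e → to (from-by v mp e) ≡ v
    to-from-by v nothing  e = sym (root-uniq t v e)
    to-from-by v (just p) e = let (i , k) , c = find v e in trans (cong child (remQuot-combine i k)) c
    from-inj : Injective _≡_ _≡_ from
    from-inj {u} {v} e = trans (sym (to-from-by u (parent t u) refl)) (trans (cong to e) (to-from-by v (parent t v) refl))

-- Trees from shapes: an internal node has one heir and δ' further children of equal shape.

module Shapes (δ' : ℕ) where

  data Shape : Set where
    leaf : Shape
    node : (heir other : Shape) → Shape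

  inner size : Shape → ℕ
  inner leaf       = 0
  inner (node h o) = suc (inner h + δ' * inner o)
  size leaf       = 1
  size (node h o) = suc (size h + δ' * size o)

  size-inner : ∀ s → size s ≡ suc (inner s * suc δ')
  size-inner leaf = refl
  size-inner (node h o) rewrite size-inner h | size-inner o = eq (inner h) (inner o) δ'
    where
    eq : ∀ a b d → 1 + ((1 + a * (1 + d)) + d * (1 + b * (1 + d))) ≡ 1 + (1 + (a + d * b)) * (1 + d)
    eq = solve-∀

  data Pos : Shape → Set where
    top : ∀ {s} → Pos s
    inH : ∀ {h o} → Pos h → Pos (node h o)
    inO : ∀ {h o} → Fin δ' → Pos o → Pos (node h o)

  enc : ∀ {s} → Pos s → Fin (size s)
  enc {leaf}     top       = zero
  enc {node h o} top       = zero
  enc {node h o} (inH p)   = suc (enc p ↑ˡ (δ' * size o))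
  enc {node h o} (inO i p) = suc (size h ↑ʳ combine i (enc p))

  dec : ∀ s → Fin (size s) → Pos s
  dec-by : ∀ h o → Fin (size h) ⊎ Fin (δ' * size o) → Pos (node h o)
  dec leaf       _       = top
  dec (node h o) zero    = top
  dec (node h o) (suc i) = dec-by h o (splitAt (size h) i)
  dec-by h o (inj₁ j) = inH (dec h j)
  dec-by h o (inj₂ j) = let i , q = remQuot (size o) j in inO i (dec o q)

  dec-enc : ∀ {s} (p : Pos s) → dec s (enc p) ≡ p
  dec-enc {leaf}     top       = refl
  dec-enc {node h o} top       = refl
  dec-enc {node h o} (inH p)   = trans (cong (dec-by h o) (splitAt-↑ˡ (size h) (enc p) (δ' * size o))) (cong inH (dec-enc p))
  dec-enc {node h o} (inO i p) = trans (cong (dec-by h o) (splitAt-↑ʳ (size h) (δ' * size o) (combine i (enc p))))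
    (trans (cong (λ { (j , q) → inO j (dec o q) }) (remQuot-combine i (enc p))) (cong (inO i) (dec-enc p)))

  enc-dec : ∀ s (i : Fin (size s)) → enc (dec s i) ≡ i
  enc-dec-by : ∀ h o (x : Fin (size h) ⊎ Fin (δ' * size o)) → enc (dec-by h o x) ≡ suc (join (size h) (δ' * size o) x)
  enc-dec leaf       zero    = refl
  enc-dec (node h o) zero    = refl
  enc-dec (node h o) (suc i) = trans (enc-dec-by h o (splitAt (size h) i)) (cong suc (join-splitAt (size h) (δ' * size o) i))
  enc-dec-by h o (inj₁ j) = cong (λ x → suc (x ↑ˡ (δ' * size o))) (enc-dec h j)
  enc-dec-by h o (inj₂ j) = cong (λ x → suc (size h ↑ʳ x))
    (trans (cong (combine (proj₁ (remQuot {δ'} (size o) j))) (enc-dec o (proj₂ (remQuot {δ'} (size o) j)))) (combine-remQuot {δ'} (size o) j))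

  par : ∀ {s} → Pos s → Maybe (Pos s)
  par top       = nothing
  par (inH p)   = just (maybe inH top (par p))
  par (inO i p) = just (maybe (inO i) top (par p))

  level : ∀ {s} → Pos s → ℕ
  level top       = 0
  level (inH p)   = suc (level p)
  level (inO _ p) = suc (level p)

  par-nothing : ∀ {s} (p : Pos s) → par p ≡ nothing → p ≡ top
  par-nothing top e = refl

  level-par : ∀ {s} (p q : Pos s) → par p ≡ just q → level p ≡ suc (level q)
  level-par (inH p) q e with par p in pp
  level-par (inH p) q refl | nothing with par-nothing p pp
  ... | refl = refl
  level-par (inH p) q refl | just p' = cong suc (level-par p p' pp)
  level-par (inO i p) q e with par p in pp
  level-par (inO i p) q refl | nothing with par-nothing p pp
  ... | refl = refl
  level-par (inO i p) q refl | just p' = cong suc (level-par p p' pp)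

  sub : ∀ {s} → Pos s → Shape
  sub {s} top   = s
  sub (inH p)   = sub p
  sub (inO _ p) = sub p

  kid : ∀ {s h o} (p : Pos s) → sub p ≡ node h o → Fin (suc δ') → Pos s
  kid top       refl zero    = inH top
  kid top       refl (suc i) = inO i top
  kid (inH p)   e k = inH (kid p e k)
  kid (inO i p) e k = inO i (kid p e k)

  par-kid : ∀ {s h o} (p : Pos s) (e : sub p ≡ node h o) k → par (kid p e k) ≡ just p
  par-kid top       refl zero    = refl
  par-kid top       refl (suc i) = refl
  par-kid (inH p)   e k rewrite par-kid p e k = refl
  par-kid (inO i p) e k rewrite par-kid p e k = refl

  inH-inj : ∀ {h o} {p q : Pos h} → inH {h} {o} p ≡ inH q → p ≡ q
  inH-inj refl = refl

  inO-inj : ∀ {h o} {i j : Fin δ'} {p q : Pos o} → inO {h} {o} i p ≡ inO j q → i ≡ j × p ≡ q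
  inO-inj refl = refl , refl

  kid-inj : ∀ {s h o} (p : Pos s) (e : sub p ≡ node h o) k l → kid p e k ≡ kid p e l → k ≡ l
  kid-inj top       refl zero    zero    q = refl
  kid-inj top       refl (suc i) (suc j) q = cong suc (proj₁ (inO-inj q))
  kid-inj (inH p)   e k l q = kid-inj p e k l (inH-inj q)
  kid-inj (inO i p) e k l q = kid-inj p e k l (proj₂ (inO-inj q))

  sub-kid₀ : ∀ {s h o} (p : Pos s) (e : sub p ≡ node h o) → sub (kid p e zero) ≡ h
  sub-kid₀ top       refl = refl
  sub-kid₀ (inH p)   e    = sub-kid₀ p e
  sub-kid₀ (inO i p) e    = sub-kid₀ p e

  sub-kid₁ : ∀ {s h o} (p : Pos s) (e : sub p ≡ node h o) i → sub (kid p e (suc i)) ≡ o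
  sub-kid₁ top       refl j = refl
  sub-kid₁ (inH p)   e    j = sub-kid₁ p e j
  sub-kid₁ (inO i p) e    j = sub-kid₁ p e j

  has-kid : ∀ {s} (q p : Pos s) → par q ≡ just p → ∃ λ h → ∃ λ o → Σ (sub p ≡ node h o) λ e → ∃ λ k → kid p e k ≡ q
  has-kid (inH q) p e with par q in pq
  has-kid {node h o} (inH q) p refl | nothing with par-nothing q pq
  ... | refl = h , o , refl , zero , refl
  has-kid {node h o} (inH q) p refl | just p' =
    let h' , o' , e , k , c = has-kid q p' pq in h' , o' , e , k , cong inH c
  has-kid (inO i q) p e with par q in pq
  has-kid {node h o} (inO i q) p refl | nothing with par-nothing q pq
  ... | refl = h , o , refl , suc i , refl
  has-kid {node h o} (inO i q) p refl | just p' =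
    let h' , o' , e , k , c = has-kid q p' pq in h' , o' , e , k , cong (inO i) c

  module _ (s : Shape) where

    treePar : Fin (size s) → Maybe (Fin (size s))
    treePar v = mapM enc (par (dec s v))

    treePar-enc : ∀ p → treePar (enc p) ≡ mapM enc (par p)
    treePar-enc p = cong (λ q → mapM enc (par q)) (dec-enc p)

    treePar-just : ∀ {v u} → treePar v ≡ just u → par (dec s v) ≡ just (dec s u)
    treePar-just {v} e with par (dec s v)
    treePar-just refl | just q = cong just (sym (dec-enc q))

    shape-enum : ∀ {h o} (p : Pos s) (e : sub p ≡ node h o) → ChildEnum (suc δ') treePar (enc p) (λ k → enc (kid p e k))
    shape-enum p e =
      (λ {k} {l} q → kid-inj p e k l (trans (sym (dec-enc (kid p e k))) (trans (cong (dec s) q) (dec-enc (kid p e l))))) ,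
      (λ k → trans (treePar-enc (kid p e k)) (cong (mapM enc) (par-kid p e k))) ,
      λ w q → kids w (trans (treePar-just q) (cong just (dec-enc p)))
      where
      kids : ∀ w → par (dec s w) ≡ just p → ∃ λ k → enc (kid p e k) ≡ w
      kids w q with has-kid (dec s w) p q
      ... | h' , o' , e' , k , c with trans (sym e) e'
      ...   | refl with uip e e'
        where
        uip : ∀ {A : Set} {x y : A} (p q : x ≡ y) → p ≡ q
        uip refl refl = refl
      ...     | refl = k , trans (cong enc c) (enc-dec s w)

    shapeTree : RTree (suc δ') (size s)
    shapeTree = record
      { parent = treePar ; root = enc (top {s}) ; root-nil = treePar-enc top
      ; root-uniq = λ v e → trans (sym (enc-dec s v)) (cong enc (par-nothing (dec s v) (map-nothing (par (dec s v)) e)))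
      ; reach = λ v → suc (level (dec s v)) , depth-ancestor (deep (level (dec s v)) (dec s v) refl v (enc-dec s v))
      ; arity = ar }
      where
      map-nothing : (m : Maybe (Pos s)) → mapM enc m ≡ nothing → m ≡ nothing
      map-nothing nothing e = refl
      deep : ∀ k (p : Pos s) → level p ≡ k → ∀ v → enc p ≡ v → Depth treePar v k
      deep k p lv v refl with par p in pp
      deep k p lv v refl | nothing with par-nothing p pp
      deep .0 .top refl v refl | nothing | refl = Depth.top (treePar-enc top)
      deep zero p lv v refl | just q = ⊥-elim (1+n≢0 (trans (sym (level-par p q pp)) lv))
      deep (suc k) p lv v refl | just q =
        down (trans (treePar-enc p) (cong (mapM enc) pp)) (deep k q (suc-injective (trans (sym (level-par p q pp)) lv)) (enc q) refl)
      ar : ∀ v → (∀ w → treePar w ≢ just v) ⊎ (Σ (Fin (suc δ') → Fin (size s)) λ f → ChildEnum (suc δ') treePar v f)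
      ar v with sub (dec s v) in e
      ... | leaf = inj₁ (λ w q → let _ , _ , e' , _ = has-kid (dec s w) (dec s v) (treePar-just q) in no-leaf (trans (sym e) e'))
        where
        no-leaf : ∀ {h o} → leaf ≢ node h o
        no-leaf ()
      ... | node h o = inj₂ (_ , subst (λ u → ChildEnum (suc δ') treePar u (λ k → enc (kid (dec s v) e k))) (enc-dec s v) (shape-enum (dec s v) e))

  -- A caterpillar, the simplest shape with a prescribed number of inner nodes. It serves as padding
  -- and provides a tree of every admissible size.
  comb : ℕ → Shape
  comb zero    = leaf
  comb (suc m) = node (comb m) leaf

  inner-comb : ∀ m → inner (comb m) ≡ m
  inner-comb zero    = refl
  inner-comb (suc m) = cong suc (trans (cong (inner (comb m) +_) (*-zeroʳ δ')) (trans (+-identityʳ _) (inner-comb m)))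

-- The initial tree

module Initial (δ'' D : ℕ) where
  δ' : ℕ
  δ' = suc δ''
  open Shapes δ'

  chainS : ℕ → Shape → Shape
  chainS zero    o = o
  chainS (suc l) o = node (chainS l o) o

  richS : ℕ → Shape
  richS zero    = leaf
  richS (suc j) = chainS D (richS j)

  spineS : (plot pad : Shape) → ℕ → Shape
  spineS plot pad zero    = pad
  spineS plot pad (suc F) = node (spineS plot pad F) plot

  module _ (s : Shape) where
    open Richness {suc δ'} {size s} D

    private
      t : RTree (suc δ') (size s)
      t = shapeTree s

    chain-head : ∀ {j l v} → Chain t (Rich t j) l v → Rich t j v
    chain-head (stop p)        = p
    chain-head (step ce a k c) = rich-parent _ ce k a

    shape-rich  : ∀ j (p : Pos s) → sub p ≡ richS j → Rich t j (enc p)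
    shape-chain : ∀ j l (p : Pos s) → sub p ≡ chainS l (richS j) → Chain t (Rich t j) l (enc p)
    shape-rich zero    p e = tt
    shape-rich (suc j) p e = shape-chain j D p e
    shape-chain j zero    p e = stop (shape-rich j p e)
    shape-chain j (suc l) p e = step (shape-enum s p e) all zero heir
      where
      heir : Chain t (Rich t j) l (enc (kid p e zero))
      heir = shape-chain j l (kid p e zero) (sub-kid₀ p e)
      all : ∀ k → Rich t j (enc (kid p e k))
      all zero    = chain-head heir
      all (suc i) = shape-rich j (kid p e (suc i)) (sub-kid₁ p e i)

    chain-end : ∀ {j l i v w} → Chain t (Rich t j) l v → Up t j i v w → ∃ λ y → Rich t j y × Up t j (l + i) y w
    chain-end (stop p) u = _ , p , u
    chain-end {j} {suc l} {i} {v} {w} (step ce@(_ , par , _) a k c) u =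
      let y , r , u' = chain-end c (cons (par k) ce a u) in y , r , subst (λ m → Up t j m y w) (+-suc l i) u'

  module _ (plot pad : Shape) where

    -- Of the `δ'` copies of `plot` at a spine node only the first is owned, while the spine and the
    -- padding belong to no plot. So different plots are disjoint subtrees.
    ownS : ∀ F → Pos (spineS plot pad F) → Maybe ℕ
    ownS zero    _               = nothing
    ownS (suc F) top             = nothing
    ownS (suc F) (inH p)         = ownS F p
    ownS (suc F) (inO zero _)    = just F
    ownS (suc F) (inO (suc _) _) = nothing

    ownS-closed : ∀ F (u p : Pos (spineS plot pad F)) {π} → par u ≡ just p → ownS F p ≡ just π → ownS F u ≡ just π
    ownS-closed (suc F) (inH u) p e o with par u in pu
    ownS-closed (suc F) (inH u) p refl o | just q = ownS-closed F u q pu o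
    ownS-closed (suc F) (inO zero u) p e o with par u
    ownS-closed (suc F) (inO zero u) p refl o | just q = o
    ownS-closed (suc F) (inO (suc i) u) p e o with par u
    ownS-closed (suc F) (inO (suc i) u) p refl () | just q
    ownS-closed (suc F) (inO (suc i) u) p refl () | nothing

    plotPos : ∀ F {π} → π < F → ∃ λ (p : Pos (spineS plot pad F)) → sub p ≡ plot × ownS F p ≡ just π
    plotPos (suc F) {π} (s≤s le) with π ≟ℕ F
    ... | yes refl = inO zero top , refl , refl
    ... | no ne    = let p , e , o = plotPos F (≤∧≢⇒< le ne) in inH p , e , o

    inner-spine : ∀ F → inner (spineS plot pad F) ≡ F * suc (δ' * inner plot) + inner pad
    inner-spine zero    = refl
    inner-spine (suc F) rewrite inner-spine F = eq (F * suc (δ' * inner plot)) (inner pad) (δ' * inner plot)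
      where
      eq : ∀ a b c → 1 + (a + b + c) ≡ 1 + (c + a) + b
      eq = solve-∀

  inner-chain : ∀ l o → suc (inner (chainS l o)) ≤ suc (inner o) * suc (l * suc δ')
  inner-chain l o = ≤-trans (≤-reflexive (cong suc (exact l))) (≤-trans (m≤m+n _ (l * (δ' + inner o)))
    (≤-reflexive (eq l (inner o) δ')))
    where
    exact : ∀ l → inner (chainS l o) ≡ l * suc (δ' * inner o) + inner o
    exact zero    = refl
    exact (suc l) rewrite exact l = eq' (l * suc (δ' * inner o)) (inner o) (δ' * inner o)
      where
      eq' : ∀ a b c → 1 + (a + b + c) ≡ 1 + (c + a) + b
      eq' = solve-∀
    eq : ∀ l e d → 1 + (l * (1 + d * e) + e) + l * (d + e) ≡ (1 + e) * (1 + l * (1 + d))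
    eq = solve-∀

  inner-rich : ∀ j → suc (inner (richS j)) ≤ suc (D * suc δ') ^ j
  inner-rich zero    = ≤-refl
  inner-rich (suc j) = ≤-trans (inner-chain D (richS j))
    (≤-trans (*-monoˡ-≤ (suc (D * suc δ')) (inner-rich j)) (≤-reflexive (*-comm (suc (D * suc δ') ^ j) _)))

-- The state before the first round

problem : ∀ δ → 1 ≤ δ → ∀ γ → List (Fin γ × Vec (Fin γ) δ) → LCL
problem δ δ≥1 γ C = record { δ = δ ; δ≥1 = δ≥1 ; γ = γ ; C = C }

module InitialState (δ'' γ : ℕ) (δ≥1 : 1 ≤ suc (suc δ'')) (C : List (Fin γ × Vec (Fin γ) (suc (suc δ''))))
  (R : Labels.Ranking (problem (suc (suc δ'')) δ≥1 γ C)) (D F : ℕ) (pad : Shapes.Shape (suc δ'')) where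
  open Initial δ'' D
  open Shapes δ'

  private
    Π : LCL
    Π = problem (suc (suc δ'')) δ≥1 γ C

  plot full : Shape
  -- One layer more than there are ranks: the outermost path becomes the `D` generations above the
  -- site, and its lower end is still `γ`-rich.
  plot = richS (suc γ)
  full = spineS plot pad F

  module _ {T : ℕ} (P : Player Π (size full) T) where
    open Game Π R P D
    open Richness {suc δ'} {size full} D

    private
      t : RTree (suc δ') (size full)
      t = shapeTree full

      own : Fin (size full) → Maybe ℕ
      own v = ownS plot pad F (dec full v)

      siteOf : ∀ {π} → π < F → ∃ λ w → Site t own π γ w
      siteOf {π} lt =
        let p , e , o = plotPos plot pad F lt
            y , r , u = chain-end full (shape-chain full γ D p e) nil
        in y , site r (subst (λ l → Up t γ l y (enc p)) (+-identityʳ D) u) (trans (cong (ownS plot pad F) (dec-enc p)) o)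

      act : ℕ → Maybe (Fin (size full) × ℕ)
      act π with π <? F
      ... | yes lt = just (proj₁ (siteOf lt) , γ)
      ... | no _   = nothing

    initial : State 0 F
    initial = record
      { t = t ; vs = [] ; uniq = [] ; own = own
      ; closed = λ {u} {p} e o → ownS-closed plot pad F (dec full u) (dec full p) (treePar-just full e) o
      ; act = act ; sites = sites ; home = λ () ; fresh = fresh ; stock = λ _ → nothing ; stocked = λ () }
      where
      sites : ∀ {π w j} → act π ≡ just (w , j) → Site t own π j w
      sites {π} e with π <? F
      ... | yes lt with just-injective e
      ...   | refl = proj₂ (siteOf lt)
      fresh : ∀ {π} → π < F → ∃ λ w → act π ≡ just (w , γ)
      fresh {π} lt with π <? F
      ... | yes lt' = proj₁ (siteOf lt') , refl
      ... | no nlt  = ⊥-elim (nlt lt)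

    defeat : F ≡ 2 ^ γ → radius T (F * γ) + T + 3 ≤ D → ⊥
    defeat refl room = run (F * γ) room F initial ≤-refl (m≤n+m F (value γ (State.stock initial)))

-- The lower bound for branching trees

growth : ℕ → ℕ
growth zero    = 0
growth (suc h) = 5 * growth h + 8

radius-growth : ∀ T h → radius T h ≤ growth h * suc T
radius-growth T zero    = z≤n
radius-growth T (suc h) = ≤-trans (+-monoˡ-≤ 8 (+-monoˡ-≤ (4 * T) (*-monoʳ-≤ 5 (radius-growth T h))))
  (≤-trans (m≤m+n _ (4 * T)) (≤-reflexive (eq (growth h) T)))
  where
  eq : ∀ g T → 5 * (g * (1 + T)) + 4 * T + 8 + 4 * T ≡ (5 * g + 8) * (1 + T)
  eq = solve-∀

-- `q` and `K₀` come before the ranking, which becomes available only inside the final negation.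
record Bound (Π : LCL) : Set₁ where
  field
    q K₀     : ℕ
    q≥1      : 1 ≤ q
    K₀≥1     : 1 ≤ K₀
    no-player : ∀ {n T} → Labels.Ranking Π → RTree (LCL.δ Π) n → K₀ * suc T ^ q ≤ n → Player Π n T → ⊥

*-^ : ∀ a b q → (a * b) ^ q ≡ a ^ q * b ^ q
*-^ a b zero    = refl
*-^ a b (suc q) rewrite *-^ a b q = eq a b (a ^ q) (b ^ q)
  where
  eq : ∀ a b c d → a * b * (c * d) ≡ a * c * (b * d)
  eq = solve-∀

bound-branching : ∀ δ'' γ (δ≥1 : 1 ≤ suc (suc δ'')) C → Bound (problem (suc (suc δ'')) δ≥1 γ C)
bound-branching δ'' γ δ≥1 C = record
  -- A plot has fewer than `(1 + D δ) ^ (γ + 1)` inner nodes, and `c` is chosen such that `1 + D δ`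
  -- is at most `c (T + 1)`. The remaining factors count the plots and convert inner nodes into
  -- nodes.
  { q = suc γ ; K₀ = suc (δ * (F * δ) * c ^ suc γ) ; q≥1 = s≤s z≤n ; K₀≥1 = s≤s z≤n ; no-player = no-player }
  where
  δ F c₁ c : ℕ
  δ  = suc (suc δ'')
  F  = 2 ^ γ
  c₁ = growth (F * γ) + 3
  c  = suc (c₁ * δ)
  Π : LCL
  Π = problem δ δ≥1 γ C
  no-player : ∀ {n T} → Labels.Ranking Π → RTree δ n → suc (δ * (F * δ) * c ^ suc γ) * suc T ^ suc γ ≤ n → Player Π n T → ⊥
  no-player {n} {T} R t₀ big P with node-count t₀ δ≥1
  ... | m , n≡ = defeat (subst (λ k → Player Π k T) (sym size≡) P) refl room
    where
    D : ℕ
    D = c₁ * suc T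
    open Initial δ'' D using (richS; inner-spine; inner-rich)
    open Shapes (suc δ'') using (Shape; inner; size; comb; inner-comb; size-inner)
    E used : ℕ
    E    = inner (richS (suc γ))
    used = F * suc (suc δ'' * E)
    pad : Shape
    pad = comb (m ∸ used)
    open InitialState δ'' γ δ≥1 C R D F pad using (full; defeat)
    room : radius T (F * γ) + T + 3 ≤ D
    room = ≤-trans (+-monoˡ-≤ 3 (+-monoˡ-≤ T (radius-growth T (F * γ))))
      (≤-trans (m≤m+n _ (2 * T)) (≤-reflexive (eq (growth (F * γ)) T)))
      where
      eq : ∀ g T → g * (1 + T) + T + 3 + 2 * T ≡ (g + 3) * (1 + T)
      eq = solve-∀
    sucE : suc E ≤ c ^ suc γ * suc T ^ suc γ
    sucE = ≤-trans (inner-rich (suc γ)) (≤-trans (^-monoˡ-≤ (suc γ) le) (≤-reflexive (*-^ c (suc T) (suc γ))))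
      where
      le : suc (D * δ) ≤ c * suc T
      le = ≤-trans (m≤m+n _ T) (≤-reflexive (eq c₁ T δ))
        where
        eq : ∀ a T d → 1 + a * (1 + T) * d + T ≡ (1 + a * d) * (1 + T)
        eq = solve-∀
    used-small : used * δ < suc (δ * (F * δ) * c ^ suc γ) * suc T ^ suc γ
    used-small = ≤-trans (s≤s (≤-trans (*-monoˡ-≤ δ (*-monoʳ-≤ F (≤-trans (one-more (suc δ'') E) (*-monoʳ-≤ δ sucE))))
        (≤-reflexive (eq F δ (c ^ suc γ) (suc T ^ suc γ)))))
      (+-monoˡ-≤ _ (m^n>0 (suc T) (suc γ)))
      where
      one-more : ∀ d E → suc (d * E) ≤ suc d * suc E
      one-more d E = ≤-trans (m≤m+n _ (d + E)) (≤-reflexive (eq' d E))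
        where
        eq' : ∀ d E → 1 + d * E + (d + E) ≡ (1 + d) * (1 + E)
        eq' = solve-∀
      eq : ∀ F d c T → F * (d * (c * T)) * d ≡ d * (F * d) * c * T
      eq = solve-∀
    used≤m : used ≤ m
    used≤m = ≮⇒≥ λ lt → <⇒≱ (<-≤-trans used-small big)
      (≤-trans (≤-reflexive n≡) (≤-trans (+-monoˡ-≤ (m * δ) (s≤s z≤n)) (*-monoˡ-≤ δ lt)))
    size≡ : size full ≡ n
    size≡ = trans (size-inner full) (trans (cong (λ k → suc (k * δ))
      (trans (inner-spine (richS (suc γ)) pad F) (trans (cong (used +_) (inner-comb (m ∸ used))) (m+[n∸m]≡n used≤m)))) (sym n≡))

-- Paths

module PathLabels (γ : ℕ) (δ≥1 : 1 ≤ 1) (C : List (Fin γ × Vec (Fin γ) 1)) where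
  Π : LCL
  Π = problem 1 δ≥1 γ C
  open Labels Π

  private
    Full : Fin γ → Set
    Full _ = ⊤

  module _ (R : Ranking) where
    open Ranking R

    single : ∀ {r c} (v : Vec (Fin γ) 1) k → lookup v k ≡ c → r ≤ rank c → ∀ i → r ≤ rank (lookup v i)
    single v zero refl le zero = le

    -- With one child per node there are no siblings to check: once the next node of the walk has
    -- rank at least `r`, so has the entire child vector. Hence a walk can leave the high ranks only
    -- at one of its own nodes, where it is cut.
    split-low : ∀ r {m b c} → r ≤ rank c → Walk Full m b c → (Walk (λ q → r ≤ rank q) m b c × r ≤ rank b) ⊎
                (∃ λ q → rank q < r × ∃ λ i → ∃ λ j → Walk Full i b q × Walk Full j q c)
    split-low r le [] = inj₁ ([] , le)
    split-low r {b = b} le (e@(v , i , _ , _ , k , eq) ∷ w) with r ≤? rank b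
    ... | no nle = inj₂ (b , ≰⇒> nle , 0 , _ , [] , e ∷ w)
    ... | yes rb with split-low r le w
    ...   | inj₁ (w' , rc) = inj₁ ((v , i , rb , single v k eq rc , k , eq) ∷ w' , rb)
    ...   | inj₂ (q , lt , i' , j , w₁ , w₂) = inj₂ (q , lt , suc i' , j , e ∷ w₁ , w₂)

    -- On a path a label below the rank of a on a closed walk through a inherits the flexibility of a.
    inflexible : ∀ r a → rank a < r → ¬ Flex Full a
    inflexible (suc r) a (s≤s le) (m , w₀ , w₁) with split-low (rank a) ≤-refl w₀ | split-low (rank a) ≤-refl w₁
    ... | inj₁ (w₀' , _) | inj₁ (w₁' , _) = inflex a (m , w₀' , w₁')
    ... | inj₂ (q , lt , i , j , u , v) | _ = inflexible r q (<-≤-trans lt le)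
          (j + (m + i) , walk-++ v (walk-++ w₀ u) , subst (λ l → Walk Full l q q) (+-suc j (m + i)) (walk-++ v (walk-++ w₁ u)))
    ... | inj₁ _ | inj₂ (q , lt , i , j , u , v) = inflexible r q (<-≤-trans lt le)
          (j + (m + i) , walk-++ v (walk-++ w₀ u) , subst (λ l → Walk Full l q q) (+-suc j (m + i)) (walk-++ v (walk-++ w₁ u)))

  module _ {n' : ℕ} where
    private
      n : ℕ
      n = suc n'

    -- A path is encoded by the positions of its nodes, so moving a node amounts to another
    -- permutation.
    pathPar : Permutation′ n → Fin n → Maybe (Fin n)
    pathPar π v with π ⟨$⟩ʳ v
    ... | zero  = nothing
    ... | suc i = just (π ⟨$⟩ˡ inject₁ i)

    pos : Permutation′ n → Fin n → ℕ
    pos π v = toℕ (π ⟨$⟩ʳ v)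

    pos-inj : ∀ π {u v} → pos π u ≡ pos π v → u ≡ v
    pos-inj π e = order-injective π (toℕ-injective e)

    par→pos : ∀ π {v p} → pathPar π v ≡ just p → pos π v ≡ suc (pos π p)
    par→pos π {v} e with π ⟨$⟩ʳ v
    par→pos π refl | suc i = cong suc (sym (trans (cong toℕ (inverseʳ π)) (toℕ-inject₁ i)))

    pos→par : ∀ π {v p} → pos π v ≡ suc (pos π p) → pathPar π v ≡ just p
    pos→par π {v} {p} e with π ⟨$⟩ʳ v
    ... | suc i = cong just (pos-inj π (trans (cong toℕ (inverseʳ π)) (trans (toℕ-inject₁ i) (suc-injective e))))

    pathTree : Permutation′ n → RTree 1 n
    pathTree π = record
      { parent = pathPar π ; root = π ⟨$⟩ˡ zero
      ; root-nil = nil (π ⟨$⟩ˡ zero) (cong toℕ (inverseʳ π))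
      ; root-uniq = λ v e → pos-inj π (trans (nil' v e) (sym (cong toℕ (inverseʳ π))))
      ; reach = λ v → suc (pos π v) , depth-ancestor (deep (pos π v) v refl)
      ; arity = ar }
      where
      nil : ∀ v → pos π v ≡ 0 → pathPar π v ≡ nothing
      nil v e with π ⟨$⟩ʳ v
      ... | zero = refl
      nil' : ∀ v → pathPar π v ≡ nothing → pos π v ≡ 0
      nil' v e with π ⟨$⟩ʳ v
      ... | zero = refl
      deep : ∀ k v → pos π v ≡ k → Depth (pathPar π) v k
      deep zero v e = top (nil v e)
      deep (suc k) v e = down (pos→par π (trans e (cong suc (sym at)))) (deep k p at)
        where
        k< : k < n
        k< = <-trans (≤-reflexive (sym e)) (toℕ<n (π ⟨$⟩ʳ v))
        p : Fin n
        p = π ⟨$⟩ˡ fromℕ< k<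
        at : pos π p ≡ k
        at = trans (cong toℕ (inverseʳ π)) (toℕ-fromℕ< k<)
      ar : ∀ v → (∀ w → pathPar π w ≢ just v) ⊎ (Σ (Fin 1 → Fin n) λ f → ChildEnum 1 (pathPar π) v f)
      ar v with suc (pos π v) <? n
      ... | no ge = inj₁ (λ w e → ge (subst (_< n) (par→pos π e) (toℕ<n (π ⟨$⟩ʳ w))))
      ... | yes lt = inj₂ ((λ _ → c) , (λ { {zero} {zero} _ → refl }) , (λ _ → pos→par π at) ,
                      λ w e → zero , pos-inj π (trans at (sym (par→pos π e))))
        where
        c : Fin n
        c = π ⟨$⟩ˡ fromℕ< lt
        at : pos π c ≡ suc (pos π v)
        at = trans (cong toℕ (inverseʳ π)) (toℕ-fromℕ< lt)

    path-walk : ∀ π L → Feasible Π (pathTree π) L → ∀ l v w → pos π w ≡ l + pos π v → Walk Full l (L v) (L w)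
    path-walk π L feas zero v w e = subst (λ x → Walk Full 0 (L v) (L x)) (sym (pos-inj π e)) []
    path-walk π L feas (suc l) v w e =
      subst (λ m → Walk Full m (L v) (L w)) (+-comm l 1) (walk-++ (path-walk π L feas l v p at) (edge ∷ []))
      where
      k< : l + pos π v < n
      k< = <-trans (≤-reflexive (sym e)) (toℕ<n (π ⟨$⟩ʳ w))
      p : Fin n
      p = π ⟨$⟩ˡ fromℕ< k<
      at : pos π p ≡ l + pos π v
      at = trans (cong toℕ (inverseʳ π)) (toℕ-fromℕ< k<)
      pw : pathPar π w ≡ just p
      pw = pos→par π (trans e (cong suc (sym at)))
      edge : Edge Full (L p) (L w)
      edge with feas p (λ _ → w) ((λ { {zero} {zero} _ → refl }) , (λ _ → pw) , λ u e' → zero , pos-inj π (trans (par→pos π pw) (sym (par→pos π e'))))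
      ... | g , (_ , _ , gall) , c = _ , c , tt , (λ _ → tt) , let k , eq = gall w pw in k , trans (lookup∘tabulate (λ i → L (g i)) k) (cong L eq)

    dist-pos : ∀ π {k u v} → Dist≤ (pathTree π) k u v → pos π v ≤ k + pos π u
    dist-pos π {k} stay = m≤n+m _ k
    dist-pos π {suc k} {u} (move (inj₁ e) d) = ≤-trans (dist-pos π d)
      (≤-trans (+-monoʳ-≤ k (≤-trans (n≤1+n _) (≤-reflexive (sym (par→pos π e))))) (n≤1+n _))
    dist-pos π {suc k} {u} (move (inj₂ e) d) = ≤-trans (dist-pos π d)
      (≤-reflexive (trans (cong (k +_) (par→pos π e)) (+-suc k _)))

    agree-pos : ∀ π π' u → (∀ w → pos π u ≡ suc (pos π w) → pos π' u ≡ suc (pos π' w)) →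
      (∀ w → pos π' u ≡ suc (pos π' w) → pos π u ≡ suc (pos π w)) →
      (∀ w → pos π w ≡ suc (pos π u) → pos π' w ≡ suc (pos π' u)) →
      (∀ w → pos π' w ≡ suc (pos π' u) → pos π w ≡ suc (pos π u)) → Agree (pathTree π) (pathTree π') u
    agree-pos π π' u a b c d = agree (ext (pathPar π u) (pathPar π' u)
        (λ w e → pos→par π' (a w (par→pos π e))) (λ w e → pos→par π (b w (par→pos π' e))))
      (λ w e → pos→par π' (c w (par→pos π e))) (λ w e → pos→par π (d w (par→pos π' e)))
      where
      ext : (m m' : Maybe (Fin n)) → (∀ w → m ≡ just w → m' ≡ just w) → (∀ w → m' ≡ just w → m ≡ just w) → m ≡ m'
      ext (just x) m' f g = sym (f x refl)
      ext nothing (just x) f g = g x refl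
      ext nothing nothing f g = refl

    -- The last node of the path is moved right after position q.
    module Shift (q : ℕ) (q<last : q < n') where

      f g : ℕ → ℕ
      f v with v ≤? q
      ... | yes _ = v
      ... | no _ with v <? n'
      ...   | yes _ = suc v
      ...   | no _  = suc q
      g p with p ≤? q
      ... | yes _ = p
      ... | no _ with p ≟ℕ suc q
      ...   | yes _ = n'
      ...   | no _  = pred p

      f-low : ∀ {v} → v ≤ q → f v ≡ v
      f-low {v} le with v ≤? q
      ... | yes _ = refl
      ... | no nle = ⊥-elim (nle le)

      f-mid : ∀ {v} → q < v → v < n' → f v ≡ suc v
      f-mid {v} lt lt' with v ≤? q
      ... | yes le = ⊥-elim (<⇒≱ lt le)
      ... | no _ with v <? n'
      ...   | yes _ = refl
      ...   | no nlt = ⊥-elim (nlt lt')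

      f-last : f n' ≡ suc q
      f-last with n' ≤? q
      ... | yes le = ⊥-elim (<⇒≱ q<last le)
      ... | no _ with n' <? n'
      ...   | yes lt = ⊥-elim (<-irrefl refl lt)
      ...   | no _  = refl

      g-low : ∀ {v} → v ≤ q → g v ≡ v
      g-low {v} le with v ≤? q
      ... | yes _ = refl
      ... | no nle = ⊥-elim (nle le)

      g-hit : g (suc q) ≡ n'
      g-hit with suc q ≤? q
      ... | yes le = ⊥-elim (<-irrefl refl le)
      ... | no _ with suc q ≟ℕ suc q
      ...   | yes _ = refl
      ...   | no ne = ⊥-elim (ne refl)

      g-high : ∀ {p} → q < p → g (suc p) ≡ p
      g-high {p} lt with suc p ≤? q
      ... | yes le = ⊥-elim (<⇒≱ (<-trans lt (n<1+n p)) le)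
      ... | no _ with suc p ≟ℕ suc q
      ...   | yes refl = ⊥-elim (<-irrefl refl lt)
      ...   | no _ = refl

      data Zone (v : ℕ) : Set where
        low  : v ≤ q → Zone v
        mid  : q < v → v < n' → Zone v
        last : v ≡ n' → Zone v

      zone : ∀ {v} → v < n → Zone v
      zone {v} (s≤s le) with v ≤? q
      ... | yes l = low l
      ... | no nl with v ≟ℕ n'
      ...   | yes e = last e
      ...   | no ne = mid (≰⇒> nl) (≤∧≢⇒< le ne)

      f< : ∀ {v} → v < n → f v < n
      f< v< with zone v<
      ... | low l    = subst (_< n) (sym (f-low l)) v<
      ... | mid a b  = subst (_< n) (sym (f-mid a b)) (s≤s b)
      ... | last refl = subst (_< n) (sym f-last) (s≤s q<last)

      g< : ∀ {p} → p < n → g p < n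
      g< {p} p< with p ≤? q
      ... | yes _ = p<
      ... | no nl with p ≟ℕ suc q
      ...   | yes _ = ≤-refl
      ...   | no _ with p
      ...     | suc p' = <-trans (n<1+n p') p<
      ...     | zero   = p<

      gf : ∀ {v} → v < n → g (f v) ≡ v
      gf v< with zone v<
      ... | low l     = trans (cong g (f-low l)) (g-low l)
      ... | mid a b   = trans (cong g (f-mid a b)) (g-high a)
      ... | last refl = trans (cong g f-last) g-hit

      fg : ∀ {p} → p < n → f (g p) ≡ p
      fg {p} p< with p ≤? q
      ... | yes l = f-low l
      ... | no nl with p ≟ℕ suc q
      ...   | yes refl = f-last
      ...   | no ne with p | ≰⇒> nl
      ...     | suc p' | s≤s q≤ = f-mid (≤∧≢⇒< q≤ (λ { refl → ne refl })) (≤-pred p<)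

      shift : Permutation′ n
      shift = permutation (λ v → fromℕ< (f< (toℕ<n v))) (λ p → fromℕ< (g< (toℕ<n p)))
        (λ p → toℕ-injective (trans (toℕ-fromℕ< _) (trans (cong f (toℕ-fromℕ< (g< (toℕ<n p)))) (fg (toℕ<n p)))))
        (λ v → toℕ-injective (trans (toℕ-fromℕ< _) (trans (cong g (toℕ-fromℕ< (f< (toℕ<n v)))) (gf (toℕ<n v)))))

      pos-shift : ∀ v → pos shift v ≡ f (toℕ v)
      pos-shift v = toℕ-fromℕ< (f< (toℕ<n v))

      succ-low : ∀ {u w} → u < q → w < n → (u ≡ suc w → f u ≡ suc (f w)) × (f u ≡ suc (f w) → u ≡ suc w) ×
                 (w ≡ suc u → f w ≡ suc (f u)) × (f w ≡ suc (f u) → w ≡ suc u)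
      succ-low {u} {w} u<q w< with zone w< | f-low (<⇒≤ u<q)
      ... | low l | fu rewrite fu | f-low l = (λ e → e) , (λ e → e) , (λ e → e) , (λ e → e)
      ... | mid a b | fu rewrite fu | f-mid a b =
          (λ { refl → ⊥-elim (<⇒≱ (<-trans u<q a) (n≤1+n _)) }) ,
          (λ { refl → ⊥-elim (<⇒≱ (<-trans u<q a) (≤-trans (n≤1+n _) (n≤1+n _))) }) ,
          (λ { refl → ⊥-elim (<⇒≱ a u<q) }) , (λ e → ⊥-elim (<-irrefl (sym (suc-injective e)) (<-trans u<q a)))
      ... | last refl | fu rewrite fu | f-last =
          (λ { refl → ⊥-elim (<⇒≱ (<-trans u<q q<last) (n≤1+n _)) }) ,
          (λ { refl → ⊥-elim (<⇒≱ u<q (≤-trans (n≤1+n _) (n≤1+n _))) }) ,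
          (λ { e → ⊥-elim (<⇒≱ q<last (subst (_≤ q) (sym e) u<q)) }) ,
          (λ e → ⊥-elim (<-irrefl (sym (suc-injective e)) u<q))

      succ-high : ∀ {u w} → suc q < u → suc u < n' → w < n → (u ≡ suc w → f u ≡ suc (f w)) × (f u ≡ suc (f w) → u ≡ suc w) ×
                 (w ≡ suc u → f w ≡ suc (f u)) × (f w ≡ suc (f u) → w ≡ suc u)
      succ-high {u} {w} q<u u<l w< with zone w< | f-mid (<-trans (n<1+n q) q<u) (<-trans (n<1+n u) u<l)
      ... | low l | fu rewrite fu | f-low l =
          (λ { refl → ⊥-elim (<⇒≱ q<u (s≤s l)) }) , (λ { refl → ⊥-elim (<⇒≱ q<u (≤-trans l (n≤1+n q))) }) ,
          (λ { refl → ⊥-elim (<⇒≱ q<u (≤-trans (≤-trans (n≤1+n u) l) (n≤1+n q))) }) ,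
          (λ { refl → ⊥-elim (<⇒≱ q<u (≤-trans (≤-trans (≤-trans (n≤1+n u) (n≤1+n _)) l) (n≤1+n q))) })
      ... | mid a b | fu rewrite fu | f-mid a b = cong suc , suc-injective , cong suc , suc-injective
      ... | last refl | fu rewrite fu | f-last =
          (λ { refl → ⊥-elim (<⇒≱ u<l (≤-trans (n≤1+n _) (n≤1+n _))) }) ,
          (λ e → ⊥-elim (<-irrefl (sym (suc-injective e)) q<u)) ,
          (λ { refl → ⊥-elim (<-irrefl refl u<l) }) ,
          (λ e → ⊥-elim (<-irrefl (suc-injective e) (≤-trans (n≤1+n _) (≤-trans q<u (n≤1+n _)))))

      Off : ℕ → Set
      Off u = u < q ⊎ (suc q < u × suc u < n')

      shift-agree : ∀ u → Off (toℕ u) → Agree (pathTree idₚ) (pathTree shift) u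
      shift-agree u off = agree-pos idₚ shift u
        (λ w e → conv u w (proj₁ (both w) e)) (λ w e → proj₁ (proj₂ (both w)) (conv' u w e))
        (λ w e → conv w u (proj₁ (proj₂ (proj₂ (both w))) e)) (λ w e → proj₂ (proj₂ (proj₂ (both w))) (conv' w u e))
        where
        both : ∀ w → (toℕ u ≡ suc (toℕ w) → f (toℕ u) ≡ suc (f (toℕ w))) × (f (toℕ u) ≡ suc (f (toℕ w)) → toℕ u ≡ suc (toℕ w)) ×
                     (toℕ w ≡ suc (toℕ u) → f (toℕ w) ≡ suc (f (toℕ u))) × (f (toℕ w) ≡ suc (f (toℕ u)) → toℕ w ≡ suc (toℕ u))
        both w = [ (λ l → succ-low l (toℕ<n w)) , (λ { (a , b) → succ-high a b (toℕ<n w) }) ]′ off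
        conv : ∀ x y → f (toℕ x) ≡ suc (f (toℕ y)) → pos shift x ≡ suc (pos shift y)
        conv x y e = trans (pos-shift x) (trans e (cong suc (sym (pos-shift y))))
        conv' : ∀ x y → pos shift x ≡ suc (pos shift y) → f (toℕ x) ≡ suc (f (toℕ y))
        conv' x y e = trans (sym (pos-shift x)) (trans e (cong suc (pos-shift y)))

  module _ (R : Ranking) {n' T : ℕ} (P : Player Π (suc n') T) (big : suc (suc γ) * (2 * T + 5) ≤ n') where
    open Player P

    private
      W : ℕ
      -- With `q` placed `T + 1` after one observed node, the altered positions `q` and `q + 1` are
      -- out of sight from both sides. The last multiple of `W` keeps the end of the path, from
      -- which the node is taken, out of sight too.
      W = 2 * T + 5

      at : Fin (suc γ) → ℕ
      at j = suc (toℕ j) * W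

      at-room : ∀ j → at j + W ≤ n'
      at-room j = ≤-trans (≤-reflexive (+-comm (at j) W)) (≤-trans (*-monoˡ-≤ W (s≤s (toℕ<n j))) big)

      at-lt : ∀ j → at j < n'
      at-lt j = ≤-trans (≤-reflexive (+-comm 1 (at j))) (≤-trans (+-monoʳ-≤ (at j) (≤-trans (s≤s z≤n) (m≤n+m 5 (2 * T)))) (at-room j))

      at< : ∀ j → at j < suc n'
      at< j = s≤s (≤-trans (m≤m+n (at j) W) (at-room j))

      v : Fin (suc γ) → Fin (suc n')
      v j = fromℕ< (at< j)

      pos-v : ∀ j → toℕ (v j) ≡ at j
      pos-v j = toℕ-fromℕ< (at< j)

      at-inj : ∀ {i j} → at i ≡ at j → i ≡ j
      at-inj {i} {j} e = toℕ-injective (suc-injective (*-cancelʳ-≡ _ _ W {{>-nonZero (≤-trans (s≤s z≤n) (m≤n+m 5 (2 * T)))}} e))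

      vs : List (Fin (suc n'))
      vs = tabulateL v

      uniq : Unique vs
      uniq = unique-tabulate (λ {i} {j} e → at-inj (trans (sym (pos-v i)) (trans (cong toℕ e) (pos-v j))))

      v∈ : ∀ j → v j ∈ vs
      v∈ j = ∈-tabulate⁺ {f = v} j

      t₀ : RTree 1 (suc n')
      t₀ = pathTree idₚ

    -- Two of `γ + 1` observed nodes have equal labels. A node moved into the gap between them,
    -- unseen by all observed nodes, changes their distance from `l` to `l + 1`, which would make
    -- the label flexible.
    path-defeat : ⊥
    path-defeat with pigeonhole {γ} {suc γ} ≤-refl (λ j → lab t₀ vs (v j))
    ... | i , j , i<j , same = inflexible R (suc (rank a)) a ≤-refl (l , walk₀ , walk₁)
      where
      open Ranking R using (rank)
      a : Fin γ
      a = lab t₀ vs (v i)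
      i<j' : suc (toℕ i) ≤ toℕ j
      i<j' = i<j
      jump : at i + W ≤ at j
      jump = ≤-trans (≤-reflexive (+-comm (at i) W)) (*-monoˡ-≤ W (s≤s i<j'))
      l : ℕ
      l = at j ∸ at i
      l+ : at j ≡ l + at i
      l+ = sym (m∸n+n≡m (≤-trans (m≤m+n (at i) W) jump))
      q : ℕ
      q = at i + suc T
      step≤ : suc (suc q) + suc (suc T) ≤ at i + W
      step≤ = ≤-reflexive (eq (at i) T)
        where
        eq : ∀ x T → 2 + (x + (1 + T)) + (2 + T) ≡ x + (2 * T + 5)
        eq = solve-∀
      q<last : q < n'
      q<last = ≤-trans (≤-trans (n≤1+n (suc q)) (m≤m+n (suc (suc q)) (suc (suc T)))) (≤-trans step≤ (at-room i))
      open Shift q q<last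
      t₁ : RTree 1 (suc n')
      t₁ = pathTree shift
      off : ∀ k u → Dist≤ t₀ T (v k) u → Off (toℕ u)
      off k u d with toℕ k ≤? toℕ i
      ... | yes le = inj₁ (≤-<-trans (≤-trans (dist-pos idₚ d) (≤-trans (≤-reflexive (cong (T +_) (pos-v k)))
              (≤-trans (+-monoʳ-≤ T (*-monoˡ-≤ W (s≤s le))) (≤-reflexive (+-comm T (at i))))))
              (≤-reflexive (sym (+-suc (at i) T))))
      ... | no nle = inj₂ (lower , upper)
        where
        lower : suc q < toℕ u
        lower = +-cancelʳ-≤ (suc (suc T)) _ _ (≤-trans step≤ (≤-trans (≤-trans (≤-reflexive (+-comm (at i) W)) (*-monoˡ-≤ W (s≤s (≰⇒> nle))))
          (≤-trans (≤-reflexive (sym (pos-v k))) (≤-trans (dist-pos idₚ (dist-sym d))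
            (≤-trans (≤-reflexive (+-comm T (toℕ u))) (+-monoʳ-≤ (toℕ u) (≤-trans (n≤1+n T) (n≤1+n (suc T)))))))))
        upper : suc (toℕ u) < n'
        upper = ≤-trans (s≤s (s≤s (≤-trans (dist-pos idₚ d) (≤-reflexive (cong (T +_) (pos-v k))))))
          (≤-trans (≤-trans (≤-reflexive (eq T (at k))) (+-monoʳ-≤ (at k) (≤-trans (+-mono-≤ (m≤m+n T (T + 0)) (s≤s (s≤s z≤n))) ≤-refl))) (at-room k))
          where
          eq : ∀ T x → 2 + (T + x) ≡ x + (T + 2)
          eq = solve-∀
      keep : ∀ k → lab t₀ vs (v k) ≡ lab t₁ vs (v k)
      keep k = lab-agree t₀ t₁ vs uniq (λ x u x∈ d → let k' , e = ∈-tabulate⁻ {f = v} x∈ in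
        shift-agree u (off k' u (subst (λ y → Dist≤ t₀ T y u) e d))) (v k) (v∈ k)
      feas-walk : ∀ π l → (∀ k → lab (pathTree π) vs (v k) ≡ lab t₀ vs (v k)) → pos π (v j) ≡ l + pos π (v i) → Walk (λ _ → ⊤) l a a
      feas-walk π l lb e with lab-feas (pathTree π) vs uniq
      ... | L , feas , eq = subst₂ (Walk _ l) (trans (eq _ (v∈ i)) (lb i)) (trans (eq _ (v∈ j)) (trans (lb j) (sym same)))
            (path-walk π L feas l (v i) (v j) e)
      walk₀ : Walk (λ _ → ⊤) l a a
      walk₀ = feas-walk idₚ l (λ _ → refl) (trans (pos-v j) (trans l+ (cong (l +_) (sym (pos-v i)))))
      walk₁ : Walk (λ _ → ⊤) (suc l) a a
      walk₁ = feas-walk shift (suc l) (λ k → sym (keep k))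
        (trans (pos-shift (v j)) (trans (cong f (pos-v j)) (trans (f-mid far (at-lt j))
          (cong suc (trans l+ (cong (l +_) (sym (trans (pos-shift (v i)) (trans (cong f (pos-v i)) (f-low (m≤m+n (at i) (suc T))))))))))))
        where
        far : q < at j
        far = ≤-trans (≤-trans (n≤1+n (suc q)) (m≤m+n (suc (suc q)) (suc (suc T)))) (≤-trans step≤ jump)

bound-path : ∀ γ (δ≥1 : 1 ≤ 1) C → Bound (problem 1 δ≥1 γ C)
bound-path γ δ≥1 C = record { q = 1 ; K₀ = suc (suc (suc γ) * 5) ; q≥1 = ≤-refl ; K₀≥1 = s≤s z≤n ; no-player = no-player }
  where
  open PathLabels γ δ≥1 C
  no-player : ∀ {n T} → Labels.Ranking Π → RTree 1 n → suc (suc (suc γ) * 5) * suc T ^ 1 ≤ n → Player Π n T → ⊥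
  no-player {zero} R t big P with root t
  ... | ()
  no-player {suc n'} {T} R t big P = path-defeat R P (≤-pred (≤-trans enough big))
    where
    enough : suc (suc (suc γ) * (2 * T + 5)) ≤ suc (suc (suc γ) * 5) * suc T ^ 1
    enough = ≤-trans (m≤m+n _ (T + suc (suc γ) * (3 * T))) (≤-reflexive (eq (suc (suc γ)) T))
      where
      eq : ∀ g T → 1 + g * (2 * T + 5) + (T + g * (3 * T)) ≡ (1 + g * 5) * ((1 + T) * 1)
      eq = solve-∀

-- Rake and compress: level i removes from the surviving forest all windows of m + 1 generations without branching.

module Levels {δ n : ℕ} (m : ℕ) (t : RTree δ n) where

  private
    Par : Fin n → Fin n → Set
    Par u p = parent t u ≡ just p

    par? : ∀ u p → Dec (Par u p)
    par? u p = maybe-≡-dec _≟F_ (parent t u) (just p)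

  module Alive (P : Fin n → Set) where

    Branch : Fin n → Set
    Branch u = ∃ λ c → ∃ λ c' → c ≢ c' × Par c u × Par c' u × P c × P c'

    -- Only alive children count, and a node without any is unbranched for every number of
    -- generations. Thus raking is the same operation as compressing.
    Unary : ℕ → Fin n → Set
    Unary zero    u = ¬ Branch u
    Unary (suc k) u = ¬ Branch u × (∀ c → Par c u → P c → Unary k c)

    Below : ℕ → Fin n → Set
    Below zero    u = Unary m u
    Below (suc j) u = Unary m u ⊎ (∃ λ p → Par u p × P p × Below j p)

    unary-mono : ∀ {k l} → k ≤ l → ∀ {u} → Unary l u → Unary k u
    unary-mono {zero}  {zero}  le        x       = x
    unary-mono {zero}  {suc l} le        (x , _) = x
    unary-mono {suc k} {suc l} (s≤s le) (x , f) = x , λ c e p → unary-mono le (f c e p)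

    below-unary : ∀ j {u} → j ≤ m → P u → Below j u → Unary (m ∸ j) u
    below-unary zero    le pu x = x
    below-unary (suc j) le pu (inj₁ x) = unary-mono (m∸n≤m m (suc j)) x
    below-unary (suc j) {u} le pu (inj₂ (p , e , pp , x)) =
      proj₂ (subst (λ k → Unary k p) eq (below-unary j (<⇒≤ le) pp x)) u e pu
      where
      eq : m ∸ j ≡ suc (m ∸ suc j)
      eq = +-∸-assoc 1 le

    -- A node at most `m` generations under the top of a window is still inside it. Consequently it
    -- has at most one child of its own level, so runs are paths.
    below-unbranched : ∀ {u} → P u → Below m u → ¬ Branch u
    below-unbranched {u} pu x = subst (λ k → Unary k u) (n∸n≡0 m) (below-unary m ≤-refl pu x)

    below-top : ∀ j {u} → Below j u → ∃ λ i → i ≤ j × ∃ λ v → Anc (parent t) i u v × Unary m v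
    below-top zero    x = 0 , z≤n , _ , self , x
    below-top (suc j) (inj₁ x) = 0 , z≤n , _ , self , x
    below-top (suc j) (inj₂ (p , e , _ , x)) = let i , le , v , a , y = below-top j x in suc i , s≤s le , v , up e a , y

    below-suc : ∀ j {u} → Below j u → Below (suc j) u
    below-suc zero    x = inj₁ x
    below-suc (suc j) (inj₁ x) = inj₁ x
    below-suc (suc j) (inj₂ (p , e , pp , x)) = inj₂ (p , e , pp , below-suc j x)

    below-mono : ∀ {j k} → j ≤ k → ∀ {u} → Below j u → Below k u
    below-mono le = go (≤⇒≤′ le)
      where
      go : ∀ {j k u} → j ≤′ k → Below j u → Below k u
      go ≤′-refl     x = x
      go {k = suc k} (≤′-step l) x = below-suc k (go l x)

    below-anc : ∀ {j u v} → Anc (parent t) j u v → (∀ i w → Anc (parent t) i u w → i ≤ j → P w) → Unary m v → Below j u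
    below-anc self     alive x = x
    below-anc (up e a) alive x = inj₂ (_ , e , alive 1 _ (up e self) (s≤s z≤n) ,
      below-anc a (λ i w b le → alive (suc i) w (up e b) (s≤s le)) x)

    module _ (P? : ∀ u → Dec (P u)) where

      branch? : ∀ u → Dec (Branch u)
      branch? u = any? λ c → any? λ c' → ¬? (c ≟F c') ×-dec (par? c u ×-dec (par? c' u ×-dec (P? c ×-dec P? c')))

      unary? : ∀ k u → Dec (Unary k u)
      unary? zero    u = ¬? (branch? u)
      unary? (suc k) u = ¬? (branch? u) ×-dec all? (λ c → par? c u →-dec (P? c →-dec unary? k c))

      below? : ∀ j u → Dec (Below j u)
      below? zero    u = unary? m u
      below? (suc j) u = unary? m u ⊎-dec any? (λ p → par? u p ×-dec (P? p ×-dec below? j p))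

      branching : ∀ k u → ¬ Unary k u → ∃ λ z → (∃ λ j → Anc (parent t) j z u) × Branch z
      branching zero    u no-un = u , (0 , self) , decidable-stable (branch? u) no-un
      branching (suc k) u no-un with branch? u
      ... | yes b = u , (0 , self) , b
      ... | no nb with any? (λ c → par? c u ×-dec (P? c ×-dec ¬? (unary? k c)))
      ...   | yes (c , e , _ , nu) = let z , (j , a) , b = branching k c nu in z , (suc j , anc-snoc a e) , b
      ...   | no none = ⊥-elim (no-un (nb , λ c e p → decidable-stable (unary? k c) (λ nu → none (c , e , p , nu))))

  U : ℕ → Fin n → Set
  U zero    u = ⊤
  U (suc i) u = U i u × ¬ Alive.Below (U i) m u

  U? : ∀ i u → Dec (U i u)
  U? zero    u = yes tt
  U? (suc i) u = U? i u ×-dec ¬? (Alive.below? (U i) (U? i) m u)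

  Level : ℕ → Fin n → Set
  Level i u = U i u × Alive.Below (U i) m u

  level? : ∀ i u → Dec (Level i u)
  level? i u = U? i u ×-dec Alive.below? (U i) (U? i) m u

  U-anti : ∀ {i j u} → i ≤ j → U j u → U i u
  U-anti le = go (≤⇒≤′ le)
    where
    go : ∀ {i j u} → i ≤′ j → U j u → U i u
    go ≤′-refl     x       = x
    go (≤′-step l) (x , _) = go l x

  level-unique : ∀ {i j u} → Level i u → Level j u → i ≡ j
  level-unique {i} {j} (ui , bi) (uj , bj) with <-cmp i j
  ... | tri< lt _ _ = ⊥-elim (proj₂ (U-anti lt uj) bi)
  ... | tri≈ _ e _  = e
  ... | tri> _ _ gt = ⊥-elim (proj₂ (U-anti gt ui) bj)

  -- A node surviving level `i` fails `Unary m`, so below it some node has two children alive at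
  -- that level; their subtrees are disjoint and the counts add. Hence nothing survives `Λ` levels
  -- when `n < 2 ^ Λ`.
  doubling : ∀ i u → U i u → ∃ λ (f : Fin (2 ^ i) → Fin n) → Injective _≡_ _≡_ f × (∀ x → ∃ λ k → Anc (parent t) k (f x) u)
  doubling zero u _ = (λ _ → u) , (λ { {zero} {zero} _ → refl }) , λ _ → 0 , self
  doubling (suc i) u (ui , nb) with Alive.branching (U i) (U? i) m u (λ x → nb (Alive.below-mono (U i) {0} {m} z≤n x))
  ... | z , (j , a) , c , c' , ne , e , e' , uc , uc' with doubling i c uc | doubling i c' uc'
  ...   | f , f-inj , f-anc | g , g-inj , g-anc = h , h-inj , h-anc
    where
    N : ℕ
    N = 2 ^ i
    pick : Fin N ⊎ Fin (N + 0) → Fin n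
    pick (inj₁ x) = f x
    pick (inj₂ y) = g (subst Fin (+-identityʳ N) y)
    h : Fin (N + (N + 0)) → Fin n
    h x = pick (splitAt N x)
    disjoint : ∀ {x k l} → Anc (parent t) k x c → Anc (parent t) l x c' → ⊥
    disjoint p q with anc-linear p q
    ... | inj₁ (zero , self) = ne refl
    ... | inj₁ (suc k , r) = <-irrefl (trans (trans (dep-parent {t = t} e') (sym (dep-parent {t = t} e))) (dep-anc {t = t} r)) (s≤s (m≤n+m _ k))
    ... | inj₂ (zero , self) = ne refl
    ... | inj₂ (suc k , r) = <-irrefl (trans (trans (dep-parent {t = t} e) (sym (dep-parent {t = t} e'))) (dep-anc {t = t} r)) (s≤s (m≤n+m _ k))
    moved : ∀ {k x y} → x ≡ y → Anc (parent t) k x c' → Anc (parent t) k y c'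
    moved refl a = a
    subst-inj : ∀ {a b} (q : a ≡ b) {x y : Fin a} → subst Fin q x ≡ subst Fin q y → x ≡ y
    subst-inj refl r = r
    pick-inj : ∀ x y → pick x ≡ pick y → x ≡ y
    pick-inj (inj₁ x) (inj₁ y) r = cong inj₁ (f-inj r)
    pick-inj (inj₂ x) (inj₂ y) r = cong inj₂ (subst-inj (+-identityʳ N) (g-inj r))
    pick-inj (inj₁ x) (inj₂ y) r = ⊥-elim (disjoint (proj₂ (f-anc x)) (moved (sym r) (proj₂ (g-anc (subst Fin (+-identityʳ N) y)))))
    pick-inj (inj₂ x) (inj₁ y) r = ⊥-elim (disjoint (proj₂ (f-anc y)) (moved r (proj₂ (g-anc (subst Fin (+-identityʳ N) x)))))
    h-inj : Injective _≡_ _≡_ h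
    h-inj {x} {y} r = trans (sym (join-splitAt N (N + 0) x))
      (trans (cong (join N (N + 0)) (pick-inj (splitAt N x) (splitAt N y) r)) (join-splitAt N (N + 0) y))
    h-anc : ∀ x → ∃ λ k → Anc (parent t) k (h x) u
    h-anc x with splitAt N x
    ... | inj₁ y = _ , anc-trans (anc-snoc (proj₂ (f-anc y)) e) a
    ... | inj₂ y = _ , anc-trans (anc-snoc (proj₂ (g-anc _)) e') a

  module Runs (Λ : ℕ) (n<2^Λ : n < 2 ^ Λ) where

    Same : Fin n → Fin n → Set
    Same u p = ∃ λ (i : Fin Λ) → Level (toℕ i) u × Level (toℕ i) p

    abstract
      same? : ∀ u p → Dec (Same u p)
      same? u p = any? λ i → level? (toℕ i) u ×-dec level? (toℕ i) p

    same-unique : ∀ {c c' p} → Par c p → Par c' p → Same c p → Same c' p → c ≡ c'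
    same-unique {c} {c'} {p} e e' (i , lc , lp) (i' , lc' , lp') = decidable-stable (c ≟F c') λ ne →
      Alive.below-unbranched (U (toℕ i)) (proj₁ lp) (proj₂ lp)
        (c , c' , ne , e , e' , proj₁ lc , proj₁ (subst (λ k → Level k c') (sym (level-unique lp lp')) lc'))

    Run : ℕ → Fin n → Set
    Run zero    y = ⊤
    Run (suc r) y = ∃ λ p → Par y p × Same y p × Run r p

    abstract
      run? : ∀ r y → Dec (Run r y)
      run? zero    y = yes tt
      run? (suc r) y = any? λ p → par? y p ×-dec (same? y p ×-dec run? r p)

    run-anc : ∀ j {r y u} → Run (j + r) y → Anc (parent t) j y u → Run r u
    run-anc zero    x self = x
    run-anc (suc j) (p , e , _ , x) (up e' a) with just-unique e e'
    ... | refl = run-anc j x a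

    run-node : ∀ j {r y} → Run (j + r) y → ∃ λ u → Anc (parent t) j y u
    run-node zero    x = _ , self
    run-node (suc j) (p , e , _ , x) = let u , a = run-node j x in u , up e a

    level-run : ∀ (i : Fin Λ) r {y} → (∀ k → k ≤ r → ∃ λ u → Anc (parent t) k y u × Level (toℕ i) u) → Run r y
    level-run i zero    f = tt
    level-run i (suc r) f with f 0 z≤n | f 1 (s≤s z≤n)
    ... | _ , self , l₀ | p , up e self , l₁ = p , e , (i , l₀ , l₁) , level-run i r rest
      where
      rest : ∀ k → k ≤ r → ∃ λ u → Anc (parent t) k p u × Level (toℕ i) u
      rest k le with f (suc k) (s≤s le)
      ... | u , up e' a , l with just-unique e e'
      ...   | refl = u , a , l

    -- If level `i` removes some node at a height between `m` and `q - m`, its window lies entirely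
    -- within the given stretch and is a run. Otherwise the stretch without `m` generations at
    -- either end survives to the next level, which costs `2 m` per level.
    climb : ∀ rest i q b → i + rest ≡ Λ → (∀ j → j ≤ q → ∃ λ u → Anc (parent t) j b u × U i u) → rest * (m + m) ≤ q →
            ∃ λ j → ∃ λ y → Anc (parent t) j b y × j + m ≤ q × Run m y
    climb zero i q b e alive le with alive 0 z≤n
    ... | _ , self , ub with doubling Λ b (subst (λ k → U k b) (trans (sym (+-identityʳ i)) e) ub)
    ...   | f , f-inj , _ = ⊥-elim (<⇒≱ n<2^Λ (injective⇒≤ f-inj))
    climb (suc rest) i q b e alive le = by-search (any? λ x → Alive.below? (U i) (U? i) m (at-height x))
      where
      2m≤ : m + m ≤ q
      2m≤ = ≤-trans (m≤m+n (m + m) _) le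
      in-range : (x : Fin (suc (q ∸ (m + m)))) → m + toℕ x ≤ q
      in-range x = ≤-trans (+-monoʳ-≤ m (≤-pred (toℕ<n x))) (≤-trans (+-monoˡ-≤ (q ∸ (m + m)) (m≤m+n m m))
        (≤-reflexive (m+[n∸m]≡n 2m≤)))
      at-height : Fin (suc (q ∸ (m + m))) → Fin n
      at-height x = proj₁ (alive (m + toℕ x) (in-range x))
      Result : Set
      Result = ∃ λ j → ∃ λ y → Anc (parent t) j b y × j + m ≤ q × Run m y

      survive : ¬ (∃ λ x → Alive.Below (U i) m (at-height x)) → Result
      survive none = finish (climb rest (suc i) (q ∸ (m + m)) b' (trans (sym (+-suc i rest)) e) alive'
          (≤-trans (≤-reflexive (sym (m+n∸m≡n (m + m) (rest * (m + m))))) (∸-monoˡ-≤ (m + m) le)))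
        where
        m≤ : m ≤ q
        m≤ = ≤-trans (m≤m+n m m) 2m≤
        b' : Fin n
        b' = proj₁ (alive m m≤)
        a' : Anc (parent t) m b b'
        a' = proj₁ (proj₂ (alive m m≤))
        alive' : ∀ j → j ≤ q ∸ (m + m) → ∃ λ u → Anc (parent t) j b' u × U (suc i) u
        alive' j j≤ = at-height x , subst (λ k → Anc (parent t) k b' (at-height x)) (toℕ-fromℕ< (s≤s j≤)) a₂ ,
                      proj₂ (proj₂ (alive (m + toℕ x) (in-range x))) , (λ bel → none (x , bel))
          where
          x : Fin (suc (q ∸ (m + m)))
          x = fromℕ< (s≤s j≤)
          a₂ : Anc (parent t) (toℕ x) b' (at-height x)
          a₂ = let v , p , r = anc-split m (proj₁ (proj₂ (alive (m + toℕ x) (in-range x))))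
               in subst (λ w → Anc (parent t) (toℕ x) w (at-height x)) (anc-fun p a') r
        finish : (∃ λ j → ∃ λ y → Anc (parent t) j b' y × j + m ≤ q ∸ (m + m) × Run m y) → Result
        finish (j , y , a , j≤ , r) = m + j , y , anc-trans a' a ,
          ≤-trans (≤-reflexive (+-assoc m j m)) (≤-trans (+-monoʳ-≤ m j≤) (≤-trans (+-monoˡ-≤ _ (m≤m+n m m)) (≤-reflexive (m+[n∸m]≡n 2m≤)))) , r

      removed : ∀ x → Alive.Below (U i) m (at-height x) → Result
      removed x bel = lo , y , ay , lo+m≤q ,
          level-run (fromℕ< i<Λ) m (λ k k≤ → let w , aw , lw = lev k k≤ in w , aw , subst (λ l → Level l w) (sym (toℕ-fromℕ< i<Λ)) lw)
        where
        top-data : ∃ λ i' → i' ≤ m × ∃ λ v → Anc (parent t) i' (at-height x) v × Alive.Unary (U i) m v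
        top-data = Alive.below-top (U i) m bel
        j' : ℕ
        j' = proj₁ top-data
        v : Fin n
        v = proj₁ (proj₂ (proj₂ top-data))
        lo : ℕ
        -- The top `v` of the window is `m + x + j'` generations above `b`, and the run starts `m`
        -- generations below `v`.
        lo = toℕ x + j'
        i<Λ : i < Λ
        i<Λ = ≤-trans (≤-trans (≤-reflexive (+-comm 1 i)) (+-monoʳ-≤ i (s≤s z≤n))) (≤-reflexive e)
        lo+m≤q : lo + m ≤ q
        lo+m≤q = ≤-trans (+-monoˡ-≤ m (+-mono-≤ (≤-pred (toℕ<n x)) (proj₁ (proj₂ top-data))))
          (≤-trans (≤-reflexive (+-assoc _ m m)) (≤-reflexive (m∸n+n≡m 2m≤)))
        lo≤q : lo ≤ q
        lo≤q = ≤-trans (m≤m+n lo m) lo+m≤q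
        y : Fin n
        y = proj₁ (alive lo lo≤q)
        ay : Anc (parent t) lo b y
        ay = proj₁ (proj₂ (alive lo lo≤q))
        eq : ∀ m x j → m + x + j ≡ x + j + m
        eq = solve-∀
        y-v : Anc (parent t) m y v
        y-v = let y' , p , r = anc-split lo {m} (subst (λ k → Anc (parent t) k b v) (eq m (toℕ x) j')
                    (anc-trans (proj₁ (proj₂ (alive (m + toℕ x) (in-range x)))) (proj₁ (proj₂ (proj₂ (proj₂ top-data))))))
              in subst (λ w → Anc (parent t) m w v) (anc-fun p ay) r
        alive-above : ∀ {k z} → k ≤ m → Anc (parent t) k y z → U i z
        alive-above {k} {z} k≤ c = let z' , c' , uz = alive (lo + k) (≤-trans (+-monoʳ-≤ lo k≤) lo+m≤q) in
          subst (U i) (anc-fun c' (anc-trans ay c)) uz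
        lev : ∀ k → k ≤ m → ∃ λ w → Anc (parent t) k y w × Level i w
        lev k k≤ =
          let w , p , r = anc-split k {m ∸ k} (subst (λ l → Anc (parent t) l y v) (sym (m+[n∸m]≡n k≤)) y-v)
          in w , p , alive-above k≤ p , Alive.below-mono (U i) (m∸n≤m m k)
               (Alive.below-anc (U i) r (λ l z c l≤ → alive-above (≤-trans (+-monoʳ-≤ k l≤) (≤-reflexive (m+[n∸m]≡n k≤))) (anc-trans p c))
                 (proj₂ (proj₂ (proj₂ (proj₂ top-data)))))

      by-search : Dec (∃ λ x → Alive.Below (U i) m (at-height x)) → Result
      by-search (yes (x , bel)) = removed x bel
      by-search (no none)       = survive none

-- Cole–Vishkin colours

odd : ℕ → Bool
odd zero          = false
odd (suc zero)    = true
odd (suc (suc x)) = odd x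

half-odd : ∀ x y → odd x ≡ odd y → ⌊ x /2⌋ ≡ ⌊ y /2⌋ → x ≡ y
half-odd zero          zero          _ _ = refl
half-odd (suc zero)    (suc zero)    _ _ = refl
half-odd (suc (suc x)) (suc (suc y)) o h = cong (2 +_) (half-odd x y o (suc-injective h))
half-odd zero          (suc (suc y)) _ ()
half-odd (suc zero)    (suc (suc y)) _ ()
half-odd (suc (suc x)) zero          _ ()
half-odd (suc (suc x)) (suc zero)    _ ()

half< : ∀ b x → x < b + b → ⌊ x /2⌋ < b
half< (suc b) zero          _ = s≤s z≤n
half< (suc b) (suc zero)    _ = s≤s z≤n
half< (suc b) (suc (suc x)) (s≤s lt) rewrite +-suc b b = s≤s (half< b x (≤-pred lt))

bool : Bool → ℕ
bool true  = 1
bool false = 0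

bool-inj : ∀ {a b} → bool a ≡ bool b → a ≡ b
bool-inj {true}  {true}  _ = refl
bool-inj {false} {false} _ = refl

bool≤1 : ∀ a → bool a ≤ 1
bool≤1 true  = s≤s z≤n
bool≤1 false = z≤n

-- 2 i + (bit i of x), where i is the least bit at which x and y differ
cv : ℕ → ℕ → ℕ → ℕ
cv zero    x y = 0
cv (suc B) x y with odd x ≟B odd y
... | yes _ = 2 + cv B ⌊ x /2⌋ ⌊ y /2⌋
... | no _  = bool (odd x)

cv≤ : ∀ B x y → cv B x y ≤ 2 * B
cv≤ zero    x y = z≤n
cv≤ (suc B) x y with odd x ≟B odd y
... | yes _ = ≤-trans (s≤s (s≤s (cv≤ B ⌊ x /2⌋ ⌊ y /2⌋))) (≤-reflexive (sym (*-suc 2 B)))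
... | no _  = ≤-trans (bool≤1 (odd x)) (≤-trans (s≤s z≤n) (≤-reflexive (sym (*-suc 2 B))))

-- If both comparisons stop at the same bit, the recorded values of that bit in `x` and in `y`
-- differ; otherwise the recorded positions differ.
cv-proper : ∀ B x y z → x < 2 ^ B → y < 2 ^ B → z < 2 ^ B → x ≢ y → y ≢ z → cv B x y ≢ cv B y z
cv-proper zero    zero zero z (s≤s z≤n) (s≤s z≤n) _ ne _ _ = ne refl
cv-proper (suc B) x y z x< y< z< ne ne' e with odd x ≟B odd y | odd y ≟B odd z
... | yes o | yes o' = cv-proper B _ _ _ (h x x<) (h y y<) (h z z<) (λ q → ne (half-odd x y o q)) (λ q → ne' (half-odd y z o' q))
                         (suc-injective (suc-injective e))
  where
  h : ∀ x → x < 2 ^ suc B → ⌊ x /2⌋ < 2 ^ B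
  h x lt = half< (2 ^ B) x (subst (λ k → x < 2 ^ B + k) (+-identityʳ (2 ^ B)) lt)
... | yes _ | no _  = <⇒≱ (s≤s (s≤s z≤n)) (≤-trans (≤-reflexive e) (bool≤1 (odd y)))
... | no _  | yes _ = <⇒≱ (s≤s (s≤s z≤n)) (≤-trans (≤-reflexive (sym e)) (bool≤1 (odd x)))
... | no o  | no _  = o (bool-inj e)

digit< : ∀ Q {a b b'} → a < Q → b < b' → a + Q * b < Q * b'
digit< Q {b = b} a< lt = ≤-trans (+-monoˡ-≤ (Q * b) a<) (≤-trans (≤-reflexive (sym (*-suc Q b))) (*-monoʳ-≤ Q lt))

digits : ∀ Q {a a' b b'} → a < Q → a' < Q → a + Q * b ≡ a' + Q * b' → a ≡ a' × b ≡ b'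
digits Q {a} {a'} {b} {b'} a< a'< e with <-cmp b b'
... | tri≈ _ refl _ = +-cancelʳ-≡ (Q * b) a a' e , refl
... | tri< lt _ _ = ⊥-elim (<-irrefl e (<-≤-trans (digit< Q a< lt) (m≤n+m _ a')))
... | tri> _ _ gt = ⊥-elim (<-irrefl (sym e) (<-≤-trans (digit< Q a'< gt) (m≤n+m _ a)))

-- The labelling obtained from a certificate

anc-ancestor : ∀ {n} {p : Fin n → Maybe (Fin n)} {k v u} → Anc p k v u → ancestor p k v ≡ just u
anc-ancestor self = refl
anc-ancestor {p = p} {suc k} {v} (up e a) = trans (ancestor-suc k v) (trans (cong (_>>= ancestor p k) e) (anc-ancestor a))

ancestor-anc : ∀ {n} {p : Fin n → Maybe (Fin n)} j {v u} → ancestor p j v ≡ just u → Anc p j v u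
ancestor-anc zero refl = self
ancestor-anc {p = p} (suc j) {v} e with p v in pv | trans (sym (ancestor-suc j v)) e
... | just _ | e' = up pv (ancestor-anc j e')

depth-anc : ∀ {n} {p : Fin n → Maybe (Fin n)} {v h} → Depth p v h → ∀ j → j ≤ h → ∃ λ u → Anc p j v u
depth-anc d          zero    _        = _ , self
depth-anc (down e d) (suc j) (s≤s le) = let u , a = depth-anc d j le in u , up e a

depth-root : ∀ {n} {p : Fin n → Maybe (Fin n)} {v h} → Depth p v h → ∃ λ r → Anc p h v r × p r ≡ nothing
depth-root (top e)    = _ , self , e
depth-root (down e d) = let r , a , e' = depth-root d in r , up e a , e'

injective⇒surjective : ∀ {m} (f : Fin m → Fin m) → Injective _≡_ _≡_ f → ∀ y → ∃ λ x → f x ≡ y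
injective⇒surjective {m} f inj y with any? (λ x → f x ≟F y)
... | yes found = found
... | no none = ⊥-elim (1+n≰n (injective⇒≤ {f = g} g-inj))
  where
  g : Fin (suc m) → Fin m
  g zero    = y
  g (suc x) = f x
  g-inj : Injective _≡_ _≡_ g
  g-inj {zero}  {zero}  e = refl
  g-inj {zero}  {suc x} e = ⊥-elim (none (x , sym e))
  g-inj {suc x} {zero}  e = ⊥-elim (none (x , e))
  g-inj {suc x} {suc y} e = cong suc (inj e)

colours : ℕ → ℕ → ℕ
colours B K = suc (2 * B) ^ K

-- The search in `minimum` makes at most `colours B K` moves of at most `K` generations, up or down.
-- Another `K` generations below leave room for the plan, and `4 * K` above for the compared colours
-- and the ancestors that these look at.
window : ℕ → ℕ → ℕ
window B K = (K + colours B K * K) + (colours B K * K + 4 * K)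

module Alg (Π : LCL) (cert : Labels.Cert Π) (B m Λ : ℕ) (m≥ : window B (Labels.Cert.K cert) ≤ m) {n : ℕ} (n<2^Λ : n < 2 ^ Λ) (t : RTree (LCL.δ Π) n) (ident : Fin n → ℕ) where
  open LCL Π
  open Labels Π
  open Cert cert

  open Levels m t using (module Runs)
  open Runs Λ n<2^Λ public

  cvA : ℕ → Fin n → ℕ
  cvA j v = maybe (λ u → cv B (ident v) (ident u)) 0 (ancestor (parent t) j v)

  -- The digits in base `2 B + 1` compare `v` with its ancestors at all distances up to `K`. A
  -- colour comparing with the parent alone would separate adjacent nodes only.
  partCol : ℕ → Fin n → ℕ
  partCol zero    v = 0
  partCol (suc j) v = cvA (suc j) v + suc (2 * B) * partCol j v

  col : Fin n → ℕ
  col = partCol K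

  colA : ℕ → Fin n → ℕ
  colA j v = maybe col 0 (ancestor (parent t) j v)

  -- The minimum is sought K generations higher, so that steering depends on ancestors only.
  Top : Fin n → Set
  Top v = Run (K + K) v × (∀ (x : Fin (suc (K + K))) → toℕ x ≢ K → colA K v < colA (toℕ x) v)

  abstract
    top? : ∀ v → Dec (Top v)
    top? v = run? (K + K) v ×-dec all? (λ x → ¬? (toℕ x ≟ℕ K) →-dec (colA K v <? colA (toℕ x) v))

  -- Orders the children of `p`: the child of the same level, of which there is at most one,
  -- precedes all others, and these are ordered by identifier. The plan continues at place 0.
  Before : Fin n → Fin n → Fin n → Set
  Before p c c' = parent t c' ≡ just p × ¬ Same c p × (Same c' p ⊎ ident c' < ident c)

  abstract
    before? : ∀ p c c' → Dec (Before p c c')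
    before? p c c' = maybe-≡-dec _≟F_ (parent t c') (just p) ×-dec (¬? (same? c p) ×-dec (same? c' p ⊎-dec (ident c' <? ident c)))

  place : Fin n → Fin n → ℕ
  place p c = length (filter (before? p c) (allFin n))

  Plan : Set
  Plan = List (Vec (Fin γ) δ × Fin δ)

  k₀ : Fin δ
  k₀ = fromℕ< δ≥1

  choice : Fin γ → Plan → Vec (Fin γ) δ × Fin δ
  choice a []      = any a , k₀
  choice a (x ∷ _) = x

  slot : ℕ → Fin δ
  slot r with r <? δ
  ... | yes lt = fromℕ< lt
  ... | no _   = k₀

  childLabel : Fin γ × Plan → Fin n → Fin n → Fin γ
  -- The transposition hands the position `k` selected by the plan to the child at place 0.
  childLabel (a , ps) p c = let v , k = choice a ps in lookup v (swapF k₀ k (slot (place p c)))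

  pickPlan : ∀ {X Y : Set} → Dec X → Dec Y → Plan → Plan → Plan
  pickPlan (yes _) _       f g = f
  pickPlan (no _)  (yes _) f g = g
  pickPlan (no _)  (no _)  f g = []

  pick-first : ∀ {X Y : Set} (d : Dec X) (e : Dec Y) {f g} → X → pickPlan d e f g ≡ f
  pick-first (yes _) e x = refl
  pick-first (no nx) e x = ⊥-elim (nx x)

  pick-second : ∀ {X Y : Set} (d : Dec X) (e : Dec Y) {f g} → ¬ X → Y → pickPlan d e f g ≡ g
  pick-second (yes x) e nx y = ⊥-elim (nx x)
  pick-second (no _) (yes _) nx y = refl
  pick-second (no _) (no ny) nx y = ⊥-elim (ny y)

  next : Fin γ × Plan → Fin n → Fin n → Fin γ × Plan
  next s p c = childLabel s p c , pickPlan (top? c) (same? c p) (plan (childLabel s p c)) (drop 1 (proj₂ s))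

  -- Label and pending plan of v, computed from its h nearest ancestors.
  state : ℕ → Fin n → Fin γ × Plan
  stateFrom : ℕ → Fin n → Maybe (Fin n) → Fin γ × Plan
  state zero    v = a₀ , []
  state (suc h) v = stateFrom h v (parent t v)
  stateFrom h v nothing  = a₀ , []
  stateFrom h v (just p) = next (state h p) p v

  state-parent : ∀ h {v p} → parent t v ≡ just p → state (suc h) v ≡ next (state h p) p v
  state-parent h e rewrite e = refl

  Good : Fin γ × Plan → Set
  Good (a , ps) = S a × (ps ≡ [] ⊎ Valid S a₀ a ps)

  choice-C : ∀ a ps → Good (a , ps) → (a , proj₁ (choice a ps)) ∈ C
  choice-C a []       (s , _)            = any-C s
  choice-C a (x ∷ ps) (s , inj₂ (c , _)) = c

  choice-S : ∀ a ps → Good (a , ps) → ∀ i → S (lookup (proj₁ (choice a ps)) i)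
  choice-S a []       (s , _)                = any-S s
  choice-S a (x ∷ ps) (s , inj₂ (_ , r , _)) = r

  slot-0 : slot 0 ≡ k₀
  slot-0 with 0 <? δ
  ... | yes lt = refl
  ... | no nlt = ⊥-elim (nlt δ≥1)

  place-same : ∀ {p c} → Same c p → place p c ≡ 0
  place-same {p} {c} s with filter (before? p c) (allFin n) in eq
  ... | []     = refl
  ... | x ∷ xs = ⊥-elim (proj₁ (proj₂ (proj₂ (∈-filter⁻ (before? p c) {xs = allFin n} (subst (x ∈_) (sym eq) (here refl))))) s)

  childLabel-same : ∀ {a x ps p c} → Same c p → childLabel (a , x ∷ ps) p c ≡ lookup (proj₁ x) (proj₂ x)
  childLabel-same {a} {v , k} {ps} {p} {c} s rewrite place-same {p} {c} s | slot-0 | swapF-hit k₀ k = refl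

  next-good : ∀ s p c → Good s → Good (next s p c)
  next-good (a , ps) p c g = label-S , plans (top? c) (same? c p)
    where
    label-S : S (childLabel (a , ps) p c)
    label-S = choice-S a ps g _
    tail-ok : ∀ a ps → Good (a , ps) → Same c p → drop 1 ps ≡ [] ⊎ Valid S a₀ (childLabel (a , ps) p c) (drop 1 ps)
    tail-ok a []       _                     sm = inj₁ refl
    tail-ok a (x ∷ ps) (_ , inj₂ (_ , _ , ok)) sm = inj₂ (subst (λ b → Valid S a₀ b ps) (sym (childLabel-same {a} {x} {ps} sm)) ok)
    plans : ∀ (d : Dec (Top c)) (e : Dec (Same c p)) →
      let qs = pickPlan d e (plan (childLabel (a , ps) p c)) (drop 1 ps) in qs ≡ [] ⊎ Valid S a₀ (childLabel (a , ps) p c) qs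
    plans (yes _) e        = inj₂ (plan-ok label-S)
    plans (no _)  (no _)   = inj₁ refl
    plans (no _)  (yes sm) = tail-ok a ps g sm

  state-good : ∀ h v → Good (state h v)
  state-good zero    v = S-a₀ , inj₁ refl
  state-good (suc h) v with parent t v
  ... | nothing = S-a₀ , inj₁ refl
  ... | just p  = next-good (state h p) p v (state-good h p)

  data Steered : ℕ → Fin n → Fin n → Set where
    here : ∀ {z} → Steered 0 z z
    step : ∀ {k w p z} → parent t w ≡ just p → Same w p → ¬ Top w → Steered k p z → Steered (suc k) w z

  Steering : ℕ → Fin γ × Plan → Set
  Steering i (a , ps) = length ps + i ≡ K × Valid S a₀ a ps

  steering-step : ∀ {i w p} s → suc i ≤ K → Same w p → Steering i s → Steering (suc i) (childLabel s p w , drop 1 (proj₂ s))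
  steering-step (a , [])             le sm (len , _)  = ⊥-elim (<⇒≢ le len)
  steering-step {i} (a , x ∷ ps) le sm (len , ok) = trans (+-suc (length ps) i) len ,
    subst (λ b → Valid S a₀ b ps) (sym (childLabel-same {a} {x} {ps} sm)) (proj₂ (proj₂ ok))

  steer : ∀ {i w z q} → Top z → parent t z ≡ just q → i ≤ K → Steered i w z → ∀ h → Steering i (state (i + suc h) w)
  steer {z = z} {q} tp e le here h = subst (Steering 0)
      (sym (trans (state-parent h e) (cong (childLabel (state h q) q z ,_) (pick-first (top? z) (same? z q) tp))))
      (trans (+-identityʳ _) (plan-len good) , plan-ok good)
    where
    good : S (childLabel (state h q) q z)
    good = choice-S _ _ (state-good h q) _
  steer {suc i} {w} tp e le (step {p = p} ew sm nt st) h = subst (Steering (suc i))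
    (sym (trans (state-parent (i + suc h) ew)
      (cong (childLabel (state (i + suc h) p) p w ,_) (pick-second (top? w) (same? w p) nt sm))))
    (steering-step (state (i + suc h) p) le sm (steer tp e (<⇒≤ le) st h))

  -- The label at `z` may vary with `h`, but all plans have length `K` and end in `a₀`, so `K`
  -- generations lower this dependence is gone.
  anchor-state : ∀ {w z q} → Top z → parent t z ≡ just q → Steered K w z → ∀ h → state (K + suc h) w ≡ (a₀ , [])
  anchor-state {w} tp e st h with state (K + suc h) w | steer tp e ≤-refl st h
  ... | a , []     | _ , ok  = cong (_, []) ok
  ... | a , x ∷ ps | len , _ = ⊥-elim (<⇒≢ (s≤s (m≤n+m K (length ps))) (sym len))

  state-lift : ∀ {j v u h h'} → Anc (parent t) j v u → state h u ≡ state h' u → state (j + h) v ≡ state (j + h') v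
  state-lift self e = e
  state-lift {suc j} {h = h} {h'} (up {u = p} ep a) e =
    trans (state-parent (j + h) ep) (trans (cong (λ s → next s p _) (state-lift a e)) (sym (state-parent (j + h') ep)))

  state-root : ∀ {v} → parent t v ≡ nothing → ∀ h → state h v ≡ (a₀ , [])
  state-root e zero = refl
  state-root e (suc h) rewrite e = refl

  module _ (id-inj : Injective _≡_ _≡_ ident) (id< : ∀ v → ident v < 2 ^ B) where

    cvA≤ : ∀ j v → cvA j v < suc (2 * B)
    cvA≤ j v with ancestor (parent t) j v
    ... | nothing = s≤s z≤n
    ... | just u  = s≤s (cv≤ B (ident v) (ident u))

    partCol< : ∀ j v → partCol j v < suc (2 * B) ^ j
    partCol< zero    v = s≤s z≤n
    partCol< (suc j) v = ≤-trans (+-monoˡ-≤ (suc (2 * B) * partCol j v) (cvA≤ (suc j) v))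
      (≤-trans (≤-reflexive (sym (*-suc (suc (2 * B)) (partCol j v)))) (*-monoʳ-≤ (suc (2 * B)) (partCol< j v)))

    partCol-component : ∀ k {u v} → partCol k u ≡ partCol k v → ∀ j → 1 ≤ j → j ≤ k → cvA j u ≡ cvA j v
    partCol-component zero    e j j≥1 j≤ = ⊥-elim (<⇒≱ j≥1 j≤)
    partCol-component (suc k) {u} {v} e j j≥1 j≤ with digits (suc (2 * B)) (cvA≤ (suc k) u) (cvA≤ (suc k) v) e
    ... | c , r with j ≟ℕ suc k
    ...   | yes refl = c
    ...   | no ne    = partCol-component k r j j≥1 (≤-pred (≤∧≢⇒< j≤ ne))

    -- The `j`-th digits compare `u` with `v` and `v` with `w`, so they differ by `cv-proper`; this
    -- is why a further ancestor `w` at the same distance is required.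
    col-proper : ∀ {j u v w} → 1 ≤ j → j ≤ K → Anc (parent t) j u v → Anc (parent t) j v w → col u ≢ col v
    col-proper {j} {u} {v} {w} j≥1 j≤ a b e with partCol-component K e j j≥1 j≤
    ... | c rewrite anc-ancestor a | anc-ancestor b =
      cv-proper B _ _ _ (id< u) (id< v) (id< w) (distinct a j≥1) (distinct b j≥1) c
      where
      distinct : ∀ {j u v} → Anc (parent t) j u v → 1 ≤ j → ident u ≢ ident v
      distinct {suc j} {u} {v} a _ e with id-inj e
      ... | refl = <-irrefl (dep-anc {t = t} a) (s≤s (m≤n+m (dep t u) j))

    module _ {y : Fin n} (run : Run m y) where

      private
        f : ℕ → ℕ
        f j = colA j y

        node : ∀ j → j ≤ m → ∃ λ u → Anc (parent t) j y u
        node j le = run-node j {m ∸ j} (subst (λ k → Run k y) (sym (m+[n∸m]≡n le)) run)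

        colA-anc : ∀ {j u} x → Anc (parent t) j y u → colA x u ≡ f (j + x)
        colA-anc {j} {u} x a = cong (maybe col 0) (eq a)
          where
          eq : ∀ {j y u} → Anc (parent t) j y u → ancestor (parent t) x u ≡ ancestor (parent t) (j + x) y
          eq self = refl
          eq {suc j} {y} (up e a) = trans (eq a) (sym (trans (ancestor-suc (j + x) y) (cong (_>>= ancestor (parent t) (j + x)) e)))

        f-anc : ∀ {j u} → Anc (parent t) j y u → f j ≡ col u
        f-anc a = cong (maybe col 0) (anc-ancestor a)

        f< : ∀ j → f j < colours B K
        f< j with ancestor (parent t) j y
        ... | nothing = m^n>0 (suc (2 * B)) K
        ... | just u  = partCol< K u

        apart : ∀ s d → 1 ≤ d → d ≤ K → s + d + d ≤ m → f s ≢ f (s + d)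
        apart s d d≥1 d≤ le e with node (s + d + d) le
        ... | w , a with anc-split (s + d) a
        ...   | v , a₁ , b with anc-split s a₁
        ...     | u , a₂ , c = col-proper d≥1 d≤ c b (trans (sym (f-anc a₂)) (trans e (f-anc a₁)))

        Minimal : ℕ → Set
        Minimal r = ∀ (x : Fin (suc (K + K))) → toℕ x ≢ K → f (r + K) < f (r + toℕ x)

      -- Moving to a smaller colour inside the window terminates since colours are bounded.
      minimum : ∀ b r → f (r + K) < b → K + b * K ≤ r → r + (b * K + 4 * K) ≤ m →
                ∃ λ r' → K ≤ r' × r' + (K + K) ≤ m × Minimal r'
      minimum (suc b) r fr lo hi with any? (λ (x : Fin (suc (K + K))) → ¬? (toℕ x ≟ℕ K) ×-dec (f (r + toℕ x) ≤? f (r + K)))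
      ... | no none = r , ≤-trans (m≤m+n K _) lo ,
              ≤-trans (+-monoʳ-≤ r (≤-trans (+-monoʳ-≤ K (m≤m+n K _)) (m≤n+m (4 * K) (suc b * K)))) hi ,
              λ x ne → ≰⇒> (λ le → none (x , ne , le))
      ... | yes (x , ne , le) = minimum b r'' (<-≤-trans (subst (λ k → f k < f (r + K)) (sym r''K) less) (≤-pred fr)) lo' hi'
        where
        r₀ r'' : ℕ
        r₀ = r ∸ K
        -- The window is recentred: its middle `r'' + K` is the position `r + toℕ x` of the smaller
        -- colour.
        r'' = r₀ + toℕ x
        r≡ : r ≡ r₀ + K
        r≡ = sym (m∸n+n≡m (≤-trans (m≤m+n K _) lo))
        r''K : r'' + K ≡ r + toℕ x
        r''K = trans (eq r₀ (toℕ x) K) (cong (_+ toℕ x) (sym r≡))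
          where
          eq : ∀ a x k → a + x + k ≡ a + k + x
          eq = solve-∀
        x≤ : toℕ x ≤ K + K
        x≤ = ≤-pred (toℕ<n x)
        top≤ : r + (K + K + K + K) ≤ m
        top≤ = ≤-trans (+-monoʳ-≤ r (≤-trans (≤-reflexive (eq K)) (m≤n+m (4 * K) (suc b * K)))) hi
          where
          eq : ∀ K → K + K + K + K ≡ 4 * K
          eq = solve-∀
        -- The two positions are at most `K` apart, where colours are distinct, so a tie cannot stop
        -- the strict descent.
        differ : f (r + toℕ x) ≢ f (r + K)
        differ e with ≤-total (toℕ x) K
        ... | inj₁ x≤K = apart (r + toℕ x) (K ∸ toℕ x) (m<n⇒0<n∸m (≤∧≢⇒< x≤K ne)) (m∸n≤m K (toℕ x))
                (≤-trans (+-mono-≤ (≤-reflexive eqK) (m∸n≤m K (toℕ x))) (≤-trans (≤-reflexive (+-assoc r K K)) (≤-trans (+-monoʳ-≤ r (≤-trans (m≤m+n (K + K) K) (m≤m+n _ K))) top≤)))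
                (trans e (cong f (sym eqK)))
          where
          eqK : r + toℕ x + (K ∸ toℕ x) ≡ r + K
          eqK = trans (+-assoc r (toℕ x) _) (cong (r +_) (m+[n∸m]≡n x≤K))
        ... | inj₂ K≤x = apart (r + K) (toℕ x ∸ K) (m<n⇒0<n∸m (≤∧≢⇒< K≤x (λ q → ne (sym q))))
                d≤ (≤-trans (+-mono-≤ (≤-reflexive eqx) d≤) (≤-trans (+-monoˡ-≤ K (+-monoʳ-≤ r x≤)) (≤-trans (≤-reflexive (+-assoc r (K + K) K)) (≤-trans (+-monoʳ-≤ r (m≤m+n (K + K + K) K)) top≤))))
                (trans (sym e) (cong f (sym eqx)))
          where
          eqx : r + K + (toℕ x ∸ K) ≡ r + toℕ x
          eqx = trans (+-assoc r K _) (cong (r +_) (m+[n∸m]≡n K≤x))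
          d≤ : toℕ x ∸ K ≤ K
          d≤ = ≤-trans (∸-monoˡ-≤ K x≤) (≤-reflexive (m+n∸m≡n K K))
        less : f (r + toℕ x) < f (r + K)
        less = ≤∧≢⇒< le differ
        lo' : K + b * K ≤ r''
        lo' = ≤-trans (+-cancelʳ-≤ K _ _ (≤-trans (≤-reflexive (+-comm (K + b * K) K)) (≤-trans lo (≤-reflexive r≡)))) (m≤m+n r₀ (toℕ x))
        hi' : r'' + (b * K + 4 * K) ≤ m
        hi' = ≤-trans (+-monoˡ-≤ _ (+-monoʳ-≤ r₀ x≤)) (≤-trans (≤-reflexive (trans (eq r₀ K (b * K)) (cong (_+ (K + b * K + 4 * K)) (sym r≡)))) hi)
          where
          eq : ∀ a k b → a + (k + k) + (b + 4 * k) ≡ a + k + (k + b + 4 * k)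
          eq = solve-∀

      -- The minimum at height `r + K` makes the node `z` at height `r` a `Top`, and its plan runs
      -- out `K` generations lower, at `w`.
      anchor : ∃ λ j → j ≤ m × ∃ λ w → Anc (parent t) j y w × (∀ h → state (K + suc h) w ≡ (a₀ , []))
      anchor with minimum (colours B K) (K + colours B K * K) (f< (K + colours B K * K + K)) ≤-refl m≥
      ... | r , K≤r , r≤ , min with node r (≤-trans (m≤m+n r (K + K)) r≤)
      ...   | z , az = j , ≤-trans (m∸n≤m r K) (≤-trans (m≤m+n r (K + K)) r≤) , w , aw ,
                anchor-state topz (proj₂ pz) (steered K ≤-refl (subst (λ i → Anc (parent t) i y w) refl aw))
        where
        run-at : ∀ {i u} k → i + k ≤ m → Anc (parent t) i y u → Run k u
        run-at {i} {u} k le a = run-anc i {k} (run-shorten (m ∸ (i + k)) (subst (λ q → Run q y) (sym (m+[n∸m]≡n le)) run)) a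
          where
          run-shorten : ∀ l {k y} → Run (k + l) y → Run k y
          run-shorten l {zero}  _ = tt
          run-shorten l {suc k} (p , e , s , x) = p , e , s , run-shorten l x
        topz : Top z
        topz = run-at (K + K) r≤ az , λ x ne → subst₂ _<_ (sym (colA-anc K az)) (sym (colA-anc (toℕ x) az)) (min x ne)
        pz : ∃ λ q → parent t z ≡ just q
        pz with K | K≥1 | proj₁ topz
        ... | suc _ | _ | p , e , _ = p , e
        j : ℕ
        j = r ∸ K
        w : Fin n
        w = proj₁ (node j (≤-trans (m∸n≤m r K) (≤-trans (m≤m+n r (K + K)) r≤)))
        aw : Anc (parent t) j y w
        aw = proj₂ (node j (≤-trans (m∸n≤m r K) (≤-trans (m≤m+n r (K + K)) r≤)))
        -- A `Top` at height `r - i` would need its minimum at `r + K - i`. Its window also contains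
        -- `r + K`, and the window around `r + K` contains `r + K - i`, so each colour would be
        -- smaller than the other.
        not-top : ∀ i → 1 ≤ i → i ≤ K → ∀ {u} → Anc (parent t) (r ∸ i) y u → ¬ Top u
        not-top i i≥1 i≤ {u} a (_ , tu) = <-irrefl refl (<-trans
            (subst₂ _<_ (colA-anc K a) (trans (colA-anc _ a) (cong f (trans (cong (r ∸ i +_) (toℕ-fromℕ< x<)) back))) (tu (fromℕ< x<) x≢))
            (subst (f (r + K) <_) (cong f (trans (cong (r +_) (toℕ-fromℕ< x'<)) (sym shift))) (min (fromℕ< x'<) x'≢)))
          where
          i≤r : i ≤ r
          i≤r = ≤-trans i≤ K≤r
          x< : K + i < suc (K + K)
          x< = s≤s (+-monoʳ-≤ K i≤)
          x≢ : toℕ (fromℕ< x<) ≢ K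
          x≢ e = <⇒≢ (≤-trans (≤-reflexive (+-comm 1 K)) (+-monoʳ-≤ K i≥1)) (sym (trans (sym (toℕ-fromℕ< x<)) e))
          back : r ∸ i + (K + i) ≡ r + K
          back = trans (eq (r ∸ i) K i) (cong (_+ K) (m∸n+n≡m i≤r))
            where
            eq : ∀ a k i → a + (k + i) ≡ a + i + k
            eq = solve-∀
          x'< : K ∸ i < suc (K + K)
          x'< = s≤s (≤-trans (m∸n≤m K i) (m≤m+n K K))
          x'≢ : toℕ (fromℕ< x'<) ≢ K
          x'≢ e = <⇒≢ (≤-trans (+-monoʳ-≤ 1 ≤-refl) (≤-trans (≤-trans (≤-reflexive (+-comm 1 (K ∸ i))) (+-monoʳ-≤ (K ∸ i) i≥1)) (≤-reflexive (m∸n+n≡m i≤)))) (trans (sym (toℕ-fromℕ< x'<)) e)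
          shift : r ∸ i + K ≡ r + (K ∸ i)
          shift = +-cancelʳ-≡ i _ _ (trans (eq (r ∸ i) K i) (trans (cong (_+ K) (m∸n+n≡m i≤r))
                    (sym (trans (+-assoc r (K ∸ i) i) (cong (r +_) (m∸n+n≡m i≤))))))
            where
            eq : ∀ a k i → a + k + i ≡ a + i + k
            eq = solve-∀
        steered : ∀ i → i ≤ K → ∀ {u} → Anc (parent t) (r ∸ i) y u → Steered i u z
        steered zero    le a with anc-fun a az
        ... | refl = here
        steered (suc i) le {u} a with run-at 1 (≤-trans (≤-reflexive (trans (+-comm (r ∸ suc i) 1) below)) (≤-trans (m∸n≤m r i) (≤-trans (m≤m+n r (K + K)) r≤))) a
          where
          below : suc (r ∸ suc i) ≡ r ∸ i
          below = sym (+-∸-assoc 1 (≤-trans le K≤r))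
        ... | p , e , s , _ = step e s (not-top (suc i) (s≤s z≤n) le a)
                (steered i (<⇒≤ le) (subst (λ q → Anc (parent t) q y p) (sym (+-∸-assoc 1 (≤-trans le K≤r))) (anc-snoc a e)))

    reachRadius : ℕ
    reachRadius = Λ * (m + m)

    horizon : ℕ
    horizon = reachRadius + suc K

    private
      stable-below : ∀ {j v u} → Anc (parent t) j v u → j ≤ reachRadius →
                     (∀ h → state (suc (K + suc h)) u ≡ state (K + suc h) u) → state (suc horizon) v ≡ state horizon v
      stable-below {j} {v} a le st = subst (λ h → state (suc h) v ≡ state h v) total
          (subst (λ h → state h v ≡ state (j + (K + suc e)) v) (+-suc j (K + suc e)) (state-lift a (st e)))
        where
        e : ℕ
        e = reachRadius ∸ j
        eq : ∀ a k e → a + (k + suc e) ≡ a + e + suc k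
        eq = solve-∀
        total : j + (K + suc e) ≡ horizon
        total = trans (eq j K e) (cong (_+ suc K) (m+[n∸m]≡n le))

      stable-near : ∀ {v} → dep t v ≤ reachRadius → state (suc horizon) v ≡ state horizon v
      stable-near {v} le = let r , a , e = depth-root (proj₂ (depth t v)) in
        stable-below a le (λ h → trans (state-root e (suc (K + suc h))) (sym (state-root e (K + suc h))))

      stable-far : ∀ {v} → reachRadius < dep t v → state (suc horizon) v ≡ state horizon v
      stable-far {v} lt =
        let j , y , a , j≤ , run = climb Λ 0 reachRadius v refl
              (λ j le → let u , a = depth-anc (proj₂ (depth t v)) j (≤-trans le (<⇒≤ lt)) in u , a , tt) ≤-refl
            j' , j'≤ , w , a' , st = anchor run
        in stable-below (anc-trans a a') (≤-trans (+-monoʳ-≤ j j'≤) j≤)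
             (λ h → trans (cong (λ k → state k w) (sym (+-suc K (suc h)))) (trans (st (suc h)) (sym (st h))))

    -- Within `horizon` the way up meets either the root or an anchor, and from there on the state
    -- no longer depends on how many ancestors are consulted. So a node and its parent, each using
    -- its own `horizon` ancestors, agree on the labelling.
    state-stable : ∀ v → state (suc horizon) v ≡ state horizon v
    state-stable v = [ stable-near , stable-far ]′ (≤-<-connex (dep t v) reachRadius)

    before-irrefl : ∀ {p c} → ¬ Before p c c
    before-irrefl (_ , ns , inj₁ s)  = ns s
    before-irrefl (_ , ns , inj₂ lt) = <-irrefl refl lt

    place-< : ∀ {p c c'} → Before p c c' → place p c' < place p c
    place-< {p} {c} {c'} b@(e' , ns , o) = unique-⊆-length (c' ∷ filter (before? p c') (allFin n)) _
        (all-≢ _ (λ i → before-irrefl (proj₂ (∈-filter⁻ (before? p c') {xs = allFin n} i))) ∷ unique-filter (before? p c') (unique-allFin n))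
        λ { (here refl) → ∈-filter⁺ (before? p c) (∈-allFin c') b
          ; (there i) → ∈-filter⁺ (before? p c) (∈-allFin _) (trans' (proj₂ (∈-filter⁻ (before? p c') {xs = allFin n} i))) }
      where
      trans' : ∀ {x} → Before p c' x → Before p c x
      trans' (ex , _   , inj₁ s)  = ex , ns , inj₁ s
      trans' (ex , ns' , inj₂ lt) = ex , ns , [ (λ s → ⊥-elim (ns' s)) , (λ lt' → inj₂ (<-trans lt lt')) ]′ o

    place-bound : ∀ {v f} → ChildEnum δ (parent t) v f → ∀ x → place v (f x) < δ
    place-bound {v} {f} (_ , par , all) x = subst (place v (f x) <_) (length-tabulate f)
      (unique-⊆-length (f x ∷ filter (before? v (f x)) (allFin n)) (tabulateL f)
        (all-≢ _ (λ i → before-irrefl (proj₂ (∈-filter⁻ (before? v (f x)) {xs = allFin n} i))) ∷ unique-filter (before? v (f x)) (unique-allFin n))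
        λ { (here refl) → ∈-tabulate⁺ x ; (there i) → mem (proj₂ (∈-filter⁻ (before? v (f x)) {xs = allFin n} i)) })
      where
      mem : ∀ {z} → Before v (f x) z → z ∈ tabulateL f
      mem {z} (e , _) = let k , eq = all z e in subst (_∈ tabulateL f) eq (∈-tabulate⁺ k)

    place-total : ∀ {p c c'} → parent t c ≡ just p → parent t c' ≡ just p → c ≢ c' → Before p c c' ⊎ Before p c' c
    place-total {p} {c} {c'} e e' ne with same? c p | same? c' p
    ... | yes s | yes s' = ⊥-elim (ne (same-unique e e' s s'))
    ... | yes s | no ns' = inj₂ (e , ns' , inj₁ s)
    ... | no ns | yes s' = inj₁ (e' , ns , inj₁ s')
    ... | no ns | no ns' with <-cmp (ident c) (ident c')
    ...   | tri< lt _ _ = inj₂ (e , ns' , inj₂ lt)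
    ...   | tri≈ _ q _  = ⊥-elim (ne (id-inj q))
    ...   | tri> _ _ gt = inj₁ (e' , ns , inj₂ gt)

    slot-inj : ∀ {r r'} → r < δ → r' < δ → slot r ≡ slot r' → r ≡ r'
    slot-inj {r} {r'} lt lt' e with r <? δ | r' <? δ
    ... | no nlt | _ = ⊥-elim (nlt lt)
    ... | yes _ | no nlt = ⊥-elim (nlt lt')
    ... | yes l | yes l' = trans (sym (toℕ-fromℕ< l)) (trans (cong toℕ e) (toℕ-fromℕ< l'))

    swapF-injective : ∀ (i j : Fin δ) {x y} → swapF i j x ≡ swapF i j y → x ≡ y
    swapF-injective i j {x} {y} e = trans (sym (swapF-invol i j x)) (trans (cong (swapF i j) e) (swapF-invol i j y))

    label : Fin n → Fin γ
    label v = proj₁ (state horizon v)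

    label-child : ∀ {v c} → parent t c ≡ just v → label c ≡ childLabel (state horizon v) v c
    label-child {v} {c} e = trans (cong proj₁ (sym (state-stable c))) (cong proj₁ (state-parent horizon e))

    -- Assigning slots to children is injective on `δ` elements, hence a permutation. Its inverse
    -- `κ` enumerates the children such that their labels spell out exactly the chosen vector.
    feasible : Feasible Π t label
    feasible v f ce@(f-inj , par , all) = (λ y → f (κ y)) ,
        ((λ {x} {y} q → trans (sym (ικ x)) (trans (cong ι (f-inj q)) (ικ y))) , (λ y → par (κ y)) ,
         λ w e → let x , eq = all w e in ι x , trans (cong f (ι-inj (ικ (ι x)))) eq) ,
        subst (λ z → (label v , z) ∈ C) (sym vec-eq) (choice-C _ _ (state-good horizon v))
      where
      s : Fin γ × Plan
      s = state horizon v
      vec : Vec (Fin γ) δ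
      vec = proj₁ (choice (proj₁ s) (proj₂ s))
      k : Fin δ
      k = proj₂ (choice (proj₁ s) (proj₂ s))
      ι : Fin δ → Fin δ
      ι x = swapF k₀ k (slot (place v (f x)))
      ι-inj : Injective _≡_ _≡_ ι
      ι-inj {x} {y} e = decidable-stable (x ≟F y) λ ne →
        [ (λ b → <⇒≢ (place-< b) (sym (same e))) , (λ b → <⇒≢ (place-< b) (same e)) ]′ (place-total (par x) (par y) (λ q → ne (f-inj q)))
        where
        same : ∀ {x y} → ι x ≡ ι y → place v (f x) ≡ place v (f y)
        same {x} {y} e = slot-inj (place-bound ce x) (place-bound ce y) (swapF-injective k₀ k e)
      κ : Fin δ → Fin δ
      κ y = proj₁ (injective⇒surjective ι ι-inj y)
      ικ : ∀ y → ι (κ y) ≡ y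
      ικ y = proj₂ (injective⇒surjective ι ι-inj y)
      vec-eq : tabulate (λ y → label (f (κ y))) ≡ vec
      vec-eq = trans (tabulate-cong (λ y → trans (label-child (par (κ y))) (cong (lookup vec) (ικ y)))) (tabulate∘lookup vec)

-- Locality

infix 1 _⟺_
_⟺_ : Set → Set → Set
A ⟺ B = (A → B) × (B → A)

¬-⟺ : ∀ {A B} → A ⟺ B → ¬ A ⟺ ¬ B
¬-⟺ (f , g) = (λ na b → na (g b)) , (λ nb a → nb (f a))

×-⟺ : ∀ {A B C D} → A ⟺ B → C ⟺ D → A × C ⟺ B × D
×-⟺ (f , g) (h , k) = (λ { (a , c) → f a , h c }) , (λ { (b , d) → g b , k d })

unique-map : ∀ {A B : Set} (f : A → B) (xs : List A) → Unique xs → (∀ {x y} → x ∈ xs → y ∈ xs → f x ≡ f y → x ≡ y) → Unique (mapL f xs)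
unique-map f []       u         inj = []
unique-map f (x ∷ xs) (x∉ ∷ u) inj =
  all-≢ (mapL f xs) (λ i → let y , y∈ , e = ∈-map⁻ f i in All-∈ x∉ y∈ (inj (here refl) (there y∈) e)) ∷
  unique-map f xs u (λ i j → inj (there i) (there j))

filter-length : ∀ {n} {P Q : Fin n → Set} (P? : ∀ x → Dec (P x)) (Q? : ∀ x → Dec (Q x)) (f : Fin n → Fin n) →
  (∀ x → P x → Q (f x)) → (∀ {x y} → P x → P y → f x ≡ f y → x ≡ y) →
  length (filter P? (allFin n)) ≤ length (filter Q? (allFin n))
filter-length {n} P? Q? f PQ inj = subst (_≤ length (filter Q? (allFin n))) (length-map f (filter P? (allFin n)))
  (unique-⊆-length (mapL f (filter P? (allFin n))) _
    (unique-map f _ (unique-filter P? (unique-allFin n)) (λ i j → inj (holds i) (holds j)))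
    λ i → let x , x∈ , e = ∈-map⁻ f i in subst (_∈ filter Q? (allFin n)) (sym e) (∈-filter⁺ Q? (∈-allFin (f x)) (PQ x (holds x∈))))
  where
  holds : ∀ {x} → x ∈ filter P? (allFin n) → _
  holds i = proj₂ (∈-filter⁻ P? {xs = allFin n} i)

-- Per level: `m` generations up to the top of a window, `m` down to verify it, one more to the
-- children of a possible branching, and there the radius for being alive at the previous level.
levelRadius : ℕ → ℕ → ℕ
levelRadius m zero    = 0
levelRadius m (suc i) = m + (m + suc (levelRadius m i))

levelRadius-mono : ∀ m {i j} → i ≤ j → levelRadius m i ≤ levelRadius m j
levelRadius-mono m z≤n      = z≤n
levelRadius-mono m (s≤s le) = +-monoʳ-≤ m (+-monoʳ-≤ m (s≤s (levelRadius-mono m le)))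

-- Invariance of levels and runs under isomorphisms of views

module Iso {δ n : ℕ} {t t' : RTree δ n} {S S' : Fin n → Set} (I : SubIso t t' S S') where
  open SubIso I

  -- At the border of `S` an isomorphism of views says nothing about missing parents or children.
  -- Both balls are required inside, so that neighbours can be carried over in either direction.
  Core : ℕ → Fin n → Set
  Core r u = (∀ w → Dist≤ t r u w → S w) × (∀ w → Dist≤ t' r (φ u) w → S' w)

  core-mono : ∀ {r r' u} → r ≤ r' → Core r' u → Core r u
  core-mono le (a , b) = (λ w d → a w (dist-mono le d)) , (λ w d → b w (dist-mono le d))

  core-S : ∀ {r u} → Core r u → S u
  core-S (a , _) = a _ stay

  core-adj : ∀ {r u w} → Core (suc r) u → Adj t u w → Core r w
  core-adj {r} {u} {w} (a , b) ad = (λ x d → a x (move ad d)) , (λ x d → b x (move (adj' ad) d))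
    where
    su : S u
    su = a u stay
    sw : S w
    sw = a w (move ad stay)
    adj' : Adj t u w → Adj t' (φ u) (φ w)
    adj' (inj₁ e) = inj₁ (par→ u w su sw e)
    adj' (inj₂ e) = inj₂ (par→ w u sw su e)

  φ-inj : ∀ {u w} → S u → S w → φ u ≡ φ w → u ≡ w
  φ-inj su sw e = trans (sym (ψφ _ su)) (trans (cong ψ e) (ψφ _ sw))

  parent-φ : ∀ {r u p} → Core (suc r) u → parent t u ≡ just p → parent t' (φ u) ≡ just (φ p)
  parent-φ c e = par→ _ _ (core-S c) (proj₁ c _ (move (inj₁ e) stay)) e

  parent-φ⁻ : ∀ {r u q} → Core (suc r) u → parent t' (φ u) ≡ just q → ∃ λ p → parent t u ≡ just p × φ p ≡ q
  parent-φ⁻ {r} {u} {q} c e = ψ q , par← u (ψ q) (core-S c) (ψ∈ q sq) (trans e (cong just (sym (φψ q sq)))) , φψ q sq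
    where
    sq : S' q
    sq = proj₂ c q (move (inj₁ e) stay)

  parent-map : ∀ {r u} → Core (suc r) u → parent t' (φ u) ≡ mapM φ (parent t u)
  parent-map {r} {u} c with parent t u in e
  ... | just p = parent-φ c e
  ... | nothing with parent t' (φ u) in e'
  ...   | nothing = refl
  ...   | just q  = ⊥-elim (just≢nothing (proj₁ (proj₂ (parent-φ⁻ c e'))) e)

  kid-φ : ∀ {r u c} → Core (suc r) u → parent t c ≡ just u → parent t' (φ c) ≡ just (φ u)
  kid-φ co e = par→ _ _ (proj₁ co _ (move (inj₂ e) stay)) (core-S co) e

  kid-φ⁻ : ∀ {r u c'} → Core (suc r) u → parent t' c' ≡ just (φ u) → ∃ λ c → parent t c ≡ just u × φ c ≡ c'
  kid-φ⁻ {r} {u} {c'} co e = ψ c' , par← (ψ c') u (ψ∈ c' sc) (core-S co) (trans (cong (parent t') (φψ c' sc)) e) , φψ c' sc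
    where
    sc : S' c'
    sc = proj₂ co c' (move (inj₂ e) stay)

  ancestor-map : ∀ j {u} → Core j u → ancestor (parent t') j (φ u) ≡ mapM φ (ancestor (parent t) j u)
  ancestor-map zero    c = refl
  ancestor-map (suc j) {u} c = trans (ancestor-suc j (φ u)) (trans (cong (_>>= ancestor (parent t') j) (parent-map c))
      (trans (go (parent t u) refl) (cong (mapM φ) (sym (ancestor-suc j u)))))
    where
    go : ∀ mp → parent t u ≡ mp → (mapM φ mp >>= ancestor (parent t') j) ≡ mapM φ (mp >>= ancestor (parent t) j)
    go nothing  e = refl
    go (just p) e = ancestor-map j (core-adj c (inj₁ e))

  module _ (m : ℕ) where
    private
      module L = Levels {δ} {n} m t
      module L' = Levels {δ} {n} m t'

    module _ {P P' : Fin n → Set} (r : ℕ) (hP : ∀ {u} → Core r u → P u ⟺ P' (φ u)) where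
      private
        module A = L.Alive P
        module A' = L'.Alive P'

      branch-φ : ∀ {u} → Core (suc r) u → A.Branch u ⟺ A'.Branch (φ u)
      branch-φ {u} co = (λ { (c , c' , ne , e , e' , p , p') →
          φ c , φ c' , (λ q → ne (φ-inj (core-S (core-adj co (inj₂ e))) (core-S (core-adj co (inj₂ e'))) q)) ,
          kid-φ co e , kid-φ co e' , proj₁ (hP (core-adj co (inj₂ e))) p , proj₁ (hP (core-adj co (inj₂ e'))) p' }) , back
        where
        back : A'.Branch (φ u) → A.Branch u
        back (d , d' , ne , f , f' , p , p') with kid-φ⁻ co f | kid-φ⁻ co f'
        ... | c , e , refl | c' , e' , refl = c , c' , (λ q → ne (cong φ q)) , e , e' ,
              proj₂ (hP (core-adj co (inj₂ e))) p , proj₂ (hP (core-adj co (inj₂ e'))) p'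

      unary-φ : ∀ k {u} → Core (k + suc r) u → A.Unary k u ⟺ A'.Unary k (φ u)
      unary-φ zero    co = ¬-⟺ (branch-φ co)
      unary-φ (suc k) {u} co = ×-⟺ (¬-⟺ (branch-φ (core-mono (≤-trans (m≤n+m (suc r) k) (n≤1+n _)) co))) (fwd , bwd)
        where
        deeper : ∀ {c} → parent t c ≡ just u → Core (k + suc r) c
        deeper e = core-adj co (inj₂ e)
        shallow : ∀ {c} → parent t c ≡ just u → Core r c
        shallow e = core-mono (≤-trans (n≤1+n r) (m≤n+m (suc r) k)) (deeper e)
        fwd : (∀ c → parent t c ≡ just u → P c → A.Unary k c) → ∀ c' → parent t' c' ≡ just (φ u) → P' c' → A'.Unary k c'
        fwd f c' e' p' with kid-φ⁻ co e'
        ... | c , e , refl = proj₁ (unary-φ k (deeper e)) (f c e (proj₂ (hP (shallow e)) p'))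
        bwd : (∀ c' → parent t' c' ≡ just (φ u) → P' c' → A'.Unary k c') → ∀ c → parent t c ≡ just u → P c → A.Unary k c
        bwd f c e p = proj₂ (unary-φ k (deeper e)) (f (φ c) (kid-φ co e) (proj₁ (hP (shallow e)) p))

      below-φ : ∀ j {u} → Core (j + (m + suc r)) u → A.Below j u ⟺ A'.Below j (φ u)
      below-φ zero    co = unary-φ m co
      below-φ (suc j) {u} co = fwd , bwd
        where
        here' : Core (m + suc r) u
        here' = core-mono (≤-trans (m≤n+m _ j) (n≤1+n _)) co
        above : ∀ {p} → parent t u ≡ just p → Core (j + (m + suc r)) p
        above e = core-adj co (inj₁ e)
        small : ∀ {p} → parent t u ≡ just p → Core r p
        small e = core-mono (≤-trans (n≤1+n r) (≤-trans (m≤n+m (suc r) m) (m≤n+m _ j))) (above e)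
        fwd : A.Below (suc j) u → A'.Below (suc j) (φ u)
        fwd (inj₁ x) = inj₁ (proj₁ (unary-φ m here') x)
        fwd (inj₂ (p , e , pp , x)) = inj₂ (φ p , parent-φ co e , proj₁ (hP (small e)) pp , proj₁ (below-φ j (above e)) x)
        bwd : A'.Below (suc j) (φ u) → A.Below (suc j) u
        bwd (inj₁ x) = inj₁ (proj₂ (unary-φ m here') x)
        bwd (inj₂ (q , e' , pp , x)) with parent-φ⁻ co e'
        ... | p , e , refl = inj₂ (p , e , proj₂ (hP (small e)) pp , proj₂ (below-φ j (above e)) x)

    grows : ∀ i → levelRadius m i ≤ levelRadius m (suc i)
    grows i = levelRadius-mono m (n≤1+n i)

    U-φ : ∀ i {u} → Core (levelRadius m i) u → L.U i u ⟺ L'.U i (φ u)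
    U-φ zero    co = (λ _ → tt) , (λ _ → tt)
    U-φ (suc i) co = ×-⟺ (U-φ i (core-mono (grows i) co)) (¬-⟺ (below-φ (levelRadius m i) (U-φ i) m co))

    level-φ : ∀ i {u} → Core (levelRadius m (suc i)) u → L.Level i u ⟺ L'.Level i (φ u)
    level-φ i co = ×-⟺ (U-φ i (core-mono (grows i) co)) (below-φ (levelRadius m i) (U-φ i) m co)

    module _ (Λ : ℕ) (n<2^Λ : n < 2 ^ Λ) where
      private
        module R = L.Runs Λ n<2^Λ
        module R' = L'.Runs Λ n<2^Λ

      same-φ : ∀ {u p} → Core (levelRadius m Λ) u → Core (levelRadius m Λ) p → R.Same u p ⟺ R'.Same (φ u) (φ p)
      same-φ cu cp = (λ { (i , a , b) → i , proj₁ (lv i cu) a , proj₁ (lv i cp) b }) , (λ { (i , a , b) → i , proj₂ (lv i cu) a , proj₂ (lv i cp) b })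
        where
        lv : ∀ (i : Fin Λ) {u} → Core (levelRadius m Λ) u → L.Level (toℕ i) u ⟺ L'.Level (toℕ i) (φ u)
        lv i c = level-φ (toℕ i) (core-mono (levelRadius-mono m (toℕ<n i)) c)

      run-φ : ∀ k {y} → Core (k + levelRadius m Λ) y → R.Run k y ⟺ R'.Run k (φ y)
      run-φ zero    co = (λ _ → tt) , (λ _ → tt)
      run-φ (suc k) {y} co = fwd , bwd
        where
        low : ∀ {x} → Core (k + levelRadius m Λ) x → Core (levelRadius m Λ) x
        low = core-mono (m≤n+m _ k)
        sm : ∀ {p} → parent t y ≡ just p → R.Same y p ⟺ R'.Same (φ y) (φ p)
        sm e = same-φ (low (core-mono (n≤1+n _) co)) (low (core-adj co (inj₁ e)))
        fwd : R.Run (suc k) y → R'.Run (suc k) (φ y)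
        fwd (p , e , s , r) = φ p , parent-φ co e , proj₁ (sm e) s , proj₁ (run-φ k (core-adj co (inj₁ e))) r
        bwd : R'.Run (suc k) (φ y) → R.Run (suc k) y
        bwd (q , e' , s , r) with parent-φ⁻ co e'
        ... | p , e , refl = p , e , proj₂ (sm e) s , proj₂ (run-φ k (core-adj co (inj₁ e))) r

-- How the identifiers near v must correspond: literally on ancestors, in relative order on their siblings.
record IdMatch {δ n : ℕ} (t : RTree δ n) (φ : Fin n → Fin n) (id id' : Fin n → ℕ) (J : ℕ) (v : Fin n) : Set where
  field
    anc-id : ∀ {j u} → j ≤ J → Anc (parent t) j v u → id' (φ u) ≡ id u
    sib-id : ∀ {j c p c'} → j ≤ J → Anc (parent t) j v c → parent t c ≡ just p → parent t c' ≡ just p →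
             id c' < id c ⟺ id' (φ c') < id' (φ c)

open IdMatch

match-up : ∀ {δ n} {t : RTree δ n} {φ id id' J v p} → parent t v ≡ just p → IdMatch t φ id id' (suc J) v → IdMatch t φ id id' J p
match-up e M = record { anc-id = λ le a → anc-id M (s≤s le) (up e a) ; sib-id = λ le a → sib-id M (s≤s le) (up e a) }

match-mono : ∀ {δ n} {t : RTree δ n} {φ id id' J J' v} → J ≤ J' → IdMatch t φ id id' J' v → IdMatch t φ id id' J v
match-mono le M = record { anc-id = λ l a → anc-id M (≤-trans l le) a ; sib-id = λ l a → sib-id M (≤-trans l le) a }

-- Invariance of the labels

module StateLocal (Π : LCL) (cert : Labels.Cert Π) (B m Λ : ℕ) (m≥ : window B (Labels.Cert.K cert) ≤ m) {n : ℕ} (n<2^Λ : n < 2 ^ Λ)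
  {t t' : RTree (LCL.δ Π) n} {S S' : Fin n → Set} (I : SubIso t t' S S') (id id' : Fin n → ℕ) where
  open LCL Π
  open Labels Π
  open Cert cert using (K; plan)
  open SubIso I
  open Iso I
  private
    module A = Alg Π cert B m Λ m≥ n<2^Λ t id
    module A' = Alg Π cert B m Λ m≥ n<2^Λ t' id'

  -- `Top` compares colours up to `2 K` generations up, and each of these reads `K` more. The rest
  -- covers the levels of siblings, which are two steps away.
  viewRadius : ℕ
  viewRadius = K + K + K + suc (suc (levelRadius m Λ))

  private
    Match : ℕ → Fin n → Set
    Match = IdMatch t φ id id'

    core-anc : ∀ {j r v u} → Core (j + r) v → Anc (parent t) j v u → Core r u
    core-anc c self     = c
    core-anc c (up e a) = core-anc (core-adj c (inj₁ e)) a

    match-anc : ∀ {j r v u} → Match (j + r) v → Anc (parent t) j v u → Match r u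
    match-anc M self     = M
    match-anc M (up e a) = match-anc (match-up e M) a

  cvA-φ : ∀ j {v} → Core j v → Match j v → A'.cvA j (φ v) ≡ A.cvA j v
  cvA-φ j {v} c M rewrite ancestor-map j c with ancestor (parent t) j v in e
  ... | nothing = refl
  ... | just u  = cong₂ (cv B) (anc-id M z≤n self) (anc-id M ≤-refl (ancestor-anc j e))

  partCol-φ : ∀ j {v} → Core j v → Match j v → A'.partCol j (φ v) ≡ A.partCol j v
  partCol-φ zero    c M = refl
  partCol-φ (suc j) c M = cong₂ (λ x y → x + suc (2 * B) * y) (cvA-φ (suc j) c M)
    (partCol-φ j (core-mono (n≤1+n j) c) (match-mono (n≤1+n j) M))

  colA-φ : ∀ j {v} → Core (j + K) v → Match (j + K) v → A'.colA j (φ v) ≡ A.colA j v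
  colA-φ j {v} c M rewrite ancestor-map j (core-mono (m≤m+n j K) c) with ancestor (parent t) j v in e
  ... | nothing = refl
  ... | just u  = partCol-φ K (core-anc c (ancestor-anc j e)) (match-anc M (ancestor-anc j e))

  top-φ : ∀ {v} → Core viewRadius v → Match (K + K + K) v → A.Top v ⟺ A'.Top (φ v)
  top-φ {v} c M = ×-⟺ (run-φ m Λ n<2^Λ (K + K) (core-mono run≤ c))
      ((λ f x ne → subst₂ _<_ (sym (cA K (m≤m+n K K))) (sym (cA (toℕ x) (x≤ x))) (f x ne)) ,
       (λ f x ne → subst₂ _<_ (cA K (m≤m+n K K)) (cA (toℕ x) (x≤ x)) (f x ne)))
    where
    run≤ : K + K + levelRadius m Λ ≤ viewRadius
    run≤ = +-mono-≤ (m≤m+n (K + K) K) (≤-trans (n≤1+n _) (n≤1+n _))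
    x≤ : (x : Fin (suc (K + K))) → toℕ x ≤ K + K
    x≤ x = ≤-pred (toℕ<n x)
    cA : ∀ j → j ≤ K + K → A'.colA j (φ v) ≡ A.colA j v
    cA j le = colA-φ j (core-mono (≤-trans (+-monoˡ-≤ K le) (m≤m+n (K + K + K) _)) c) (match-mono (+-monoˡ-≤ K le) M)

  private
    sib-core : ∀ {p c} → Core (suc (levelRadius m Λ)) p → parent t c ≡ just p → Core (levelRadius m Λ) c
    sib-core cp e = core-adj cp (inj₂ e)

  same-kid : ∀ {p c} → Core (suc (levelRadius m Λ)) p → parent t c ≡ just p → A.Same c p ⟺ A'.Same (φ c) (φ p)
  same-kid cp e = same-φ m Λ n<2^Λ (sib-core cp e) (core-mono (n≤1+n _) cp)

  before-φ : ∀ {p c c'} → Core (suc (levelRadius m Λ)) p → parent t c ≡ just p → parent t c' ≡ just p →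
             (id c' < id c ⟺ id' (φ c') < id' (φ c)) → A.Before p c c' ⟺ A'.Before (φ p) (φ c) (φ c')
  before-φ cp e e' o =
    (λ { (_ , ns , x) → kid-φ cp e' , proj₁ (¬-⟺ (same-kid cp e)) ns , [ (λ s → inj₁ (proj₁ (same-kid cp e') s)) , (λ l → inj₂ (proj₁ o l)) ]′ x }) ,
    (λ { (_ , ns , x) → e' , proj₂ (¬-⟺ (same-kid cp e)) ns , [ (λ s → inj₁ (proj₂ (same-kid cp e') s)) , (λ l → inj₂ (proj₂ o l)) ]′ x })

  place-φ : ∀ {p c} → Core (suc (levelRadius m Λ)) p → parent t c ≡ just p →
            (∀ {c'} → parent t c' ≡ just p → id c' < id c ⟺ id' (φ c') < id' (φ c)) → A'.place (φ p) (φ c) ≡ A.place p c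
  place-φ {p} {c} cp e o = ≤-antisym
    (filter-length (A'.before? (φ p) (φ c)) (A.before? p c) ψ there' inj')
    (filter-length (A.before? p c) (A'.before? (φ p) (φ c)) φ (λ x b → proj₁ (before-φ cp e (proj₁ b) (o (proj₁ b))) b)
      (λ b b' → φ-inj (core-S (sib-core cp (proj₁ b))) (core-S (sib-core cp (proj₁ b')))))
    where
    there' : ∀ x → A'.Before (φ p) (φ c) x → A.Before p c (ψ x)
    there' x b with kid-φ⁻ cp (proj₁ b)
    ... | c' , e' , refl = subst (A.Before p c) (sym (ψφ c' (core-S (sib-core cp e')))) (proj₂ (before-φ cp e e' (o e')) b)
    inj' : ∀ {x y} → A'.Before (φ p) (φ c) x → A'.Before (φ p) (φ c) y → ψ x ≡ ψ y → x ≡ y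
    inj' {x} {y} b b' q = trans (sym (φψ x (proj₂ cp x (move (inj₂ (proj₁ b)) stay))))
      (trans (cong φ q) (φψ y (proj₂ cp y (move (inj₂ (proj₁ b')) stay))))

  pick-φ : ∀ {X Y X' Y' : Set} → X ⟺ X' → Y ⟺ Y' → (d : Dec X) (e : Dec Y) (d' : Dec X') (e' : Dec Y') → ∀ {f g} →
           A'.pickPlan d' e' f g ≡ A.pickPlan d e f g
  pick-φ (a , b) _ (yes x) e (yes x') e' = refl
  pick-φ (a , b) _ (yes x) e (no nx) e' = ⊥-elim (nx (a x))
  pick-φ (a , b) _ (no nx) e (yes x') e' = ⊥-elim (nx (b x'))
  pick-φ _ (a , b) (no _) (yes y) (no _) (yes y') = refl
  pick-φ _ (a , b) (no _) (yes y) (no _) (no ny) = ⊥-elim (ny (a y))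
  pick-φ _ (a , b) (no _) (no ny) (no _) (yes y') = ⊥-elim (ny (b y'))
  pick-φ _ (a , b) (no _) (no ny) (no _) (no ny') = refl

  slot-eq : ∀ r → A'.slot r ≡ A.slot r
  slot-eq r with r <? δ
  ... | yes _ = refl
  ... | no _  = refl

  childLabel-φ : ∀ s p c → A'.place (φ p) (φ c) ≡ A.place p c → A'.childLabel s (φ p) (φ c) ≡ A.childLabel s p c
  childLabel-φ (a , [])     p c e = cong (λ r → lookup (Cert.any cert a) (swapF A.k₀ A.k₀ r)) (trans (slot-eq _) (cong A.slot e))
  childLabel-φ (a , (v , k) ∷ ps) p c e = cong (λ r → lookup v (swapF A.k₀ k r)) (trans (slot-eq _) (cong A.slot e))

  next-φ : ∀ s {p c} → Core (suc (levelRadius m Λ)) p → Core viewRadius c → Match (K + K + K) c → parent t c ≡ just p →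
           A'.next s (φ p) (φ c) ≡ A.next s p c
  next-φ s {p} {c} cp cc M e = cong₂ _,_ lab≡ (trans
      (cong (λ b → A'.pickPlan (A'.top? (φ c)) (A'.same? (φ c) (φ p)) (plan b) (drop 1 (proj₂ s))) lab≡)
      (pick-φ (top-φ cc M) (same-kid cp e) (A.top? c) (A.same? c p) (A'.top? (φ c)) (A'.same? (φ c) (φ p))))
    where
    lab≡ : A'.childLabel s (φ p) (φ c) ≡ A.childLabel s p c
    lab≡ = childLabel-φ s p c (place-φ cp e (λ e' → sib-id M z≤n self e e'))

  state-φ : ∀ h {v} → Core (h + viewRadius) v → Match (h + (K + K + K)) v → A'.state h (φ v) ≡ A.state h v
  state-φ zero    c M = refl
  state-φ (suc h) {v} c M rewrite parent-map c with parent t v in e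
  ... | nothing = refl
  ... | just p = trans (cong (λ s → A'.next s (φ p) (φ v)) (state-φ h cp (match-up e M)))
      (next-φ (A.state h p) (core-mono (≤-trans (≤-trans (n≤1+n _) (m≤n+m _ (K + K + K))) (m≤n+m viewRadius h)) cp)
        (core-mono (≤-trans (m≤n+m viewRadius h) (n≤1+n _)) c) (match-mono (≤-trans (m≤n+m _ h) (n≤1+n _)) M) e)
    where
    cp : Core (h + viewRadius) p
    cp = core-adj c (inj₁ e)

-- Algorithms from certificates

least : ∀ {N} {P : Fin N → Set} → (∀ x → Dec (P x)) → ∃ P → ∃ λ x → P x × (∀ y → toℕ y < toℕ x → ¬ P y)
least {suc N} P? (x , px) with P? zero
... | yes p = zero , p , λ _ ()
... | no np with x
...   | zero  = ⊥-elim (np px)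
...   | suc x' = let y , py , min = least (λ z → P? (suc z)) (x' , px) in
        suc y , py , λ { zero _ → np ; (suc z) (s≤s lt) → min z lt }

horizonOf viewOf localityOf : (K B Λ : ℕ) → ℕ
horizonOf  K B Λ = Λ * (window B K + window B K) + suc K
viewOf     K B Λ = K + K + K + suc (suc (levelRadius (window B K) Λ))
localityOf K B Λ = horizonOf K B Λ + viewOf K B Λ

sightOf : (K B Λ : ℕ) → ℕ
sightOf K B Λ = horizonOf K B Λ + (K + K + K)

-- A sibling of an ancestor is two steps further away than the ancestor itself and must be visible
-- as well.
sight-room : ∀ K B Λ → 2 + sightOf K B Λ ≤ localityOf K B Λ
sight-room K B Λ = ≤-trans (≤-reflexive (eq (horizonOf K B Λ) (K + K + K))) (+-monoʳ-≤ (horizonOf K B Λ) (+-monoʳ-≤ (K + K + K) (s≤s (s≤s z≤n))))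
  where
  eq : ∀ h k → 2 + (h + k) ≡ h + (k + 2)
  eq = solve-∀

module Upper (Π : LCL) (cert : Labels.Cert Π) (B Λ : ℕ) {n : ℕ} (n<2^Λ : n < 2 ^ Λ) where
  open LCL Π
  open Labels Π
  open Cert cert using (K)

  private
    T J : ℕ
    T = localityOf K B Λ
    J = sightOf K B Λ

    sight≤ : ∀ {j} → j ≤ J → j ≤ T
    sight≤ le = ≤-trans le (≤-trans (n≤1+n J) (≤-trans (n≤1+n (suc J)) (sight-room K B Λ)))

    sib≤ : ∀ {j} → j ≤ J → j + 2 ≤ T
    sib≤ {j} le = ≤-trans (≤-reflexive (+-comm j 2)) (≤-trans (s≤s (s≤s le)) (sight-room K B Λ))

  output : RTree δ n → (Fin n → ℕ) → Fin n → Fin γ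
  output t ident v = proj₁ (Alg.state Π cert B (window B K) Λ ≤-refl n<2^Λ t ident (horizonOf K B Λ) v)

  output-feasible : ∀ t ident → Injective _≡_ _≡_ ident → (∀ v → ident v < 2 ^ B) → Feasible Π t (output t ident)
  output-feasible t ident inj bound = Alg.feasible Π cert B (window B K) Λ ≤-refl n<2^Λ t ident inj bound

  sibling : ∀ {t : RTree δ n} {j v c p c'} → Anc (parent t) j v c → parent t c ≡ just p → parent t c' ≡ just p → Dist≤ t (j + 2) v c'
  sibling {t} a e e' = dist-trans (dist-anc {t = t} a) (move (inj₁ e) (move (inj₂ e') stay))

  output-local : ∀ {t t' S S'} (I : SubIso t t' S S') id id' v → Iso.Core I T v →
                 IdMatch t (SubIso.φ I) id id' J v → output t id v ≡ output t' id' (SubIso.φ I v)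
  output-local I id id' v c M = cong proj₁ (sym (StateLocal.state-φ Π cert B (window B K) Λ ≤-refl n<2^Λ I id id' (horizonOf K B Λ) c M))

  local-solvable : ∀ c → n ^ c < 2 ^ B → LOCALSolvable c Π n T
  local-solvable c small = (output , local) , λ t id valid →
      output-feasible t id (proj₁ valid) (λ v → ≤-<-trans (proj₂ (proj₂ valid v)) small)
    where
    local : ∀ t t' id id' v v' → ValidIds n c id → ValidIds n c id' → (I : SubIso t t' (Ball t T v) (Ball t' T v')) →
            SubIso.φ I v ≡ v' → (∀ u → Ball t T v u → id' (SubIso.φ I u) ≡ id u) → output t id v ≡ output t' id' v'
    local t t' id id' v v' _ _ I eq same = trans (output-local I id id' v ((λ w d → d) , (λ w → subst (λ x → Dist≤ t' T x w) eq)) record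
      { anc-id = λ le a → same _ (dist-mono (sight≤ le) (dist-anc {t = t} a))
      ; sib-id = λ {j} {x} {p} {x'} le a e e' →
          let sx  = same x (dist-mono (sight≤ le) (dist-anc {t = t} a))
              sx' = same x' (dist-mono (sib≤ le) (sibling {t} a e e'))
          in subst₂ _<_ (sym sx') (sym sx) , subst₂ _<_ sx' sx }) (cong (output t' id') eq)

  -- In the online model a node is named by the first processed node of which it is a near ancestor.
  module _ (t : RTree δ n) (σ : Fin n → Fin n) where

    -- `combine` sorts codes by processing time first, so the least code of a node is settled when
    -- the first node having it as a near ancestor is processed.
    Code : Fin n → Fin (n * suc J) → Set
    Code u x = ancestor (parent t) (toℕ (proj₂ (remQuot {n} (suc J) x))) (σ (proj₁ (remQuot {n} (suc J) x))) ≡ just u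

    code? : ∀ u x → Dec (Code u x)
    code? u x = maybe-≡-dec _≟F_ _ (just u)

    nameBy : ∀ {u} → Dec (∃ (Code u)) → ℕ
    nameBy {u} (yes ex) = toℕ (proj₁ (least (code? u) ex))
    nameBy (no _)       = 0

    abstract
      name : Fin n → ℕ
      name u = nameBy (any? (code? u))

      name-spec : ∀ {u} → ∃ (Code u) → ∃ λ x → name u ≡ toℕ x × Code u x × (∀ y → Code u y → toℕ x ≤ toℕ y)
      name-spec {u} ex = go (any? (code? u))
        where
        go : (d : Dec (∃ (Code u))) → ∃ λ x → nameBy d ≡ toℕ x × Code u x × (∀ y → Code u y → toℕ x ≤ toℕ y)
        go (no none) = ⊥-elim (none ex)
        go (yes ex') = let x , cx , min = least (code? u) ex' in x , refl , cx , λ y cy → ≮⇒≥ (λ lt → min y lt cy)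

    code-combine : ∀ i (a : Fin (suc J)) {u} → ancestor (parent t) (toℕ a) (σ i) ≡ just u → Code u (combine i a)
    code-combine i a {u} e = trans (cong (λ ja → ancestor (parent t) (toℕ (proj₂ ja)) (σ (proj₁ ja))) (remQuot-combine i a)) e

    coded : Injective _≡_ _≡_ σ → ∀ u → ∃ (Code u)
    coded inj u = let i , e = injective⇒surjective σ inj u in combine i zero , code-combine i zero (cong just e)

    name-inj : Injective _≡_ _≡_ σ → Injective _≡_ _≡_ name
    name-inj inj {u} {v} e with name-spec (coded inj u) | name-spec (coded inj v)
    ... | x , ex , cx , _ | y , ey , cy , _ with toℕ-injective {i = x} {j = y} (trans (sym ex) (trans e ey))
    ...   | refl = just-unique cx cy

    name< : Injective _≡_ _≡_ σ → ∀ u → name u < n * suc J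
    name< inj u = let x , ex , _ = name-spec (coded inj u) in subst (_< n * suc J) (sym ex) (toℕ<n x)

  online-solvable : n * suc J ≤ 2 ^ B → OnlineSolvable Π n T
  online-solvable small = ((λ t σ i → output t (name t σ) (σ i)) , online) , λ t σ inj L eq v f ce →
      let g , ce' , c = output-feasible t (name t σ) (name-inj t σ inj) (λ u → <-≤-trans (name< t σ inj u) small) v f ce
      in g , ce' , subst (_∈ C) (cong₂ _,_ (sym (lab t σ inj L eq v)) (tabulate-cong (λ k → sym (lab t σ inj L eq (g k))))) c
    where
    lab : ∀ t σ → Injective _≡_ _≡_ σ → (L : Fin n → Fin γ) → (∀ i → L (σ i) ≡ output t (name t σ) (σ i)) → ∀ v → L v ≡ output t (name t σ) v
    lab t σ inj L eq v with injective⇒surjective σ inj v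
    ... | i , refl = eq i
    online : ∀ t t' σ σ' i → Injective _≡_ _≡_ σ → Injective _≡_ _≡_ σ' →
             (I : SubIso t t' (Revealed t T σ i) (Revealed t' T σ' i)) → (∀ j → toℕ j ≤ toℕ i → SubIso.φ I (σ j) ≡ σ' j) →
             output t (name t σ) (σ i) ≡ output t' (name t' σ') (σ' i)
    online t t' σ σ' i inj inj' I fix = trans (output-local I (name t σ) (name t' σ') (σ i) (core i ≤-refl) record { anc-id = anc ; sib-id = sib })
        (cong (output t' (name t' σ')) (fix i ≤-refl))
      where
      open SubIso I
      open Iso I
      core : ∀ j → toℕ j ≤ toℕ i → Core T (σ j)
      core j le = (λ w d → j , le , d) , (λ w d → j , le , subst (λ x → Dist≤ t' T x w) (fix j le) d)
      quot : Fin (n * suc J) → Fin n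
      quot x = proj₁ (remQuot {n} (suc J) x)
      rem : Fin (n * suc J) → Fin (suc J)
      rem x = proj₂ (remQuot {n} (suc J) x)
      anc-map : ∀ x → toℕ (quot x) ≤ toℕ i →
        ancestor (parent t') (toℕ (rem x)) (σ' (quot x)) ≡ mapM φ (ancestor (parent t) (toℕ (rem x)) (σ (quot x)))
      anc-map x le = trans (cong (ancestor (parent t') (toℕ (rem x))) (sym (fix (quot x) le)))
        (ancestor-map (toℕ (rem x)) (core-mono (sight≤ (≤-pred (toℕ<n (rem x)))) (core (quot x) le)))
      code→ : ∀ {u} x → toℕ (quot x) ≤ toℕ i → Code t σ u x → Code t' σ' (φ u) x
      code→ x le e = trans (anc-map x le) (cong (mapM φ) e)
      code← : ∀ {u} x → Revealed t T σ i u → toℕ (quot x) ≤ toℕ i → Code t' σ' (φ u) x → Code t σ u x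
      code← {u} x su le e with ancestor (parent t) (toℕ (rem x)) (σ (quot x)) in eq | trans (sym (anc-map x le)) e
      ... | just w | e' = cong just (φ-inj sw su (just-injective e'))
        where
        sw : Revealed t T σ i w
        sw = quot x , le , dist-mono (sight≤ (≤-pred (toℕ<n (rem x)))) (dist-anc {t = t} (ancestor-anc (toℕ (rem x)) eq))
      early : ∀ x (a : Fin (suc J)) → toℕ x ≤ toℕ (combine i a) → toℕ (quot x) ≤ toℕ i
      early x a le = ≮⇒≥ λ lt → <⇒≱ (subst (toℕ (combine i a) <_) (cong toℕ (combine-remQuot {n} (suc J) x)) (combine-monoˡ-< a (rem x) lt)) le
      near : ∀ {j u} → j ≤ J → Anc (parent t) j (σ i) u → ∃ λ (a : Fin (suc J)) → Code t σ u (combine i a)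
      near {j} {u} le a = fromℕ< (s≤s le) , code-combine t σ i (fromℕ< (s≤s le))
        (trans (cong (λ k → ancestor (parent t) k (σ i)) (toℕ-fromℕ< (s≤s le))) (anc-ancestor a))
      shown : ∀ {j u} → j ≤ T → Dist≤ t j (σ i) u → Revealed t T σ i u
      shown le d = i , ≤-refl , dist-mono le d
      -- An ancestor within sight has a code made with `i`, so its least code involves only nodes
      -- processed up to step `i`, and these are visible on both sides.
      anc : ∀ {j u} → j ≤ J → Anc (parent t) j (σ i) u → name t' σ' (φ u) ≡ name t σ u
      anc {j} {u} le a = trans e' (trans (≤-antisym (min' x (code→ x ex cx)) (min x' (code← x' su ex' cx'))) (sym e))
        where
        su = shown (sight≤ le) (dist-anc {t = t} a)
        spec  = name-spec t σ (coded t σ inj u)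
        spec' = name-spec t' σ' (coded t' σ' inj' (φ u))
        x  = proj₁ spec
        x' = proj₁ spec'
        e = proj₁ (proj₂ spec)
        e' = proj₁ (proj₂ spec')
        cx = proj₁ (proj₂ (proj₂ spec))
        cx' = proj₁ (proj₂ (proj₂ spec'))
        min = proj₂ (proj₂ (proj₂ spec))
        min' = proj₂ (proj₂ (proj₂ spec'))
        own = near le a
        ex : toℕ (quot x) ≤ toℕ i
        ex = early x (proj₁ own) (min _ (proj₂ own))
        ex' : toℕ (quot x') ≤ toℕ i
        ex' = early x' (proj₁ own) (min' _ (code→ _ (early _ (proj₁ own) ≤-refl) (proj₂ own)))
      -- The sibling `c'` may be named after step `i`, and then its name cannot be known. But `c`
      -- has an early name and any smaller name is early too, so the outcome of the comparison is
      -- determined.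
      sib : ∀ {j c p c'} → j ≤ J → Anc (parent t) j (σ i) c → parent t c ≡ just p → parent t c' ≡ just p →
            name t σ c' < name t σ c ⟺ name t' σ' (φ c') < name t' σ' (φ c)
      sib {j} {c} {p} {c'} le a e e' = fwd , bwd
        where
        sc' : Revealed t T σ i c'
        sc' = shown (sib≤ le) (sibling {t} a e e')
        own = near le a
        limit : name t σ c ≤ toℕ (combine i (proj₁ own))
        limit = let _ , eq , _ , min = name-spec t σ (coded t σ inj c) in subst (_≤ toℕ (combine i (proj₁ own))) (sym eq) (min _ (proj₂ own))
        fwd : name t σ c' < name t σ c → name t' σ' (φ c') < name t' σ' (φ c)
        fwd lt with name-spec t σ (coded t σ inj c') | name-spec t' σ' (coded t' σ' inj' (φ c'))
        ... | x , eq , cx , _ | x' , eq' , _ , min' = ≤-<-trans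
              (subst₂ _≤_ (sym eq') (sym eq) (min' x (code→ x (early x (proj₁ own) (subst (_≤ _) eq (≤-trans (<⇒≤ lt) limit))) cx)))
              (subst (name t σ c' <_) (sym (anc le a)) lt)
        bwd : name t' σ' (φ c') < name t' σ' (φ c) → name t σ c' < name t σ c
        bwd lt with name-spec t σ (coded t σ inj c') | name-spec t' σ' (coded t' σ' inj' (φ c'))
        ... | x , eq , _ , min | x' , eq' , cx' , _ = ≤-<-trans
              (subst₂ _≤_ (sym eq) (sym eq') (min x' (code← x' sc'
                (early x' (proj₁ own) (subst (_≤ _) eq' (≤-trans (<⇒≤ lt) (≤-trans (≤-reflexive (anc le a)) limit)))) cx')))
              (subst (name t' σ' (φ c') <_) (anc le a) lt)

-- Polynomials against powers of two

Poly : (ℕ → ℕ) → Set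
Poly f = ∃ λ a → ∃ λ b → ∀ e → f e ≤ a * suc e ^ b

poly-const : ∀ k → Poly (λ _ → k)
poly-const k = k , 0 , λ e → ≤-reflexive (sym (*-identityʳ k))

poly-id : Poly (λ e → e)
poly-id = 1 , 1 , λ e → ≤-trans (n≤1+n e) (≤-reflexive (eq e))
  where
  eq : ∀ e → 1 + e ≡ 1 * ((1 + e) * 1)
  eq = solve-∀

poly-+ : ∀ {f g} → Poly f → Poly g → Poly (λ e → f e + g e)
poly-+ (a , b , p) (a' , b' , p') = a + a' , b + b' , λ e →
  ≤-trans (+-mono-≤ (≤-trans (p e) (*-monoʳ-≤ a (^-monoʳ-≤ (suc e) (m≤m+n b b'))))
                    (≤-trans (p' e) (*-monoʳ-≤ a' (^-monoʳ-≤ (suc e) (m≤n+m b' b)))))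
          (≤-reflexive (sym (*-distribʳ-+ (suc e ^ (b + b')) a a')))

poly-* : ∀ {f g} → Poly f → Poly g → Poly (λ e → f e * g e)
poly-* (a , b , p) (a' , b' , p') = a * a' , b + b' , λ e →
  ≤-trans (*-mono-≤ (p e) (p' e)) (≤-reflexive (trans (eq a a' (suc e ^ b) (suc e ^ b')) (cong (a * a' *_) (sym (^-distribˡ-+-* (suc e) b b')))))
  where
  eq : ∀ a a' x y → a * x * (a' * y) ≡ a * a' * (x * y)
  eq = solve-∀

poly-^ : ∀ {f} → Poly f → ∀ k → Poly (λ e → f e ^ k)
poly-^ p zero    = poly-const 1
poly-^ p (suc k) = poly-* p (poly-^ p k)

suc≤2^ : ∀ k → suc k ≤ 2 ^ k
suc≤2^ zero    = ≤-refl
suc≤2^ (suc k) = ≤-trans (s≤s (suc≤2^ k)) (≤-trans (+-monoˡ-≤ (2 ^ k) (m^n>0 2 k)) (≤-reflexive (2^-double k)))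

abstract
  exponential : ∀ {f} → Poly f → ∃ λ e → f e < 2 ^ e
  exponential (a , b , p) = e , ≤-<-trans (p e) (≤-<-trans
      (≤-trans (*-mono-≤ (≤-trans (n≤1+n a) (suc≤2^ a)) (^-monoˡ-≤ b suc-e))
        (≤-reflexive (trans (cong (2 ^ a *_) (^-*-assoc 2 (suc s) b)) (sym (^-distribˡ-+-* 2 a (suc s * b))))))
      (<-≤-trans (n<1+n _) (≤-trans (double (a + suc s * b)) (^-monoʳ-≤ 2 small))))
    where
    x s e : ℕ
    x = a + b
    -- For `e` a power of two the polynomial is bounded by a power of two, and exponents can be
    -- compared: a quadratic expression in `x` is at most `(1 + x) ^ 3`, which is at most
    -- `2 ^ (3 x) = e`.
    s = x * 3
    e = 2 ^ s
    suc-e : suc e ≤ 2 ^ suc s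
    suc-e = ≤-trans (+-monoˡ-≤ e (m^n>0 2 s)) (≤-reflexive (2^-double s))
    double : ∀ k → suc (2 ^ k) ≤ 2 ^ suc k
    double k = ≤-trans (+-monoˡ-≤ (2 ^ k) (m^n>0 2 k)) (≤-reflexive (2^-double k))
    small : suc (a + suc s * b) ≤ e
    small = ≤-trans (s≤s (+-mono-≤ (m≤m+n a b) (*-monoʳ-≤ (suc s) (m≤n+m b a))))
      (≤-trans (≤-trans (m≤m+n _ (x * x * x + x)) (≤-reflexive (cube x)))
        (≤-trans (^-monoˡ-≤ 3 (suc≤2^ x)) (≤-reflexive (^-*-assoc 2 x 3))))
      where
      cube : ∀ x → 1 + (x + (1 + x * 3) * x) + (x * x * x + x) ≡ (1 + x) * ((1 + x) * ((1 + x) * 1))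
      cube = solve-∀

levelRadius-poly : ∀ {f g} → Poly f → Poly g → Poly (λ e → levelRadius (f e) (g e))
levelRadius-poly {f} {g} pf pg = let a , b , le = poly-* pg (poly-+ pf (poly-+ pf (poly-const 1))) in
  a , b , λ e → ≤-trans (≤-reflexive (closed (f e) (g e))) (le e)
  where
  closed : ∀ m i → levelRadius m i ≡ i * (m + (m + 1))
  closed m zero    = refl
  closed m (suc i) = trans (cong (λ r → m + (m + suc r)) (closed m i)) (eq m (i * (m + (m + 1))))
    where
    eq : ∀ m r → m + (m + (1 + r)) ≡ m + (m + 1) + r
    eq = solve-∀

module _ (K : ℕ) {B Λ : ℕ → ℕ} (pB : Poly B) (pΛ : Poly Λ) where

  window-poly : Poly (λ e → window (B e) K)
  window-poly = poly-+ (poly-+ (poly-const K) cK) (poly-+ cK (poly-const (4 * K)))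
    where
    cK : Poly (λ e → colours (B e) K * K)
    cK = poly-* (poly-^ (poly-+ (poly-const 1) (poly-* (poly-const 2) pB)) K) (poly-const K)

  horizon-poly : Poly (λ e → horizonOf K (B e) (Λ e))
  horizon-poly = poly-+ (poly-* pΛ (poly-+ window-poly window-poly)) (poly-const (suc K))

  sight-poly : Poly (λ e → sightOf K (B e) (Λ e))
  sight-poly = poly-+ horizon-poly (poly-const (K + K + K))

  locality-poly : Poly (λ e → localityOf K (B e) (Λ e))
  locality-poly = poly-+ horizon-poly (poly-+ (poly-const (K + K + K)) (poly-+ (poly-const 2) (levelRadius-poly window-poly pΛ)))

-- Refuting polynomial lower bounds

module _ (δ' : ℕ) where
  open Shapes δ'

  treeOfSize : ∀ m → RTree (suc δ') (suc (m * suc δ'))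
  treeOfSize m = subst (RTree (suc δ')) (trans (size-inner (comb m)) (cong (λ k → suc (k * suc δ')) (inner-comb m))) (shapeTree (comb m))

regularTree : ∀ {δ} → 1 ≤ δ → ∀ m → RTree δ (suc (m * δ))
regularTree {suc δ'} _ m = treeOfSize δ' m

module Refute (Π : LCL) (cert : Labels.Cert Π) where
  open LCL Π
  open Labels.Cert cert using (K)

  private
    Λ size : ℕ → ℕ
    Λ e    = e + suc δ
    size e = suc (2 ^ e * δ)

    pΛ : Poly Λ
    pΛ = poly-+ poly-id (poly-const (suc δ))

    size-small : ∀ e → size e < 2 ^ Λ e
    size-small e = ≤-trans (s≤s (+-monoˡ-≤ (2 ^ e * δ) (m^n>0 2 e))) (≤-trans
      (≤-reflexive (cong suc (sym (*-suc (2 ^ e) δ)))) (≤-trans (s≤s (*-monoʳ-≤ (2 ^ e) (suc≤2^ δ)))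
      (≤-trans (≤-reflexive (cong suc (sym (^-distribˡ-+-* 2 e δ)))) (≤-trans (+-monoˡ-≤ (2 ^ (e + δ)) (m^n>0 2 (e + δ)))
      (≤-reflexive (trans (2^-double (e + δ)) (cong (2 ^_) (sym (+-suc e δ)))))))))

    size-large : ∀ e → 2 ^ e ≤ size e
    size-large e = ≤-trans (m≤m*n (2 ^ e) δ {{>-nonZero δ≥1}}) (n≤1+n _)

  private
    refute-at : ∀ {Solvable : ℕ → ℕ → Set} {p q K' n₀ e T J} → 1 ≤ p →
      (∀ n → n₀ ≤ n → RTree δ n → ∀ T → K' * T ^ q < n ^ p → ¬ Solvable n T) →
      K' * T ^ q + J + n₀ < 2 ^ e → (J < size e → Solvable (size e) T) → ⊥
    refute-at {Solvable} {p} {q} {K'} {n₀} {e} {T} {J} p≥1 hard lt solvable =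
      hard (size e) (≤-trans (m≤n+m n₀ _) (<⇒≤ big)) (regularTree δ≥1 (2 ^ e)) T
        (<-≤-trans (≤-<-trans (≤-trans (m≤m+n _ J) (m≤m+n _ n₀)) big) (n≤n^c (size e) p (s≤s z≤n) p≥1))
        (solvable (≤-<-trans (≤-trans (m≤n+m J _) (m≤m+n _ n₀)) big))
      where
      big : K' * T ^ q + J + n₀ < size e
      big = <-≤-trans lt (size-large e)

  -- One large size suffices for a contradiction. The sizes exceed `2 ^ e` and admit trees, while
  -- the locality is polynomial in `e`.
  refute : ∀ {Solvable B} → Poly B →
    (∀ e → sightOf K (B e) (Λ e) < size e → Solvable (size e) (localityOf K (B e) (Λ e))) → ¬ PolyLowerBound Π Solvable
  refute {Solvable} {B} pB solvable (p , q , K' , n₀ , p≥1 , _ , _ , hard) =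
    let e , lt = exponential (poly-+ (poly-+ (poly-* (poly-const K') (poly-^ (locality-poly K pB pΛ) q)) (sight-poly K pB pΛ)) (poly-const n₀))
    in refute-at {Solvable} {p} {q} {K'} {n₀} {e} {localityOf K (B e) (Λ e)} {sightOf K (B e) (Λ e)} p≥1 hard lt (solvable e)

  refute-local : ∀ c → ¬ PolyLowerBound Π (LOCALSolvable c Π)
  refute-local c = refute {B = B} (poly-+ (poly-const 1) (poly-* pΛ (poly-const c))) λ e _ →
      Upper.local-solvable Π cert (B e) (Λ e) (size-small e) c
        (≤-<-trans (≤-trans (^-monoˡ-≤ c (<⇒≤ (size-small e))) (≤-reflexive (^-*-assoc 2 (Λ e) c)))
          (≤-trans (+-monoˡ-≤ (2 ^ (Λ e * c)) (m^n>0 2 (Λ e * c))) (≤-reflexive (2^-double (Λ e * c)))))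
    where
    B : ℕ → ℕ
    B e = 1 + Λ e * c

  refute-online : ¬ PolyLowerBound Π (OnlineSolvable Π)
  -- Names are below `n * (J + 1)`, and `J < n`, so twice the number of bits for `n` is enough.
  refute-online = refute {B = λ e → Λ e + Λ e} (poly-+ pΛ pΛ) λ e J< →
    Upper.online-solvable Π cert (Λ e + Λ e) (Λ e) (size-small e)
      (≤-trans (*-mono-≤ (<⇒≤ (size-small e)) (≤-trans J< (<⇒≤ (size-small e)))) (≤-reflexive (sym (^-distribˡ-+-* 2 (Λ e) (Λ e)))))

-- The equivalence

bound : ∀ Π → Bound Π
bound record { δ = zero ; δ≥1 = () }
bound record { δ = suc zero ; δ≥1 = δ≥1 ; γ = γ ; C = C } = bound-path γ δ≥1 C
bound record { δ = suc (suc δ'') ; δ≥1 = δ≥1 ; γ = γ ; C = C } = bound-branching δ'' γ δ≥1 C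

lower-bound : ∀ Π {Solvable} → (∀ {n T} → Solvable n T → Player Π n T) → ¬ Labels.Cert Π → PolyLowerBound Π Solvable
lower-bound Π player no-cert = 1 , q , K₀ * 2 ^ q , K₀ , ≤-refl , q≥1 , *-mono-≤ K₀≥1 (m^n>0 2 q) , hard
  where
  open Bound (bound Π)
  -- For `T = 0` the bound on `T` gives nothing useful and the threshold `n₀ = K₀` takes over.
  -- Otherwise `T + 1` is at most `2 T`, which accounts for the factor `2 ^ q`.
  enough : ∀ n T → K₀ ≤ n → K₀ * 2 ^ q * T ^ q < n ^ 1 → K₀ * suc T ^ q ≤ n
  enough n zero    big small = ≤-trans (≤-reflexive (trans (cong (K₀ *_) (^-zeroˡ q)) (*-identityʳ K₀))) big
  enough n (suc T) big small = ≤-trans (≤-trans (*-monoʳ-≤ K₀ (^-monoˡ-≤ q (≤-trans (m≤m+n (suc (suc T)) T) (≤-reflexive (eq T)))))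
      (≤-reflexive (trans (cong (K₀ *_) (*-^ 2 (suc T) q)) (sym (*-assoc K₀ (2 ^ q) (suc T ^ q))))))
      (≤-trans (<⇒≤ small) (≤-reflexive (*-identityʳ n)))
    where
    eq : ∀ T → 2 + T + T ≡ 2 * (1 + T)
    eq = solve-∀
  hard : ∀ n → K₀ ≤ n → RTree (LCL.δ Π) n → ∀ T → K₀ * 2 ^ q * T ^ q < n ^ 1 → ¬ _
  hard n big t T small solved = Labels.dichotomy Π λ
    { (inj₁ cert) → no-cert cert
    ; (inj₂ R)    → no-player R t (enough n T big small) (player solved) }

-- Hardness in one model excludes a certificate, and the absence of a certificate, a condition
-- mentioning no model, makes the other model hard.
theorem5p3 : (Π : LCL) (c : ℕ) → 1 ≤ c →
    PolyLowerBound Π (LOCALSolvable c Π) ⇔ PolyLowerBound Π (OnlineSolvable Π)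
theorem5p3 Π c c≥1 = mk⇔
  (λ hard → lower-bound Π onlinePlayer (λ cert → Refute.refute-local Π cert c hard))
  (λ hard → lower-bound Π (localPlayer c c≥1) (λ cert → Refute.refute-online Π cert hard))
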